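{- Let $H$ be a connected hypergraph and let $f=(f_1,\dots,f_p)\in\mathcal V_p(H)$ with $p\ge 1$ be such that $f_1(v)+f_2(v)+\cdots+f_p(v)\ge d_H(v)$ for all $v\in V(H)$. Then $H$ is not $f$-partitionable if and only if $(H,f)$ is a hard pair.
   Context: A hypergraph $H=(V,E,i)$ consists of finite sets $V=V(H)$ (vertices), $E=E(H)$ (edges) and an incidence function $i=i_H:E\to 2^V$ with $|i(e)|\ge 2$ for every $e\in E$ (parallel edges, i.e. distinct edges with the same incidence set, are allowed). An edge with $|i(e)|=2$ is ordinary. $H'\subseteq H$ (subhypergraph) means $V(H')\subseteq V(H)$, $E(H')\subseteq E(H)$, $i_{H'}=i_H|_{E(H')}$. For $X\subseteq V(H)$, $H[X]$ has vertex set $X$ and edge set $\{e: i_H(e)\subseteq X\}$; induced subhypergraphs are those of this form. The empty hypergraph has no vertices and no edges. The degree $d_H(v)$ is the number of edges $e$ with $v\in i_H(e)$. $H$ is connected if it is nonempty and for every $\emptyset\ne X\subsetneq V(H)$ some edge is incident with a vertex of $X$ and a vertex outside $X$. A vertex $v$ is separating if $H$ is the union of two induced subhypergraphs $H_1,H_2$ with $V(H_1)\cap V(H_2)=\{v\}$ and $|V(H_i)|\ge 2$; a block is a maximal connected subhypergraph without a separating vertex. For $h:V(H)\to\mathbb N_0$, $H$ is strictly $h$-degenerate if every nonempty subhypergraph $G\subseteq H$ has a vertex $v$ with $d_G(v)<h(v)$. $\mathcal V_p(H)$ is the set of functions $f=(f_1,\dots,f_p):V(H)\to\mathbb N_0^p$.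 A $p$-partition of $H$ is a sequence $(H_1,\dots,H_p)$ of pairwise vertex-disjoint induced subhypergraphs (possibly empty) with $V(H_1)\cup\dots\cup V(H_p)=V(H)$; it is an $f$-partition if each $H_i$ is strictly $f_i$-degenerate, and $H$ is $f$-partitionable if an $f$-partition exists. For $t\ge1,n\ge1$, $tK_n$ is the hypergraph on $n$ vertices in which every pair of distinct vertices is joined by exactly $t$ parallel ordinary edges and there are no other edges; for $n\ge3$, $tC_n$ is the cycle of length $n$ with each edge replaced by $t$ parallel ordinary edges. Merging: if $H^1,H^2$ are disjoint hypergraphs, $v^1\in V(H^1)$, $v^2\in V(H^2)$, the hypergraph obtained by merging $v^1$ and $v^2$ to a new vertex $v^*$ has vertex set $((V(H^1)\cup V(H^2))\setminus\{v^1,v^2\})\cup\{v^*\}$, edge set $E(H^1)\cup E(H^2)$, and incidences inherited from $H^1,H^2$ with $v^1$, $v^2$ replaced by $v^*$. Hard pairs: for connected $H$ and $f\in\mathcal V_p(H)$, $(H,f)$ is a hard pair ($H$ is $f$-hard) if one of the following holds: (M) $H$ is a block and there is $j$ with $f_j(v)=d_H(v)$ and $f_i(v)=0$ for all $i\ne j$ and all $v$; (K) $H=tK_n$ with $t\ge1$, $n\ge3$, and there are integers $n_1,\dots,n_p\ge0$, at least two nonzero, with $n_1+\dots+n_p=n-1$ and $f(v)=(tn_1,\dots,tn_p)$ for all $v$; (C) $H=tC_n$ with $t\ge1$, $n\ge5$ odd, and there are indices $k\ne\ell$ with $f_k(v)=f_\ell(v)=t$ and $f_i(v)=0$ for $i\notin\{k,\ell\}$,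 for all $v$; or (merge) there are hard pairs $(H^1,f^1)$, $(H^2,f^2)$ with $f^j\in\mathcal V_p(H^j)$ such that $H$ is obtained by merging $v^1\in V(H^1)$ and $v^2\in V(H^2)$ to $v^*$, and $f=f^1$ on $V(H^1)\setminus\{v^1\}$, $f=f^2$ on $V(H^2)\setminus\{v^2\}$, $f(v^*)=f^1(v^1)+f^2(v^2)$. -}

module Defs where

open import Data.Nat using (ℕ; zero; suc; _+_; _*_; _∸_; _≤_; _<_)
open import Data.Fin using (Fin; zero; suc; toℕ)
open import Data.Fin.Subset using (Subset; ∣_∣; ⁅_⁆; _∪_)
open import Data.Vec using (lookup)
open import Data.Vec.Properties using (≡-dec)
open import Data.Bool using (Bool; true; false; if_then_else_; _∧_)
open import Data.Bool.Properties renaming (_≟_ to _≟B_)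
open import Data.Product using (Σ; ∃; ∃-syntax; _×_; _,_)
open import Data.Sum using (_⊎_; inj₁; inj₂)
open import Relation.Nullary using (¬_)
open import Data.Empty using (⊥)
open import Relation.Nullary.Decidable using (isYes)
open import Relation.Binary.PropositionalEquality using (_≡_; _≢_)
open import Function.Bundles using (_↔_; Inverse)

count : ∀ {m} → (Fin m → Bool) → ℕ
count {zero}  b = 0
count {suc m} b = (if b zero then 1 else 0) + count (λ k → b (suc k))

sumFin : ∀ {p} → (Fin p → ℕ) → ℕ
sumFin {zero}  g = 0
sumFin {suc p} g = g zero + sumFin (λ i → g (suc i))

record Hypergraph : Set where
  field
    nV       : ℕ
    nE       : ℕ
    inc      : Fin nE → Subset nV
    inc-size : ∀ e → 2 ≤ ∣ inc e ∣

open Hypergraph public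

_∈ₛ_ : ∀ {n} → Fin n → Subset n → Set
v ∈ₛ X = lookup X v ≡ true

_⊆ₛ_ : ∀ {n} → Subset n → Subset n → Set
X ⊆ₛ Y = ∀ v → v ∈ₛ X → v ∈ₛ Y

deg : (H : Hypergraph) → Fin (nV H) → ℕ
deg H v = count (λ e → lookup (inc H e) v)

degIn : (H : Hypergraph) → Subset (nE H) → Fin (nV H) → ℕ
degIn H F v = count (λ e → lookup F e ∧ lookup (inc H e) v)

IsSub : (H : Hypergraph) → Subset (nV H) → Subset (nE H) → Set
IsSub H Y F = ∀ e → e ∈ₛ F → inc H e ⊆ₛ Y

-- The induced subhypergraph H[X] is strictly h-degenerate (h : X → ℕ,
-- given as a function on all of V(H), only its values on X matter):
-- every nonempty subhypergraph G ⊆ H[X] has a vertex v with d_G(v) < h(v).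
-- Subhypergraphs of H[X] are exactly the subhypergraphs (Y , F) of H
-- with Y ⊆ X.
StrictlyDegenerateInduced : (H : Hypergraph) → Subset (nV H) → (Fin (nV H) → ℕ) → Set
StrictlyDegenerateInduced H X h =
  ∀ (Y : Subset (nV H)) (F : Subset (nE H)) →
    Y ⊆ₛ X → IsSub H Y F → (∃[ u ] u ∈ₛ Y) →
    ∃[ v ] (v ∈ₛ Y × degIn H F v < h v)

VFun : ℕ → Hypergraph → Set
VFun p H = Fin (nV H) → Fin p → ℕ

record Partition (p : ℕ) (H : Hypergraph) : Set where
  field
    parts    : Fin p → Subset (nV H)
    disjoint : ∀ i j v → i ≢ j → v ∈ₛ parts i → v ∈ₛ parts j → ⊥
    cover    : ∀ v → ∃[ i ] (v ∈ₛ parts i)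

IsFPartition : ∀ {p} (H : Hypergraph) → VFun p H → Partition p H → Set
IsFPartition H f P = ∀ i → StrictlyDegenerateInduced H (Partition.parts P i) (λ v → f v i)

Partitionable : ∀ {p} (H : Hypergraph) → VFun p H → Set
Partitionable {p} H f = Σ (Partition p H) (IsFPartition H f)

Connected : Hypergraph → Set
Connected H =
  (0 < nV H) ×
  (∀ (X : Subset (nV H)) → (∃[ u ] u ∈ₛ X) → (∃[ u ] ¬ (u ∈ₛ X)) →
     ∃[ e ] ∃[ u ] ∃[ w ]
       (u ∈ₛ inc H e × u ∈ₛ X × w ∈ₛ inc H e × ¬ (w ∈ₛ X)))

-- v is separating: H = H[X₁] ∪ H[X₂] with V(H[X₁]) ∩ V(H[X₂]) = {v}
-- and |X₁|, |X₂| ≥ 2.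
Separating : (H : Hypergraph) → Fin (nV H) → Set
Separating H v =
  ∃[ X₁ ] ∃[ X₂ ]
    ((∀ u → u ∈ₛ X₁ ⊎ u ∈ₛ X₂) ×
     (∀ u → u ∈ₛ X₁ → u ∈ₛ X₂ → u ≡ v) ×
     v ∈ₛ X₁ × v ∈ₛ X₂ ×
     2 ≤ ∣ X₁ ∣ × 2 ≤ ∣ X₂ ∣ ×
     (∀ e → inc H e ⊆ₛ X₁ ⊎ inc H e ⊆ₛ X₂))

IsBlock : Hypergraph → Set
IsBlock H = Connected H × (∀ v → ¬ Separating H v)

pair : ∀ {n} → Fin n → Fin n → Subset n
pair u w = ⁅ u ⁆ ∪ ⁅ w ⁆

mult : (H : Hypergraph) → Fin (nV H) → Fin (nV H) → ℕ
mult H u w = count (λ e → isYes (≡-dec _≟B_ (inc H e) (pair u w)))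

Ordinary : (H : Hypergraph) → Set
Ordinary H = ∀ e → ∣ inc H e ∣ ≡ 2

IsTK : Hypergraph → ℕ → Set
IsTK H t = Ordinary H × (∀ u w → u ≢ w → mult H u w ≡ t)

CycAdj : ∀ {n} → Fin n → Fin n → Set
CycAdj {n} i j =
  suc (toℕ i) ≡ toℕ j ⊎ suc (toℕ j) ≡ toℕ i ⊎
  (toℕ i ≡ 0 × suc (toℕ j) ≡ n) ⊎ (toℕ j ≡ 0 × suc (toℕ i) ≡ n)

IsTC : Hypergraph → ℕ → Set
IsTC H t =
  Ordinary H ×
  Σ (Fin (nV H) ↔ Fin (nV H)) λ σ →
    let s = Inverse.to σ in
    ∀ i j → i ≢ j →
      (CycAdj i j → mult H (s i) (s j) ≡ t) ×
      (¬ CycAdj i j → mult H (s i) (s j) ≡ 0)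

Odd : ℕ → Set
Odd n = ∃[ k ] n ≡ suc (2 * k)

-- Merging: H is obtained (up to isomorphism) from disjoint copies of
-- H₁, H₂ by merging v₁ ∈ V(H₁) and v₂ ∈ V(H₂) into the vertex w of H.

record MergeOf (H₁ : Hypergraph) (v₁ : Fin (nV H₁))
               (H₂ : Hypergraph) (v₂ : Fin (nV H₂))
               (H : Hypergraph) (w : Fin (nV H)) : Set where
  field
    φ₁      : Fin (nV H₁) → Fin (nV H)
    φ₂      : Fin (nV H₂) → Fin (nV H)
    φ₁-inj  : ∀ x y → φ₁ x ≡ φ₁ y → x ≡ y
    φ₂-inj  : ∀ x y → φ₂ x ≡ φ₂ y → x ≡ y
    φ₁-v    : φ₁ v₁ ≡ w
    φ₂-v    : φ₂ v₂ ≡ w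
    meet    : ∀ x y → φ₁ x ≡ φ₂ y → x ≡ v₁
    cover   : ∀ u → (∃[ x ] φ₁ x ≡ u) ⊎ (∃[ y ] φ₂ y ≡ u)
    ψ       : (Fin (nE H₁) ⊎ Fin (nE H₂)) ↔ Fin (nE H)
    inc₁    : ∀ e x → lookup (inc H (Inverse.to ψ (inj₁ e))) (φ₁ x) ≡ lookup (inc H₁ e) x
    inc₁-im : ∀ e u → u ∈ₛ inc H (Inverse.to ψ (inj₁ e)) → ∃[ x ] φ₁ x ≡ u
    inc₂    : ∀ e y → lookup (inc H (Inverse.to ψ (inj₂ e))) (φ₂ y) ≡ lookup (inc H₂ e) y
    inc₂-im : ∀ e u → u ∈ₛ inc H (Inverse.to ψ (inj₂ e)) → ∃[ y ] φ₂ y ≡ u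

data Hard (p : ℕ) : (H : Hypergraph) → VFun p H → Set where
  hard-M : ∀ (H : Hypergraph) (f : VFun p H) (j : Fin p) →
    IsBlock H →
    (∀ v → f v j ≡ deg H v) →
    (∀ v i → i ≢ j → f v i ≡ 0) →
    Hard p H f
  hard-K : ∀ (H : Hypergraph) (f : VFun p H) (t : ℕ) (ns : Fin p → ℕ) →
    1 ≤ t → 3 ≤ nV H → IsTK H t →
    (∃[ j ] ∃[ k ] (j ≢ k × ns j ≢ 0 × ns k ≢ 0)) →
    sumFin ns ≡ nV H ∸ 1 →
    (∀ v i → f v i ≡ t * ns i) →
    Hard p H f
  hard-C : ∀ (H : Hypergraph) (f : VFun p H) (t : ℕ) (k l : Fin p) →
    1 ≤ t → 5 ≤ nV H → Odd (nV H) → IsTC H t → k ≢ l →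
    (∀ v → f v k ≡ t) → (∀ v → f v l ≡ t) →
    (∀ v i → i ≢ k → i ≢ l → f v i ≡ 0) →
    Hard p H f
  hard-merge : ∀ (H₁ : Hypergraph) (f₁ : VFun p H₁) (v₁ : Fin (nV H₁))
                 (H₂ : Hypergraph) (f₂ : VFun p H₂) (v₂ : Fin (nV H₂))
                 (H : Hypergraph) (f : VFun p H) (w : Fin (nV H)) →
    Hard p H₁ f₁ → Hard p H₂ f₂ →
    (m : MergeOf H₁ v₁ H₂ v₂ H w) →
    (∀ x → x ≢ v₁ → ∀ i → f (MergeOf.φ₁ m x) i ≡ f₁ x i) →
    (∀ y → y ≢ v₂ → ∀ i → f (MergeOf.φ₂ m y) i ≡ f₂ y i) →
    (∀ i → f w i ≡ f₁ v₁ i + f₂ v₂ i) →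
    Hard p H f

{-# OPTIONS --safe #-}

-- Suppose that H has no f-partition. A good colouring of V(H) − v, with a "token" on v, is one whose
-- classes are strictly fᵢ-degenerate. Since v cannot be coloured, exactly fᵢ(v) edges at v have
-- colour i off v, and every edge at v is monochromatic off v; hence the token may be moved to any
-- neighbour u, where v takes over the colour of u.
-- At a separating vertex v the edge counts on the two sides split f(v), and both sides stay
-- unpartitionable. In a block either every reachable colouring uses one colour, or token excursions
-- bring two colours to any two neighbours of any vertex. Then all edges are ordinary, there is no
-- induced diamond, and moving the token around an induced cycle of length at least 4 forces this
-- cycle to be odd and spanning. Without such cycles the graph is complete.
module Submission where

open import Defs
open import Data.Nat
open import Data.Nat.Properties
open import Data.Nat.DivMod using (m≡m%n+[m/n]*n; m%n<n; [m+n]%n≡m%n; [m+kn]%n≡m%n; m<n⇒m%n≡m)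
open import Data.Nat.Induction using (<-rec)
open import Data.Fin using (Fin; zero; suc; toℕ; fromℕ<)
import Data.Fin.Properties as FinP
open import Data.Fin.Subset using (Subset; ∣_∣; ⁅_⁆) renaming (⊥ to ∅)
open import Data.Fin.Subset.Properties using (x∈⁅y⁆⇒x≡y; x∈⁅x⁆; x∈p∪q⁻; x∈p∪q⁺; ∉⊥; anySubset?)
open import Data.Vec using (lookup; tabulate; []; _∷_)
open import Data.Vec.Properties using (lookup∘tabulate; tabulate∘lookup; tabulate-cong; lookup⇒[]=; []=⇒lookup; ≡-dec)
open import Data.Bool using (Bool; true; false; if_then_else_)
open import Data.Bool.Properties using () renaming (_≟_ to _≟B_)
open import Data.Product
open import Data.Sum as Sum using (_⊎_; inj₁; inj₂; [_,_]′)
open import Data.Sum.Properties using (inj₁-injective; inj₂-injective)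
open import Data.Empty using (⊥; ⊥-elim)
open import Data.Unit using (⊤; tt)
open import Relation.Nullary
open import Relation.Nullary.Decidable
open import Relation.Unary using (Pred; Decidable)
open import Relation.Binary.Definitions using (tri<; tri≈; tri>)
open import Relation.Binary.PropositionalEquality
open import Level using (0ℓ)
open import Function using (_∘_; id)
open import Function.Bundles using (Inverse; _↔_; mk↔ₛ′; _⇔_; mk⇔)

-- Everything rests on one rigidity: two good colourings with the token on the same vertex v give
-- every colour i the same number of edges at v, namely the value of f at v. A closed tour of the
-- token changes the colours near v in a known way, so comparing before and after yields equations
-- between colours or between edge multiplicities. Such a comparison says something only if the
-- neighbours concerned differ in colour, while the two colours at hand may sit far away. So the
-- contrast is concentrated: it is passed from the whole vertex set to smaller linked sets, one
-- vertex d at a time, as long as three vertices remain. The token leaves the smaller set through d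
-- and, as no vertex separates, re-enters elsewhere; the colour of d is thereby carried into the
-- set. The final set is v with two of its neighbours. For the converse, call a set of vertices of
-- colour i bad if each of them has at least its i-th value of f many edges inside the set. The
-- three basic families always force a bad set. Under merging, a bad set of one side is bad in the
-- whole unless it contains the merged vertex; hence bad sets of the two sides have the same colour
-- and unite to a bad set.

isTrue? : (b : Bool) → Dec (b ≡ true)
-- `does` computes to `b` itself, so `# (_∋? v)` is `deg H v`, and a conjunction of such tests
-- counts `degIn`, by computation alone.
does  (isTrue? b)     = b
proof (isTrue? true)  = ofʸ refl
proof (isTrue? false) = ofⁿ λ ()

⊤? : ∀ {n} → Decidable (λ (x : Fin n) → ⊤)
⊤? _ = yes tt

-- Counting over finite sets

infix 8 #_
infixl 9 _∩?_ _∪?_ _─?_ _∖?_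

_∩?_ : ∀ {m} {P Q : Pred (Fin m) 0ℓ} → Decidable P → Decidable Q → Decidable (λ x → P x × Q x)
(P? ∩? Q?) x = P? x ×-dec Q? x

_∪?_ : ∀ {n} {P Q : Pred (Fin n) 0ℓ} → Decidable P → Decidable Q → Decidable (λ x → P x ⊎ Q x)
(P? ∪? Q?) x = P? x ⊎-dec Q? x

_─?_ : ∀ {m} {P Q : Pred (Fin m) 0ℓ} → Decidable P → Decidable Q → Decidable (λ x → P x × ¬ Q x)
(P? ─? Q?) x = P? x ×-dec ¬? (Q? x)

_∖?_ : ∀ {m} {P : Pred (Fin m) 0ℓ} → Decidable P → ∀ a → Decidable (λ x → P x × x ≢ a)
(P? ∖? a) x = P? x ×-dec ¬? (x FinP.≟ a)

#_ : ∀ {m} {P : Pred (Fin m) 0ℓ} → Decidable P → ℕ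
# P? = count (λ x → does (P? x))

count-cong : ∀ {m} {b c : Fin m → Bool} → (∀ x → b x ≡ c x) → count b ≡ count c
count-cong {zero}  eq = refl
count-cong {suc m} eq = cong₂ (λ h t → (if h then 1 else 0) + t) (eq zero) (count-cong (eq ∘ suc))

#-split : ∀ {m} {P Q : Pred (Fin m) 0ℓ} (P? : Decidable P) (Q? : Decidable Q) →
  # P? ≡ # (P? ∩? Q?) + # (P? ─? Q?)
#-split {zero}  P? Q? = refl
#-split {suc m} P? Q? with does (P? zero) | does (Q? zero) | #-split (P? ∘ suc) (Q? ∘ suc)
... | false | _     | ih = ih
... | true  | true  | ih = cong suc ih
... | true  | false | ih = trans (cong suc ih) (sym (+-suc _ _))

#-zero : ∀ {m} {P : Pred (Fin m) 0ℓ} (P? : Decidable P) → (∀ x → ¬ P x) → # P? ≡ 0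
#-zero {zero}  P? ¬P = refl
#-zero {suc m} P? ¬P with P? zero
... | yes p = ⊥-elim (¬P zero p)
... | no  _ = #-zero (P? ∘ suc) (¬P ∘ suc)

#-mono : ∀ {m} {P Q : Pred (Fin m) 0ℓ} (P? : Decidable P) (Q? : Decidable Q) →
  (∀ x → P x → Q x) → # P? ≤ # Q?
#-mono {zero}  P? Q? P⊆Q = z≤n
#-mono {suc m} P? Q? P⊆Q with P? zero | Q? zero
... | yes p | yes _ = s≤s (#-mono (P? ∘ suc) (Q? ∘ suc) (P⊆Q ∘ suc))
... | yes p | no ¬q = ⊥-elim (¬q (P⊆Q zero p))
... | no _  | yes _ = m≤n⇒m≤1+n (#-mono (P? ∘ suc) (Q? ∘ suc) (P⊆Q ∘ suc))
... | no _  | no _  = #-mono (P? ∘ suc) (Q? ∘ suc) (P⊆Q ∘ suc)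

#-cong : ∀ {m} {P Q : Pred (Fin m) 0ℓ} (P? : Decidable P) (Q? : Decidable Q) →
  (∀ x → P x → Q x) → (∀ x → Q x → P x) → # P? ≡ # Q?
#-cong P? Q? P⊆Q Q⊆P = ≤-antisym (#-mono P? Q? P⊆Q) (#-mono Q? P? Q⊆P)

#-all : ∀ {m} {P : Pred (Fin m) 0ℓ} (P? : Decidable P) → (∀ x → P x) → # P? ≡ m
#-all {zero}  P? all = refl
#-all {suc m} P? all with P? zero
... | yes _ = cong suc (#-all (P? ∘ suc) (all ∘ suc))
... | no ¬p = ⊥-elim (¬p (all zero))

#-suc : ∀ {m} {P : Pred (Fin m) 0ℓ} (P? : Decidable P) {a} → P a →
  # P? ≡ suc (# (P? ∖? a))
#-suc {P = P} P? {a} pa =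
  trans (#-split P? (FinP._≟ a)) (cong (_+ # (P? ∖? a)) (single a P? pa))
  where
  single : ∀ {m} a {P : Pred (Fin m) 0ℓ} (P? : Decidable P) → P a → # (P? ∩? (FinP._≟ a)) ≡ 1
  single zero P? p with P? zero
  ... | yes _ = cong suc (#-zero ((P? ∩? (FinP._≟ zero)) ∘ suc) λ { x (_ , ()) })
  ... | no ¬p = ⊥-elim (¬p p)
  single (suc a) P? p with does (P? zero)
  ... | true = trans (#-cong ((P? ∩? (FinP._≟ suc a)) ∘ suc) ((P? ∘ suc) ∩? (FinP._≟ a))
                     (λ x → map₂ FinP.suc-injective) (λ x → map₂ (cong suc))) (single a (P? ∘ suc) p)
  ... | false = trans (#-cong ((P? ∩? (FinP._≟ suc a)) ∘ suc) ((P? ∘ suc) ∩? (FinP._≟ a))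
                     (λ x → map₂ FinP.suc-injective) (λ x → map₂ (cong suc))) (single a (P? ∘ suc) p)

#-≡0⇒¬ : ∀ {m} {P : Pred (Fin m) 0ℓ} (P? : Decidable P) → # P? ≡ 0 → ∀ x → ¬ P x
#-≡0⇒¬ P? eq x p with () ← trans (sym eq) (#-suc P? p)

#-pos : ∀ {m} {P : Pred (Fin m) 0ℓ} (P? : Decidable P) → 0 < # P? → ∃ P
#-pos P? 0<# with FinP.any? P?
... | yes x∈P = x∈P
... | no  ¬∃P = ⊥-elim (<-irrefl (sym (#-zero P? λ x p → ¬∃P (x , p))) 0<#)

#-strict : ∀ {m} {P Q : Pred (Fin m) 0ℓ} (P? : Decidable P) (Q? : Decidable Q) →
  (∀ x → P x → Q x) → ∀ {a} → Q a → ¬ P a → # P? < # Q?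
#-strict P? Q? P⊆Q {a} qa ¬pa = subst (# P? <_) (sym (#-suc Q? qa))
  (s≤s (#-mono P? (Q? ∖? a) λ x p → P⊆Q x p , λ { refl → ¬pa p }))

-- Each step removes the image of the first element from `Q`. The map may use the membership proof,
-- which suits maps such as `index` that exist only on members.
#-injection : ∀ {m n} {P : Pred (Fin m) 0ℓ} {Q : Pred (Fin n) 0ℓ} (P? : Decidable P) (Q? : Decidable Q)
  (g : ∀ x → P x → Fin n) → (∀ x p → Q (g x p)) →
  (∀ x y p q → g x p ≡ g y q → x ≡ y) → # P? ≤ # Q?
#-injection {zero}  P? Q? g g∈Q inj = z≤n
#-injection {suc m} P? Q? g g∈Q inj with P? zero
... | no _  = #-injection (P? ∘ suc) Q? (g ∘ suc) (g∈Q ∘ suc)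
                (λ x y p q eq → FinP.suc-injective (inj (suc x) (suc y) p q eq))
... | yes p = subst (suc (# (P? ∘ suc)) ≤_) (sym (#-suc Q? (g∈Q zero p)))
  (s≤s (#-injection (P? ∘ suc) (Q? ∖? g zero p) (g ∘ suc)
    (λ x q → g∈Q (suc x) q , λ eq → FinP.0≢1+n (sym (inj (suc x) zero q p eq)))
    (λ x y p q eq → FinP.suc-injective (inj (suc x) (suc y) p q eq))))

#-two : ∀ {m} {P : Pred (Fin m) 0ℓ} (P? : Decidable P) → ∀ {x y} → x ≢ y → P x → P y → 2 ≤ # P?
#-two P? {x} {y} x≢y px py = subst (2 ≤_) (sym (trans (#-suc P? px)
  (cong suc (#-suc (P? ∖? x) (py , λ y≡x → x≢y (sym y≡x)))))) (s≤s (s≤s z≤n))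

#-other : ∀ {m} {P : Pred (Fin m) 0ℓ} (P? : Decidable P) → 2 ≤ # P? → ∀ a → ∃ λ x → x ≢ a × P x
#-other {P = P} P? 2≤# a with FinP.any? (λ x → ¬? (x FinP.≟ a) ×-dec P? x)
... | yes found = found
... | no ¬found = ⊥-elim (<-irrefl refl (≤-trans 2≤# (≤-trans (#-mono P? (FinP._≟ a) only-a) single≤1)))
  where
  only-a : ∀ x → P x → x ≡ a
  only-a x p with x FinP.≟ a
  ... | yes eq = eq
  ... | no neq = ⊥-elim (¬found (x , neq , p))
  single≤1 : # (FinP._≟ a) ≤ 1
  single≤1 = ≤-reflexive (trans (#-suc (FinP._≟ a) refl)
    (cong suc (#-zero ((FinP._≟ a) ∖? a) λ { x (eq , neq) → neq eq })))

#-third : ∀ {m} {P : Pred (Fin m) 0ℓ} (P? : Decidable P) → 3 ≤ # P? → ∀ a b → ∃ λ x → x ≢ a × x ≢ b × P x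
#-third P? 3≤# a b with P? a
... | no ¬pa with #-other P? (≤-trans (s≤s (s≤s z≤n)) 3≤#) b
...   | x , x≢b , px = x , (λ { refl → ¬pa px }) , x≢b , px
#-third P? 3≤# a b | yes pa
  with #-other (P? ∖? a) (s≤s⁻¹ (subst (3 ≤_) (#-suc P? pa) 3≤#)) b
... | x , x≢b , px , x≢a = x , x≢a , x≢b , px

#-three : ∀ {m} {P : Pred (Fin m) 0ℓ} (P? : Decidable P) → ∀ {x y z} → x ≢ y → x ≢ z → y ≢ z →
  P x → P y → P z → 3 ≤ # P?
#-three P? {x} x≢y x≢z y≢z px py pz = subst (3 ≤_) (sym (#-suc P? px))
  (s≤s (#-two (P? ∖? x) y≢z (py , x≢y ∘ sym) (pz , x≢z ∘ sym)))

#-guard : ∀ {m t} {A : Set} {P : Pred (Fin m) 0ℓ} (A? : Dec A) (P? : Decidable P) → (A → # P? ≡ t) →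
  # (λ x → A? ×-dec P? x) ≡ (if does A? then t else 0)
#-guard (yes a) P? eq = trans (#-cong (λ x → yes a ×-dec P? x) P? (λ x → proj₂) (λ x → a ,_)) (eq a)
#-guard (no ¬a) P? eq = #-zero (λ x → no ¬a ×-dec P? x) λ x → ¬a ∘ proj₁

sumFin-mono : ∀ {p} {g h : Fin p → ℕ} → (∀ i → g i ≤ h i) → sumFin g ≤ sumFin h
sumFin-mono {zero}  g≤h = z≤n
sumFin-mono {suc p} g≤h = +-mono-≤ (g≤h zero) (sumFin-mono (g≤h ∘ suc))

sumFin-cong : ∀ {p} {g h : Fin p → ℕ} → (∀ i → g i ≡ h i) → sumFin g ≡ sumFin h
sumFin-cong {zero}  g≡h = refl
sumFin-cong {suc p} g≡h = cong₂ _+_ (g≡h zero) (sumFin-cong (g≡h ∘ suc))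

sumFin-<⇒∃< : ∀ {p} {g h : Fin p → ℕ} → sumFin g < sumFin h → ∃ λ i → g i < h i
sumFin-<⇒∃< {p} {g} {h} lt with FinP.any? (λ i → g i <? h i)
... | yes found = found
... | no ¬found = ⊥-elim (<⇒≱ lt (sumFin-mono λ i → ≮⇒≥ λ g<h → ¬found (i , g<h)))

-- One strict inequality would make the whole sum strictly smaller. This turns the degree bound on
-- `f` into exact values.
sumFin-≤⇒≡ : ∀ {p} {g h : Fin p → ℕ} → (∀ i → g i ≤ h i) → sumFin h ≤ sumFin g → ∀ i → g i ≡ h i
sumFin-≤⇒≡ {g = g} {h} g≤h Σh≤Σg i with g i <? h i
... | no  g≮h = ≤-antisym (g≤h i) (≮⇒≥ g≮h)
... | yes g<h = ⊥-elim (<⇒≱ (strict g≤h i g<h) Σh≤Σg)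
  where
  strict : ∀ {p} {g h : Fin p → ℕ} → (∀ i → g i ≤ h i) → ∀ i → g i < h i → sumFin g < sumFin h
  strict g≤h zero    lt = +-mono-<-≤ lt (sumFin-mono (g≤h ∘ suc))
  strict g≤h (suc i) lt = +-mono-≤-< (g≤h zero) (strict (g≤h ∘ suc) i lt)

Σ#-≤ : ∀ {p m} {P : Fin p → Pred (Fin m) 0ℓ} {Q : Pred (Fin m) 0ℓ}
  (P? : ∀ i → Decidable (P i)) (Q? : Decidable Q) → (∀ i x → P i x → Q x) →
  (∀ i j x → P i x → P j x → i ≡ j) → sumFin (λ i → # (P? i)) ≤ # Q?
Σ#-≤ {zero}  P? Q? P⊆Q disj = z≤n
Σ#-≤ {suc p} P? Q? P⊆Q disj = subst (sumFin (λ i → # (P? i)) ≤_) (sym (#-split Q? (P? zero)))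
  (+-mono-≤ (#-mono (P? zero) (Q? ∩? P? zero) λ x p → P⊆Q zero x p , p)
    (Σ#-≤ (P? ∘ suc) (Q? ─? P? zero)
      (λ i x p → P⊆Q (suc i) x p , λ p₀ → FinP.0≢1+n (disj zero (suc i) x p₀ p))
      (λ i j x p q → FinP.suc-injective (disj (suc i) (suc j) x p q))))

Σ#-≥ : ∀ {p m} {P : Fin p → Pred (Fin m) 0ℓ} {Q : Pred (Fin m) 0ℓ}
  (P? : ∀ i → Decidable (P i)) (Q? : Decidable Q) → (∀ x → Q x → ∃ λ i → P i x) →
  # Q? ≤ sumFin (λ i → # (P? i))
Σ#-≥ {zero}  P? Q? cov = ≤-reflexive (#-zero Q? λ x q → FinP.¬Fin0 (proj₁ (cov x q)))
Σ#-≥ {suc p} {P = P} {Q = Q} P? Q? cov = subst (_≤ sumFin (λ i → # (P? i))) (sym (#-split Q? (P? zero)))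
  (+-mono-≤ (#-mono (Q? ∩? P? zero) (P? zero) λ x → proj₂) (Σ#-≥ (P? ∘ suc) (Q? ─? P? zero) cov′))
  where
  cov′ : ∀ x → Q x × ¬ P zero x → ∃ λ i → P (suc i) x
  cov′ x (q , ¬p₀) with cov x q
  ... | zero  , p₀ = ⊥-elim (¬p₀ p₀)
  ... | suc i , pᵢ = i , pᵢ

Σ#-< : ∀ {p m} {P : Fin p → Pred (Fin m) 0ℓ} {Q : Pred (Fin m) 0ℓ}
  (P? : ∀ i → Decidable (P i)) (Q? : Decidable Q) → (∀ i x → P i x → Q x) →
  (∀ i j x → P i x → P j x → i ≡ j) → ∀ {a} → Q a → (∀ i → ¬ P i a) → sumFin (λ i → # (P? i)) < # Q?
Σ#-< P? Q? P⊆Q disj {a} qa ¬pa = subst (sumFin (λ i → # (P? i)) <_) (sym (#-suc Q? qa))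
  (s≤s (Σ#-≤ P? (Q? ∖? a) (λ i x p → P⊆Q i x p , λ { refl → ¬pa i p }) disj))

sumFin-if : ∀ {m} {P : Pred (Fin m) 0ℓ} (P? : Decidable P) t →
  sumFin (λ x → if does (P? x) then t else 0) ≡ t * # P?
sumFin-if {zero}  P? t = sym (*-zeroʳ t)
sumFin-if {suc m} P? t with does (P? zero)
... | true  = trans (cong (t +_) (sumFin-if (P? ∘ suc) t)) (sym (*-suc t _))
... | false = sumFin-if (P? ∘ suc) t

_∈?ₛ_ : ∀ {n} (v : Fin n) (X : Subset n) → Dec (v ∈ₛ X)
v ∈?ₛ X = isTrue? (lookup X v)

⟦_⟧ : ∀ {n} {P : Pred (Fin n) 0ℓ} → Decidable P → Subset n
⟦ P? ⟧ = tabulate (λ x → does (P? x))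

does-true : {A : Set} (A? : Dec A) → A → does A? ≡ true
does-true (yes _) a = refl
does-true (no ¬a) a = ⊥-elim (¬a a)

true-does : {A : Set} (A? : Dec A) → does A? ≡ true → A
true-does (yes a) _ = a

∈⟦⟧⁺ : ∀ {n} {P : Pred (Fin n) 0ℓ} (P? : Decidable P) {x} → P x → x ∈ₛ ⟦ P? ⟧
∈⟦⟧⁺ P? {x} p = trans (lookup∘tabulate _ x) (does-true (P? x) p)

∈⟦⟧⁻ : ∀ {n} {P : Pred (Fin n) 0ℓ} (P? : Decidable P) {x} → x ∈ₛ ⟦ P? ⟧ → P x
∈⟦⟧⁻ P? {x} x∈ = true-does (P? x) (trans (sym (lookup∘tabulate _ x)) x∈)

∣∣≡# : ∀ {n} (X : Subset n) → ∣ X ∣ ≡ # (_∈?ₛ X)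
∣∣≡# []          = refl
∣∣≡# (true ∷ X)  = cong suc (∣∣≡# X)
∣∣≡# (false ∷ X) = ∣∣≡# X

infixl 10 _[_≔_]

_[_≔_] : ∀ {n} {A : Set} → (Fin n → A) → Fin n → A → Fin n → A
(φ [ u ≔ c ]) x = if does (x FinP.≟ u) then c else φ x

≔-≡ : ∀ {n} {A : Set} (φ : Fin n → A) u c → (φ [ u ≔ c ]) u ≡ c
≔-≡ φ u c with u FinP.≟ u
... | yes _  = refl
... | no u≢u = ⊥-elim (u≢u refl)

≔-≢ : ∀ {n} {A : Set} (φ : Fin n → A) {u} c {x} → x ≢ u → (φ [ u ≔ c ]) x ≡ φ x
≔-≢ φ {u} c {x} x≢u with x FinP.≟ u
... | yes x≡u = ⊥-elim (x≢u x≡u)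
... | no _    = refl

-- Edges at a vertex and strict degeneracy

module Edges (H : Hypergraph) where

  _∋_ : Fin (nE H) → Fin (nV H) → Set
  e ∋ v = v ∈ₛ inc H e

  _∋?_ : ∀ e v → Dec (e ∋ v)
  e ∋? v = v ∈?ₛ inc H e

  Adj : Fin (nV H) → Fin (nV H) → Set
  Adj u w = u ≢ w × ∃ λ e → e ∋ u × e ∋ w

  Adj? : ∀ u w → Dec (Adj u w)
  Adj? u w = ¬? (u FinP.≟ w) ×-dec FinP.any? (λ e → (e ∋? u) ×-dec (e ∋? w))

  Adj-sym : ∀ {u w} → Adj u w → Adj w u
  Adj-sym (u≢w , e , e∋u , e∋w) = u≢w ∘ sym , e , e∋w , e∋u

  other-end : ∀ e v → ∃ λ w → w ≢ v × e ∋ w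
  other-end e v = #-other (e ∋?_) (subst (2 ≤_) (∣∣≡# (inc H e)) (inc-size H e)) v

  Inside? : ∀ Y → Decidable (λ e → inc H e ⊆ₛ Y)
  Inside? Y e = FinP.all? (λ u → (e ∋? u) →-dec (u ∈?ₛ Y))

  Within : Subset (nV H) → Fin (nV H) → Fin (nE H) → Set
  Within Y v e = e ∋ v × (∀ u → e ∋ u → u ∈ₛ Y)

  Within? : ∀ Y v → Decidable (Within Y v)
  Within? Y v e = (e ∋? v) ×-dec Inside? Y e

  -- Unlike `Within`, the condition exempts `v` itself, so it can be applied at a vertex whose
  -- colour is not yet meaningful.
  Star : Pred (Fin (nV H)) 0ℓ → Fin (nV H) → Fin (nE H) → Set
  Star Z v e = e ∋ v × (∀ u → e ∋ u → u ≢ v → Z u)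

  Star? : ∀ {Z : Pred (Fin (nV H)) 0ℓ} → Decidable Z → ∀ v → Decidable (Star Z v)
  Star? Z? v e = (e ∋? v) ×-dec FinP.all? (λ u → (e ∋? u) →-dec (¬? (u FinP.≟ v) →-dec Z? u))

  -- For fixed Y the degree condition is weakest when F consists of all edges inside Y,
  -- so only induced subhypergraphs have to be tested.
  Degenerate : Pred (Fin (nV H)) 0ℓ → (Fin (nV H) → ℕ) → Set
  Degenerate X h = ∀ Y → (∀ y → y ∈ₛ Y → X y) → ∃ (_∈ₛ Y) → ∃ λ v → v ∈ₛ Y × # (Within? Y v) < h v

  degenerate⇒strictly : ∀ X {h} → Degenerate (_∈ₛ X) h → StrictlyDegenerateInduced H X h
  degenerate⇒strictly X degen Y F Y⊆X sub ne with degen Y Y⊆X ne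
  ... | v , v∈Y , lt = v , v∈Y , ≤-<-trans
    (#-mono (λ e → (e ∈?ₛ F) ×-dec (e ∋? v)) (Within? Y v) λ e (e∈F , e∋v) → e∋v , sub e e∈F) lt

  strictly⇒degenerate : ∀ X {h} → StrictlyDegenerateInduced H X h → Degenerate (_∈ₛ X) h
  strictly⇒degenerate X strict Y Y⊆X ne
    with strict Y ⟦ Inside? Y ⟧ Y⊆X (λ e e∈F → ∈⟦⟧⁻ (Inside? Y) e∈F) ne
  ... | v , v∈Y , lt = v , v∈Y , ≤-<-trans
    (#-mono (Within? Y v) (λ e → (e ∈?ₛ ⟦ Inside? Y ⟧) ×-dec (e ∋? v)) λ e (e∋v , e⊆Y) → ∈⟦⟧⁺ (Inside? Y) e⊆Y , e∋v) lt

-- Good colourings and moves of the token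

module Colourings {p} (H : Hypergraph) (f : VFun p H) where

  open Edges H

  Colouring : Set
  Colouring = Fin (nV H) → Fin p

  -- φ is only meaningful off U.
  Good : Pred (Fin (nV H)) 0ℓ → Colouring → Set
  Good U φ = ∀ i → Degenerate (λ y → ¬ U y × φ y ≡ i) (λ v → f v i)

  good⇒partitionable : ∀ {φ} → Good (λ _ → ⊥) φ → Partitionable H f
  good⇒partitionable {φ} good = P , λ i → degenerate⇒strictly ⟦ (λ x → φ x FinP.≟ i) ⟧ λ Y Y⊆X ne →
      good i Y (λ y y∈Y → (λ ()) , ∈⟦⟧⁻ (λ x → φ x FinP.≟ i) (Y⊆X y y∈Y)) ne
    where
    P : Partition p H
    P = record
      { parts    = λ i → ⟦ (λ x → φ x FinP.≟ i) ⟧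
      ; disjoint = λ i j v i≢j v∈i v∈j → i≢j (trans (sym (∈⟦⟧⁻ (λ x → φ x FinP.≟ i) v∈i)) (∈⟦⟧⁻ (λ x → φ x FinP.≟ j) v∈j))
      ; cover    = λ v → φ v , ∈⟦⟧⁺ (λ x → φ x FinP.≟ φ v) refl
      }

  partitionable⇒good : Partitionable H f → ∃ (Good (λ _ → ⊥))
  partitionable⇒good (P , isP) = (λ v → proj₁ (cover v)) , λ i Y Y⊆ ne →
      strictly⇒degenerate (parts i) (isP i) Y (λ y y∈Y → subst (λ j → y ∈ₛ parts j) (proj₂ (Y⊆ y y∈Y)) (proj₂ (cover y))) ne
    where open Partition P

  -- A set of colour `i` through `u` has `u` as its vertex of small degree, since its edges at `u`
  -- are among those counted by `Star`. A set missing `u` is handled by the old colouring.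
  extend : ∀ {U U′ Z : Pred (Fin (nV H)) 0ℓ} {φ u i} (Z? : Decidable Z) → Good U φ →
    (∀ y → y ≢ u → ¬ U′ y → ¬ U y) → (∀ y → y ≢ u → ¬ U′ y → φ y ≡ i → Z y) →
    # (Star? Z? u) < f u i → Good U′ (φ [ u ≔ i ])
  extend {U} {U′} {Z} {φ} {u} {i} Z? good U⊆ ⊆Z lt j Y Y⊆ ne with u ∈?ₛ Y
  ... | no u∉Y = good j Y (λ y y∈Y → let y≢u = λ { refl → u∉Y y∈Y } in
          U⊆ y y≢u (proj₁ (Y⊆ y y∈Y)) , trans (sym (≔-≢ φ i y≢u)) (proj₂ (Y⊆ y y∈Y))) ne
  ... | yes u∈Y with trans (sym (≔-≡ φ u i)) (proj₂ (Y⊆ u u∈Y))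
  ...   | refl = u , u∈Y , ≤-<-trans (#-mono (Within? Y u) (Star? Z? u) λ e (e∋u , e⊆Y) → e∋u ,
          λ w e∋w w≢u → ⊆Z w w≢u (proj₁ (Y⊆ w (e⊆Y w e∋w)))
            (trans (sym (≔-≢ φ i w≢u)) (proj₂ (Y⊆ w (e⊆Y w e∋w))))) lt


  module Existence (c₀ : Fin p) (conn : Connected H) (f≥deg : ∀ v → deg H v ≤ sumFin (f v)) where

    -- Vertices are coloured towards `S`: first everything outside `S` and `w`, then `w`, which
    -- shares the edge `e` with a vertex of `S` that stays uncoloured. No colour counts `e` at `w`,
    -- so fewer than `deg H w` edges are counted in total and some colour still has room.
    uncoloured : ∀ k S → # (λ x → ¬? (x ∈?ₛ S)) ≤ k → ∃ (_∈ₛ S) → ∃ (Good (_∈ₛ S))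
    uncoloured k S bound ne with FinP.any? (λ x → ¬? (x ∈?ₛ S))
    uncoloured k S bound ne | no full =
      (λ _ → c₀) , λ i Y Y⊆ (y , y∈Y) → ⊥-elim (full (y , proj₁ (Y⊆ y y∈Y)))
    uncoloured zero S bound ne | yes (x , x∉S) =
      ⊥-elim (#-≡0⇒¬ (λ x → ¬? (x ∈?ₛ S)) (n≤0⇒n≡0 bound) x x∉S)
    uncoloured (suc k) S bound ne | yes out with proj₂ conn S ne out
    ... | e , u , w , e∋u , u∈S , e∋w , w∉S = φ [ w ≔ i ] , extend (Z? i) good (λ y y≢w y∉S y∈S′ →
              [ y∉S , y≢w ]′ (∈⟦⟧⁻ S′? y∈S′))
              (λ y y≢w y∉S φy → (λ y∈S′ → [ y∉S , y≢w ]′ (∈⟦⟧⁻ S′? y∈S′)) , φy) (proj₂ small)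
      where
      S′? = λ x → (x ∈?ₛ S) ⊎-dec (x FinP.≟ w)
      rec = uncoloured k ⟦ S′? ⟧
        (s≤s⁻¹ (≤-trans (#-strict (λ x → ¬? (x ∈?ₛ ⟦ S′? ⟧)) (λ x → ¬? (x ∈?ₛ S))
          (λ x x∉S′ x∈S → x∉S′ (∈⟦⟧⁺ S′? (inj₁ x∈S))) w∉S λ w∉S′ → w∉S′ (∈⟦⟧⁺ S′? (inj₂ refl))) bound))
        (u , ∈⟦⟧⁺ S′? (inj₁ u∈S))
      φ = proj₁ rec
      good = proj₂ rec
      Z? : ∀ i → Decidable (λ y → ¬ (y ∈ₛ ⟦ S′? ⟧) × φ y ≡ i)
      Z? i y = ¬? (y ∈?ₛ ⟦ S′? ⟧) ×-dec (φ y FinP.≟ i)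
      different : ∀ i j e → Star _ w e → Star _ w e → i ≡ j
      different i j e (_ , c) (_ , d) with other-end e w
      ... | x , x≢w , e∋x = trans (sym (proj₂ (c x e∋x x≢w))) (proj₂ (d x e∋x x≢w))
      small : ∃ λ i → # (Star? (Z? i) w) < f w i
      small = sumFin-<⇒∃< (<-≤-trans
        (Σ#-< (λ i → Star? (Z? i) w) (_∋? w) (λ i e → proj₁) different e∋w
          λ i (_ , c) → proj₁ (c u e∋u λ { refl → w∉S u∈S }) (∈⟦⟧⁺ S′? (inj₁ u∈S)))
        (f≥deg w))
      i = proj₁ small

    token-exists : ∀ v → ∃ (Good (_≡ v))
    token-exists v with uncoloured _ ⟦ FinP._≟ v ⟧ ≤-refl (v , ∈⟦⟧⁺ (FinP._≟ v) refl)
    ... | φ , good = φ , λ i Y Y⊆ ne → good i Y (λ y y∈Y →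
          (λ y∈v → proj₁ (Y⊆ y y∈Y) (∈⟦⟧⁻ (FinP._≟ v) y∈v)) , proj₂ (Y⊆ y y∈Y)) ne

  -- A token on v marks the only uncoloured vertex.
  Token : Colouring → Fin (nV H) → Set
  Token φ v = Good (_≡ v) φ

  Mono : Colouring → Fin p → Fin (nV H) → Fin (nE H) → Set
  Mono φ i v = Star (λ u → φ u ≡ i) v

  Mono? : ∀ φ i v → Decidable (Mono φ i v)
  Mono? φ i = Star? (λ u → φ u FinP.≟ i)

  Mono-unique : ∀ {φ v} i j e → Mono φ i v e → Mono φ j v e → i ≡ j
  Mono-unique {v = v} i j e (_ , c) (_ , d) with other-end e v
  ... | x , x≢v , e∋x = trans (sym (c x e∋x x≢v)) (d x e∋x x≢v)

  module Moves (f≥deg : ∀ v → deg H v ≤ sumFin (f v)) (unpart : ¬ Partitionable H f) where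

    Mono-≥ : ∀ {φ v} → Token φ v → ∀ i → f v i ≤ # (Mono? φ i v)
    Mono-≥ {φ} {v} tok i = ≮⇒≥ λ lt → unpart (good⇒partitionable
      (extend (λ u → φ u FinP.≟ i) tok (λ y y≢v _ → y≢v) (λ _ _ _ c → c) lt))

    -- An edge is monochromatic in at most one colour, so these counts sum to at most `deg H v`,
    -- hence to at most the sum of `f v`; each of them is at least `f v i`.
    Mono-# : ∀ {φ v} → Token φ v → ∀ i → # (Mono? φ i v) ≡ f v i
    Mono-# {φ} {v} tok i = sym (sumFin-≤⇒≡ (Mono-≥ tok)
      (≤-trans (Σ#-≤ (λ i → Mono? φ i v) (_∋? v) (λ i e → proj₁) Mono-unique) (f≥deg v)) i)

    edge-mono : ∀ {φ v} → Token φ v → ∀ e → e ∋ v → ∃ λ i → Mono φ i v e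
    edge-mono {φ} {v} tok e e∋v with FinP.any? (λ i → Mono? φ i v e)
    ... | yes found = found
    ... | no  ¬mono = ⊥-elim (<⇒≱ (Σ#-< (λ i → Mono? φ i v) (_∋? v) (λ i e → proj₁) Mono-unique e∋v
            (λ i m → ¬mono (i , m))) (≤-trans (f≥deg v) (sumFin-mono (Mono-≥ tok))))

    edge-≡ : ∀ {φ v} → Token φ v → ∀ e {a b} → e ∋ v → e ∋ a → e ∋ b → a ≢ v → b ≢ v → φ a ≡ φ b
    edge-≡ tok e e∋v e∋a e∋b a≢v b≢v with edge-mono tok e e∋v
    ... | i , _ , c = trans (c _ e∋a a≢v) (sym (c _ e∋b b≢v))

    -- The only new danger is a set `Y` of colour `φ u` containing `v`. Its edges at `v` are among
    -- the `f v i` monochromatic ones; the edge `e` to `u` is also one of these but leaves `Y`,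
    -- because `u` now holds the token. So fewer than `f v i` lie in `Y`.
    move : ∀ {φ v u} → Token φ v → Adj v u → Token (φ [ v ≔ φ u ]) u
    move {φ} {v} {u} tok (v≢u , e , e∋v , e∋u) i Y Y⊆ ne with v ∈?ₛ Y
    ... | no v∉Y = tok i Y (λ y y∈Y → let y≢v = λ { refl → v∉Y y∈Y } in
            y≢v , trans (sym (≔-≢ φ _ y≢v)) (proj₂ (Y⊆ y y∈Y))) ne
    ... | yes v∈Y = v , v∈Y , subst (# (Within? Y v) <_) (Mono-# tok i)
      (#-strict (Within? Y v) (Mono? φ i v)
        (λ e (e∋v , e⊆Y) → e∋v , λ w e∋w w≢v → trans (sym (≔-≢ φ _ w≢v)) (proj₂ (Y⊆ w (e⊆Y w e∋w))))
        (e∋v , λ w e∋w w≢v → trans (edge-≡ tok e e∋v e∋w e∋u w≢v (v≢u ∘ sym))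
                               (trans (sym (≔-≡ φ v (φ u))) (proj₂ (Y⊆ v v∈Y))))
        λ (_ , e⊆Y) → proj₁ (Y⊆ u (e⊆Y u e∋u)) refl)

    -- Both counts equal f v κ.
    no-colour-loss : ∀ {φ φ′ v x} → Token φ v → Token φ′ v → ∀ κ →
      (∀ z → Adj v z → φ′ z ≡ κ → φ z ≡ κ) → Adj v x → φ x ≡ κ → φ′ x ≢ κ → ⊥
    no-colour-loss {φ} {φ′} {v} {x} tok tok′ κ κ⊆ (v≢x , e , e∋v , e∋x) φx φ′x =
      <-irrefl (trans (Mono-# tok′ κ) (sym (Mono-# tok κ)))
        (#-strict (Mono? φ′ κ v) (Mono? φ κ v)
          (λ e (e∋v , c) → e∋v , λ u e∋u u≢v → κ⊆ u (u≢v ∘ sym , e , e∋v , e∋u) (c u e∋u u≢v))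
          (e∋v , λ u e∋u u≢v → trans (edge-≡ tok e e∋v e∋u e∋x u≢v (v≢x ∘ sym)) φx)
          λ (_ , c) → φ′x (c x e∋x (v≢x ∘ sym)))

-- Walks around a non-separating vertex

-- Absence of separating vertices in positive form: without `v`, no set `Z` is cut off from the
-- rest. This is the form that lets walks avoiding `v` be grown.
NoCut : Hypergraph → Set
NoCut H = ∀ v Z → ∃ (_∈ₛ Z) → ¬ (v ∈ₛ Z) → (∃ λ y → ¬ (y ∈ₛ Z) × y ≢ v) →
  ∃ λ e → ∃ λ u → ∃ λ w → e ∋ u × u ∈ₛ Z × e ∋ w × ¬ (w ∈ₛ Z) × w ≢ v
  where open Edges H

-- Without such an edge, `Z` with `v` added and the complement of `Z` form a separation at `v`: an
-- edge that meets `Z` stays in the first set, every other edge lies in the second.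
block⇒noCut : ∀ H → (∀ v → ¬ Separating H v) → NoCut H
block⇒noCut H ¬sep v Z (z , z∈Z) v∉Z (y , y∉Z , y≢v)
  with FinP.any? (λ e → FinP.any? (λ u → FinP.any? (λ w →
         (e ∋? u) ×-dec (u ∈?ₛ Z) ×-dec (e ∋? w) ×-dec ¬? (w ∈?ₛ Z) ×-dec ¬? (w FinP.≟ v))))
  where open Edges H
... | yes (e , u , w , c) = e , u , w , c
... | no ¬cross = ⊥-elim (¬sep v (⟦ X₁? ⟧ , ⟦ X₂? ⟧ , cover , meet
      , ∈⟦⟧⁺ X₁? (inj₂ refl) , ∈⟦⟧⁺ X₂? v∉Z , two X₁? z v z≢v (inj₁ z∈Z) (inj₂ refl) , two X₂? y v y≢v y∉Z v∉Z , sides))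
  where
  open Edges H
  X₁? = (_∈?ₛ Z) ∪? (FinP._≟ v)
  X₂? = λ x → ¬? (x ∈?ₛ Z)
  z≢v : z ≢ v
  z≢v refl = v∉Z z∈Z
  two : ∀ {P : Pred (Fin (nV H)) 0ℓ} (P? : Decidable P) x y → x ≢ y → P x → P y → 2 ≤ ∣ ⟦ P? ⟧ ∣
  two P? x y x≢y px py = subst (2 ≤_) (sym (∣∣≡# ⟦ P? ⟧)) (#-two (_∈?ₛ ⟦ P? ⟧) x≢y (∈⟦⟧⁺ P? px) (∈⟦⟧⁺ P? py))
  cover : ∀ u → u ∈ₛ ⟦ X₁? ⟧ ⊎ u ∈ₛ ⟦ X₂? ⟧
  cover u with u ∈?ₛ Z
  ... | yes u∈Z = inj₁ (∈⟦⟧⁺ X₁? (inj₁ u∈Z))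
  ... | no  u∉Z = inj₂ (∈⟦⟧⁺ X₂? u∉Z)
  meet : ∀ u → u ∈ₛ ⟦ X₁? ⟧ → u ∈ₛ ⟦ X₂? ⟧ → u ≡ v
  meet u u∈X₁ u∈X₂ = [ (λ u∈Z → ⊥-elim (∈⟦⟧⁻ X₂? u∈X₂ u∈Z)) , id ]′ (∈⟦⟧⁻ X₁? u∈X₁)
  sides : ∀ e → inc H e ⊆ₛ ⟦ X₁? ⟧ ⊎ inc H e ⊆ₛ ⟦ X₂? ⟧
  sides e with FinP.any? (λ u → (e ∋? u) ×-dec (u ∈?ₛ Z))
  ... | no  ¬Z = inj₂ λ w e∋w → ∈⟦⟧⁺ X₂? λ w∈Z → ¬Z (w , e∋w , w∈Z)
  ... | yes (u , e∋u , u∈Z) = inj₁ λ w e∋w → ∈⟦⟧⁺ X₁? (in₁ w e∋w)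
    where
    in₁ : ∀ w → e ∋ w → w ∈ₛ Z ⊎ w ≡ v
    in₁ w e∋w with w ∈?ₛ Z | w FinP.≟ v
    ... | yes w∈Z | _ = inj₁ w∈Z
    ... | no _ | yes w≡v = inj₂ w≡v
    ... | no w∉Z | no w≢v = ⊥-elim (¬cross (e , u , w , e∋u , u∈Z , e∋w , w∉Z , w≢v))

module Walks (H : Hypergraph) where

  open Edges H

  -- `A` is demanded of every vertex except the first, so walks concatenate without further
  -- conditions.
  data Walk (A : Pred (Fin (nV H)) 0ℓ) : Fin (nV H) → Fin (nV H) → Set where
    []  : ∀ {u} → Walk A u u
    _∷_ : ∀ {u w z} → Adj u w × A w → Walk A w z → Walk A u z

  _++_ : ∀ {A u w z} → Walk A u w → Walk A w z → Walk A u z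
  []      ++ q = q
  (a ∷ p) ++ q = a ∷ (p ++ q)

  weaken : ∀ {A B : Pred (Fin (nV H)) 0ℓ} {u w} → (∀ x → A x → B x) → Walk A u w → Walk B u w
  weaken A⊆B []            = []
  weaken A⊆B ((a , b) ∷ p) = (a , A⊆B _ b) ∷ weaken A⊆B p

  Linked : Pred (Fin (nV H)) 0ℓ → Set
  Linked S = ∀ x y → S x → S y → Walk S x y

  end-in : ∀ {A u w} → A u → Walk A u w → A w
  end-in a []            = a
  end-in a ((_ , b) ∷ p) = end-in b p

  record Return (S : Pred (Fin (nV H)) 0ℓ) (s d : Fin (nV H)) : Set where
    field
      {last landing} : Fin (nV H)
      outside        : Walk (λ x → ¬ S x) d last
      back           : Adj last landing
      landing∈       : S landing
      landing≢       : landing ≢ s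

  -- The set `Z` of vertices reached from `d` outside `S` is grown. As `s` does not separate, some
  -- edge leaves `Z` towards a vertex `w` other than `s`: if `w` is in `S` the walk is finished,
  -- otherwise `w` enlarges `Z`. The vertex `s′` ensures that something besides `s` stays outside
  -- `Z`.
  return : ∀ {S} → NoCut H → Decidable S → ∀ {s d} → S s → ¬ S d → (∃ λ s′ → S s′ × s′ ≢ s) → Return S s d
  return {S} noCut S? {s} {d} s∈S d∉S (s′ , s′∈S , s′≢s) =
    explore _ ⟦ FinP._≟ d ⟧ ≤-refl (∈⟦⟧⁺ (FinP._≟ d) refl) λ z z∈ → reach-d z (∈⟦⟧⁻ (FinP._≟ d) z∈)
    where
    reach-d : ∀ z → z ≡ d → ¬ S z × Walk (λ x → ¬ S x) d z
    reach-d z refl = d∉S , []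
    explore : ∀ k Z → # (λ x → ¬? (x ∈?ₛ Z)) ≤ k → d ∈ₛ Z →
      (∀ z → z ∈ₛ Z → ¬ S z × Walk (λ x → ¬ S x) d z) → Return S s d
    explore k Z bound d∈Z reach with noCut s Z (d , d∈Z) (λ s∈Z → proj₁ (reach s s∈Z) s∈S)
                                       (s′ , (λ s′∈Z → proj₁ (reach s′ s′∈Z) s′∈S) , s′≢s)
    ... | e , u , w , e∋u , u∈Z , e∋w , w∉Z , w≢s with S? w | k
    ...   | yes w∈S | _ = record
            { outside = proj₂ (reach u u∈Z) ; back = (λ { refl → w∉Z u∈Z }) , e , e∋u , e∋w
            ; landing∈ = w∈S ; landing≢ = w≢s }
    ...   | no _ | zero = ⊥-elim (#-≡0⇒¬ (λ x → ¬? (x ∈?ₛ Z)) (n≤0⇒n≡0 bound) w w∉Z)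
    ...   | no w∉S | suc k = explore k ⟦ Z′? ⟧ (s≤s⁻¹ (≤-trans (#-strict (λ x → ¬? (x ∈?ₛ ⟦ Z′? ⟧)) (λ x → ¬? (x ∈?ₛ Z))
              (λ x x∉Z′ x∈Z → x∉Z′ (∈⟦⟧⁺ Z′? (inj₁ x∈Z))) w∉Z λ w∉Z′ → w∉Z′ (∈⟦⟧⁺ Z′? (inj₂ refl))) bound))
              (∈⟦⟧⁺ Z′? (inj₁ d∈Z)) (λ z z∈Z′ → reach′ z (∈⟦⟧⁻ Z′? z∈Z′))
      where
      Z′? = (_∈?ₛ Z) ∪? (FinP._≟ w)
      reach′ : ∀ z → z ∈ₛ Z ⊎ z ≡ w → ¬ S z × Walk (λ x → ¬ S x) d z
      reach′ z (inj₁ z∈Z) = reach z z∈Z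
      reach′ z (inj₂ refl) = w∉S , proj₂ (reach u u∈Z) ++ ((((λ { refl → w∉Z u∈Z }) , e , e∋u , e∋w) , w∉S) ∷ [])

-- Concentrating two colours on a small set

module Focus {p} (H : Hypergraph) (f : VFun p H) (conn : Connected H)
  (f≥deg : ∀ v → deg H v ≤ sumFin (f v)) (unpart : ¬ Partitionable H f) (noCut : NoCut H) where

  open Edges H
  open Walks H public
  open Colourings H f
  open Moves f≥deg unpart

  Mixed : Pred (Fin (nV H)) 0ℓ → Colouring → Fin (nV H) → Set
  Mixed T φ t = ∃ λ x → ∃ λ y → T x × T y × x ≢ t × y ≢ t × φ x ≢ φ y

  mixed-weaken : ∀ {T T′ : Pred (Fin (nV H)) 0ℓ} {φ t} → (∀ x → T x → T′ x) → Mixed T φ t → Mixed T′ φ t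
  mixed-weaken T⊆T′ (x , y , x∈T , y∈T , rest) = x , y , T⊆T′ x x∈T , T⊆T′ y y∈T , rest

  -- The vertex `t` takes over the colour of `u`, so a witness that was `u` is replaced by `t`.
  mixed-move : ∀ {T φ t u} → t ≢ u → T t → Mixed T φ t → Mixed T (φ [ t ≔ φ u ]) u
  mixed-move {T} {φ} {t} {u} t≢u t∈T (x , y , x∈T , y∈T , x≢t , y≢t , φx≢φy) with x FinP.≟ u | y FinP.≟ u
  ... | yes refl | yes refl = ⊥-elim (φx≢φy refl)
  ... | yes refl | no y≢u = t , y , t∈T , y∈T , t≢u , y≢u ,
          λ eq → φx≢φy (trans (sym (≔-≡ φ t (φ x))) (trans eq (≔-≢ φ (φ x) y≢t)))
  ... | no x≢u | yes refl = x , t , x∈T , t∈T , x≢u , t≢u ,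
          λ eq → φx≢φy (trans (sym (≔-≢ φ (φ y) x≢t)) (trans eq (≔-≡ φ t (φ y))))
  ... | no x≢u | no y≢u = x , y , x∈T , y∈T , x≢u , y≢u ,
          λ eq → φx≢φy (trans (sym (≔-≢ φ (φ u) x≢t)) (trans eq (≔-≢ φ (φ u) y≢t)))

  record Run (A : Pred (Fin (nV H)) 0ℓ) (φ : Colouring) (t z : Fin (nV H)) : Set₁ where
    field
      {result} : Colouring
      token    : Token result z
      same     : ∀ x → ¬ A x → result x ≡ φ x
      mixed    : ∀ {T : Pred (Fin (nV H)) 0ℓ} → (∀ x → A x → T x) → Mixed T φ t → Mixed T result z

  run : ∀ {A φ t z} → A t → Token φ t → Walk A t z → Run A φ t z
  run a tok [] = record { token = tok ; same = λ _ _ → refl ; mixed = λ _ m → m }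
  run {A} {φ} {t} a tok (_∷_ {w = w} (adj , b) walk) = record
    { token = token ; same = λ x ¬A → trans (same x ¬A) (≔-≢ φ (φ w) λ { refl → ¬A a })
    ; mixed = λ A⊆T m → mixed A⊆T (mixed-move {φ = φ} (proj₁ adj) (A⊆T t a) m) }
    where open Run (run b (move tok adj) walk)

  -- The token leaves S at s through d and comes back elsewhere: inside S the only effect
  -- is that s receives the colour of d.
  excursion : ∀ {S φ s d} → Token φ s → ¬ S d → Adj s d → (r : Return S s d) → S s →
    ∃ λ φ′ → Token φ′ (Return.landing r) × φ′ s ≡ φ d × (∀ z → S z → z ≢ s → φ′ z ≡ φ z)
  excursion {S} {φ} {s} {d} tok d∉S adj r s∈S = result [ last ≔ result landing ] , move token back
    , trans (on-S s∈S) (≔-≡ φ s (φ d)) , λ z z∈S z≢s → trans (on-S z∈S) (≔-≢ φ (φ d) z≢s)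
    where
    open Return r
    open Run (run d∉S (move tok adj) outside)
    on-S : ∀ {z} → S z → (result [ last ≔ result landing ]) z ≡ (φ [ s ≔ φ d ]) z
    on-S {z} z∈S = trans (≔-≢ result (result landing) (λ { refl → end-in d∉S outside z∈S })) (same z (λ z∉S → z∉S z∈S))

  Focused : Subset (nV H) → Set
  Focused S = ∃ λ t → ∃ λ φ → t ∈ₛ S × Token φ t × Mixed (_∈ₛ S) φ t

  -- An excursion through `d` returns at some `w` and leaves the colour of `d` on `s`. Then `s`
  -- contrasts with a third vertex `a`, or with `x`. If neither pair works, `a` has the colour of
  -- `d` and `x` is `w`, and in that case `x` and `a` already differed before the excursion.
  pull-in : ∀ {S φ s d x} → (∀ a b → ∃ λ x → x ≢ a × x ≢ b × x ∈ₛ S) → s ∈ₛ S → ¬ (d ∈ₛ S) → Adj s d →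
    Token φ s → x ∈ₛ S → x ≢ s → φ x ≢ φ d → Focused S
  pull-in {S} {φ₁} {s} {d} {x} three s∈S d∉S sd tok₁ x∈S x≢s cx≢cd with return noCut (_∈?ₛ S) s∈S d∉S
    (let (s′ , s′≢s , _ , s′∈S) = three s s in s′ , s′∈S , s′≢s)
  ... | r with excursion tok₁ d∉S sd r s∈S | three s (Return.landing r)
  ...   | φ , tok , φs , φS | a , a≢s , a≢w , a∈S with φ₁ a FinP.≟ φ₁ d
  ...     | no ca≢cd = w , φ , landing∈ , tok , s , a , s∈S , a∈S , landing≢ ∘ sym , a≢w ,
              λ eq → ca≢cd (trans (sym (φS a a∈S a≢s)) (trans (sym eq) φs))
    where open Return r renaming (landing to w)
  ...     | yes ca≡cd with x FinP.≟ Return.landing r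
  ...       | no x≢w = w , φ , landing∈ , tok , s , x , s∈S , x∈S , landing≢ ∘ sym , x≢w ,
                λ eq → cx≢cd (trans (sym (φS x x∈S x≢s)) (trans (sym eq) φs))
    where open Return r renaming (landing to w)
  ...       | yes refl = s , φ₁ , s∈S , tok₁ , x , a , x∈S , a∈S , x≢s , a≢s ,
                λ eq → cx≢cd (trans eq ca≡cd)

  module Spread (φ₀ : Colouring) (t₀ : Fin (nV H)) (tok₀ : Token φ₀ t₀) (x₀ y₀ : Fin (nV H))
    (x₀≢t₀ : x₀ ≢ t₀) (y₀≢t₀ : y₀ ≢ t₀) (φx₀≢φy₀ : φ₀ x₀ ≢ φ₀ y₀) where

    -- Descent from the whole vertex set, where `x₀` and `y₀` contrast, down to `S`. In the step
    -- from `S′`, which is `S` with a neighbour `d` of `s` added, the token walks to `s` inside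
    -- `S′`; if one of the contrasting vertices is `d`, `pull-in` moves the contrast into `S`.
    focus : ∀ k S → # (λ x → ¬? (x ∈?ₛ S)) ≤ k → Linked (_∈ₛ S) →
      (∀ a b → ∃ λ x → x ≢ a × x ≢ b × x ∈ₛ S) → Focused S
    focus k S bound linked three with FinP.any? (λ x → ¬? (x ∈?ₛ S))
    focus k S bound linked three | no full = t₀ , φ₀ , in-S t₀ , tok₀ , x₀ , y₀ , in-S x₀ , in-S y₀ , x₀≢t₀ , y₀≢t₀ , φx₀≢φy₀
      where
      in-S : ∀ x → x ∈ₛ S
      in-S x = decidable-stable (x ∈?ₛ S) λ x∉S → full (x , x∉S)
    focus zero S bound linked three | yes (x , x∉S) =
      ⊥-elim (#-≡0⇒¬ (λ x → ¬? (x ∈?ₛ S)) (n≤0⇒n≡0 bound) x x∉S)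
    focus (suc k) S bound linked three | yes out
      with proj₂ conn S (proj₁ (three t₀ t₀) , proj₂ (proj₂ (proj₂ (three t₀ t₀)))) out
    ... | e , s , d , e∋s , s∈S , e∋d , d∉S = at-s (mixed-weaken S′⊆ (mixed (λ _ a → a) m))
      where
      sd : Adj s d
      sd = (λ { refl → d∉S s∈S }) , e , e∋s , e∋d
      S′? = (_∈?ₛ S) ∪? (FinP._≟ d)
      S′ = ⟦ S′? ⟧
      S⊆S′ : ∀ x → x ∈ₛ S → x ∈ₛ S′
      S⊆S′ x x∈S = ∈⟦⟧⁺ S′? (inj₁ x∈S)
      d∈S′ : d ∈ₛ S′
      d∈S′ = ∈⟦⟧⁺ S′? (inj₂ refl)
      S′⊆ : ∀ x → x ∈ₛ S′ → x ∈ₛ S ⊎ x ≡ d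
      S′⊆ x = ∈⟦⟧⁻ S′?
      to-s : ∀ x → x ∈ₛ S ⊎ x ≡ d → Walk (_∈ₛ S′) x s
      to-s x (inj₁ x∈S)  = weaken S⊆S′ (linked x s x∈S s∈S)
      to-s x (inj₂ refl) = (Adj-sym sd , S⊆S′ s s∈S) ∷ []
      from-s : ∀ x → x ∈ₛ S ⊎ x ≡ d → Walk (_∈ₛ S′) s x
      from-s x (inj₁ x∈S)  = weaken S⊆S′ (linked s x s∈S x∈S)
      from-s x (inj₂ refl) = (sd , d∈S′) ∷ []
      rec : Focused S′
      rec = focus k S′ (s≤s⁻¹ (≤-trans (#-strict (λ x → ¬? (x ∈?ₛ S′)) (λ x → ¬? (x ∈?ₛ S))
              (λ x x∉S′ x∈S → x∉S′ (S⊆S′ x x∈S)) d∉S (λ d∉S′ → d∉S′ d∈S′)) bound))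
              (λ x y x∈S′ y∈S′ → to-s x (S′⊆ x x∈S′) ++ from-s y (S′⊆ y y∈S′))
              (λ a b → let (x , x≢a , x≢b , x∈S) = three a b in x , x≢a , x≢b , S⊆S′ x x∈S)
      t = proj₁ rec
      t∈S′ = proj₁ (proj₂ (proj₂ rec))
      m = proj₂ (proj₂ (proj₂ (proj₂ rec)))
      open Run (run t∈S′ (proj₁ (proj₂ (proj₂ (proj₂ rec)))) (to-s t (S′⊆ t t∈S′)))

      at-s : Mixed (λ x → x ∈ₛ S ⊎ x ≡ d) result s → Focused S
      at-s (x , y , inj₁ x∈S  , inj₁ y∈S  , x≢s , y≢s , cx≢cy) = s , result , s∈S , token , x , y , x∈S , y∈S , x≢s , y≢s , cx≢cy
      at-s (x , y , inj₁ x∈S  , inj₂ refl , x≢s , y≢s , cx≢cy) = pull-in {S = S} three s∈S d∉S sd token x∈S x≢s cx≢cy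
      at-s (x , y , inj₂ refl , inj₁ y∈S  , x≢s , y≢s , cx≢cy) = pull-in {S = S} three s∈S d∉S sd token y∈S y≢s (cx≢cy ∘ sym)
      at-s (x , y , inj₂ refl , inj₂ refl , x≢s , y≢s , cx≢cy) = ⊥-elim (cx≢cy refl)

-- Multiplicities of ordinary edges

subset-ext : ∀ {n} {X Y : Subset n} → (∀ v → v ∈ₛ X → v ∈ₛ Y) → (∀ v → v ∈ₛ Y → v ∈ₛ X) → X ≡ Y
subset-ext {X = X} {Y} X⊆Y Y⊆X = trans (sym (tabulate∘lookup X)) (trans (tabulate-cong same) (tabulate∘lookup Y))
  where
  same : ∀ v → lookup X v ≡ lookup Y v
  same v with lookup X v in eqX | lookup Y v in eqY
  ... | true  | true  = refl
  ... | false | false = refl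
  ... | true  | false = trans (sym (X⊆Y v eqX)) eqY
  ... | false | true  = trans (sym eqX) (Y⊆X v eqY)

∈pair⁻ : ∀ {n} (u w x : Fin n) → x ∈ₛ pair u w → x ≡ u ⊎ x ≡ w
∈pair⁻ u w x p = Sum.map (x∈⁅y⁆⇒x≡y u) (x∈⁅y⁆⇒x≡y w) (x∈p∪q⁻ ⁅ u ⁆ ⁅ w ⁆ (lookup⇒[]= x _ p))

∈pair⁺ : ∀ {n} (u w x : Fin n) → x ≡ u ⊎ x ≡ w → x ∈ₛ pair u w
∈pair⁺ u w x (inj₁ refl) = []=⇒lookup (x∈p∪q⁺ (inj₁ (x∈⁅x⁆ x)))
∈pair⁺ u w x (inj₂ refl) = []=⇒lookup (x∈p∪q⁺ {p = ⁅ u ⁆} (inj₂ (x∈⁅x⁆ x)))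

module Joins (H : Hypergraph) where

  open Edges H

  Join : Fin (nV H) → Fin (nV H) → Fin (nE H) → Set
  Join u w e = e ∋ u × e ∋ w

  Join? : ∀ u w → Decidable (Join u w)
  Join? u w e = (e ∋? u) ×-dec (e ∋? w)

  #Join-sym : ∀ u w → # (Join? u w) ≡ # (Join? w u)
  #Join-sym u w = #-cong (Join? u w) (Join? w u) (λ e → swap) (λ e → swap)

module Multigraph (H : Hypergraph) (ordinary : Ordinary H) where

  open Edges H
  open Joins H

  ends : ∀ e {u w x} → u ≢ w → e ∋ u → e ∋ w → e ∋ x → x ≡ u ⊎ x ≡ w
  ends e {u} {w} {x} u≢w e∋u e∋w e∋x with x FinP.≟ u | x FinP.≟ w
  ... | yes x≡u | _ = inj₁ x≡u
  ... | no _ | yes x≡w = inj₂ x≡w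
  ... | no x≢u | no x≢w = ⊥-elim (<-irrefl refl (subst (3 ≤_) (trans (sym (∣∣≡# (inc H e))) (ordinary e))
          (#-three (e ∋?_) u≢w (x≢u ∘ sym) (x≢w ∘ sym) e∋u e∋w e∋x)))

  join⇔pair : ∀ {u w} → u ≢ w → ∀ e → (Join u w e → inc H e ≡ pair u w) × (inc H e ≡ pair u w → Join u w e)
  join⇔pair {u} {w} u≢w e =
      (λ (e∋u , e∋w) → subset-ext (λ x e∋x → ∈pair⁺ u w x (ends e u≢w e∋u e∋w e∋x))
        λ x x∈ → [ (λ { refl → e∋u }) , (λ { refl → e∋w }) ]′ (∈pair⁻ u w x x∈))
    , λ eq → subst (u ∈ₛ_) (sym eq) (∈pair⁺ u w u (inj₁ refl)) , subst (w ∈ₛ_) (sym eq) (∈pair⁺ u w w (inj₂ refl))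

  mult≡# : ∀ {u w} → u ≢ w → mult H u w ≡ # (Join? u w)
  mult≡# {u} {w} u≢w = trans
    (count-cong λ e → isYes≗does (≡-dec _≟B_ (inc H e) (pair u w)))
    (#-cong (λ e → ≡-dec _≟B_ (inc H e) (pair u w)) (Join? u w)
      (λ e → proj₂ (join⇔pair u≢w e)) (λ e → proj₁ (join⇔pair u≢w e)))

  -- Every edge at v has exactly one other end.
  #Star : ∀ {Z : Pred (Fin (nV H)) 0ℓ} (Z? : Decidable Z) v t → (∀ u → Z u → u ≢ v → # (Join? v u) ≡ t) →
    # (Star? Z? v) ≡ t * # (Z? ∖? v)
  #Star {Z} Z? v t all-t = trans (≤-antisym
      (Σ#-≥ P? (Star? Z? v) other) (Σ#-≤ P? (Star? Z? v) in-star unique))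
    (trans (sumFin-cong each) (sumFin-if (Z? ∖? v) t))
    where
    P? : ∀ u → Decidable (λ e → (Z u × u ≢ v) × Join v u e)
    P? u e = (Z? ∖? v) u ×-dec Join? v u e
    other : ∀ e → Star Z v e → ∃ λ u → (Z u × u ≢ v) × Join v u e
    other e (e∋v , c) with other-end e v
    ... | u , u≢v , e∋u = u , (c u e∋u u≢v , u≢v) , e∋v , e∋u
    in-star : ∀ u e → (Z u × u ≢ v) × Join v u e → Star Z v e
    in-star u e ((z , u≢v) , e∋v , e∋u) = e∋v , λ x e∋x x≢v →
      [ (λ { refl → z }) , (λ x≡v → ⊥-elim (x≢v x≡v)) ]′ (ends e u≢v e∋u e∋v e∋x)
    unique : ∀ u w e → (Z u × u ≢ v) × Join v u e → (Z w × w ≢ v) × Join v w e → u ≡ w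
    unique u w e ((_ , u≢v) , e∋v , e∋u) ((_ , w≢v) , _ , e∋w) =
      [ sym , (λ w≡v → ⊥-elim (w≢v w≡v)) ]′ (ends e u≢v e∋u e∋v e∋w)
    each : ∀ u → # (P? u) ≡ (if does ((Z? ∖? v) u) then t else 0)
    each u = #-guard ((Z? ∖? v) u) (Join? v u) λ (z , u≢v) → all-t u z u≢v

-- Blocks with two colours: ordinary edges and no diamond

module Structure {p} (H : Hypergraph) (f : VFun p H) (conn : Connected H)
  (f≥deg : ∀ v → deg H v ≤ sumFin (f v)) (unpart : ¬ Partitionable H f) (noCut : NoCut H)
  (φ₀ : Fin (nV H) → Fin p) (t₀ : Fin (nV H)) (tok₀ : Colourings.Token H f φ₀ t₀) (x₀ y₀ : Fin (nV H))
  (x₀≢t₀ : x₀ ≢ t₀) (y₀≢t₀ : y₀ ≢ t₀) (φx₀≢φy₀ : φ₀ x₀ ≢ φ₀ y₀) where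

  open Edges H
  open Colourings H f
  open Moves f≥deg unpart public
  open Focus H f conn f≥deg unpart noCut public
  open Spread φ₀ t₀ tok₀ x₀ y₀ x₀≢t₀ y₀≢t₀ φx₀≢φy₀

  focus-at : ∀ S → Linked (_∈ₛ S) → 3 ≤ # (_∈?ₛ S) → ∀ {v} → v ∈ₛ S →
    ∃ λ φ → Token φ v × Mixed (_∈ₛ S) φ v
  focus-at S linked three {v} v∈S with focus _ S ≤-refl linked (#-third (_∈?ₛ S) three)
  ... | t , φ , t∈S , tok , m = result , token , mixed (λ _ a → a) m
    where open Run (run t∈S tok (linked t v t∈S v∈S))

  -- The set of `v`, `a` and `b` is linked through `v` and has three vertices, so the contrast can
  -- be focused on it. With the token on `v`, the contrasting vertices can only be `a` and `b`.
  two-colours : ∀ {v a b} → Adj v a → Adj v b → a ≢ b → ∃ λ φ → Token φ v × φ a ≢ φ b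
  two-colours {v} {a} {b} va vb a≢b = φ , tok , separate m
    where
    In : Pred (Fin (nV H)) 0ℓ
    In x = x ≡ v ⊎ x ≡ a ⊎ x ≡ b
    In? : Decidable In
    In? = (FinP._≟ v) ∪? ((FinP._≟ a) ∪? (FinP._≟ b))
    S : Subset (nV H)
    S = ⟦ In? ⟧
    v∈ : v ∈ₛ S
    v∈ = ∈⟦⟧⁺ In? (inj₁ refl)
    a∈ : a ∈ₛ S
    a∈ = ∈⟦⟧⁺ In? (inj₂ (inj₁ refl))
    b∈ : b ∈ₛ S
    b∈ = ∈⟦⟧⁺ In? (inj₂ (inj₂ refl))
    to : ∀ x → In x → Walk (_∈ₛ S) x v
    to x (inj₁ refl)        = []
    to x (inj₂ (inj₁ refl)) = (Adj-sym va , v∈) ∷ []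
    to x (inj₂ (inj₂ refl)) = (Adj-sym vb , v∈) ∷ []
    from : ∀ x → In x → Walk (_∈ₛ S) v x
    from x (inj₁ refl)        = []
    from x (inj₂ (inj₁ refl)) = (va , a∈) ∷ []
    from x (inj₂ (inj₂ refl)) = (vb , b∈) ∷ []
    linked : Linked (_∈ₛ S)
    linked x y x∈ y∈ = to x (∈⟦⟧⁻ In? x∈) ++ from y (∈⟦⟧⁻ In? y∈)
    focused : ∃ λ φ → Token φ v × Mixed (_∈ₛ S) φ v
    focused = focus-at S linked (#-three (_∈?ₛ S) (proj₁ va) (proj₁ vb) a≢b v∈ a∈ b∈) v∈
    φ : Colouring
    φ = proj₁ focused
    tok : Token φ v
    tok = proj₁ (proj₂ focused)
    m : Mixed (_∈ₛ S) φ v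
    m = proj₂ (proj₂ focused)
    collapse : ∀ {ψ : Colouring} → ψ a ≡ ψ b → ∀ x → In x → x ≢ v → ψ x ≡ ψ a
    collapse eq x (inj₁ x≡v) x≢v = ⊥-elim (x≢v x≡v)
    collapse eq x (inj₂ (inj₁ refl)) x≢v = refl
    collapse eq x (inj₂ (inj₂ refl)) x≢v = sym eq
    separate : ∀ {ψ} → Mixed (_∈ₛ S) ψ v → ψ a ≢ ψ b
    separate {ψ} (x , y , x∈ , y∈ , x≢v , y≢v , ψx≢ψy) eq = ψx≢ψy
      (trans (collapse {ψ} eq x (∈⟦⟧⁻ In? x∈) x≢v) (sym (collapse {ψ} eq y (∈⟦⟧⁻ In? y∈) y≢v)))

  no-three-ends : ∀ e {v a b} → v ≢ a → v ≢ b → a ≢ b → e ∋ v → e ∋ a → e ∋ b → ⊥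
  no-three-ends e {v} {a} {b} v≢a v≢b a≢b e∋v e∋a e∋b = refute (two-colours (v≢a , e , e∋v , e∋a) (v≢b , e , e∋v , e∋b) a≢b)
    where
    refute : (∃ λ φ → Token φ v × φ a ≢ φ b) → ⊥
    refute (φ , tok , φa≢φb) = φa≢φb (edge-≡ tok e e∋v e∋a e∋b (v≢a ∘ sym) (v≢b ∘ sym))

  ordinary : Ordinary H
  ordinary e = ≤-antisym (≮⇒≥ λ 3≤ → impossible (subst (3 ≤_) (∣∣≡# (inc H e)) 3≤)) (inc-size H e)
    where
    impossible : 3 ≤ # (e ∋?_) → ⊥
    impossible 3≤ with #-pos (e ∋?_) (≤-trans (s≤s z≤n) 3≤)
    ... | v , e∋v with #-other (e ∋?_) (≤-trans (s≤s (s≤s z≤n)) 3≤) v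
    ...   | a , a≢v , e∋a with #-third (e ∋?_) 3≤ v a
    ...     | b , b≢v , b≢a , e∋b = no-three-ends e (a≢v ∘ sym) (b≢v ∘ sym) (b≢a ∘ sym) e∋v e∋a e∋b

  open Joins H
  open Multigraph H ordinary public

  Mono-end : ∀ {φ κ v x e} → v ≢ x → Join v x e → (Mono φ κ v e → φ x ≡ κ) × (φ x ≡ κ → Mono φ κ v e)
  Mono-end v≢x (e∋v , e∋x) = (λ (_ , c) → c _ e∋x (v≢x ∘ sym)) ,
    λ eq → e∋v , λ u e∋u u≢v → [ (λ u≡v → ⊥-elim (u≢v u≡v)) , (λ { refl → eq }) ]′ (ends _ v≢x e∋v e∋x e∋u)

  -- Both colourings have equally many edges of colour φ a at v, and they differ only
  -- in the edges to a and to b.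
  swap⇒#Join≡ : ∀ {φ φ′ v a b} → Token φ v → Token φ′ v → v ≢ a → v ≢ b → φ a ≢ φ b →
    φ′ a ≡ φ b → φ′ b ≡ φ a → (∀ x → Adj v x → x ≢ a → x ≢ b → φ′ x ≡ φ x) →
    # (Join? v a) ≡ # (Join? v b)
  swap⇒#Join≡ {φ} {φ′} {v} {a} {b} tok tok′ v≢a v≢b φa≢φb φ′a φ′b same =
    +-cancelʳ-≡ _ _ _ (begin
      # (Join? v a) + rest         ≡⟨ cong₂ _+_ (#-cong (Join? v a) (Mono? φ κ v ∩? Q?) to-a from-a) refl ⟩
      # (Mono? φ κ v ∩? Q?) + rest ≡⟨ #-split (Mono? φ κ v) Q? ⟨
      # (Mono? φ κ v)              ≡⟨ trans (Mono-# tok κ) (sym (Mono-# tok′ κ)) ⟩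
      # (Mono? φ′ κ v)             ≡⟨ #-split (Mono? φ′ κ v) Q? ⟩
      # (Mono? φ′ κ v ∩? Q?) + # (Mono? φ′ κ v ─? Q?)
        ≡⟨ cong₂ _+_ (#-cong (Mono? φ′ κ v ∩? Q?) (Join? v b) from-b to-b)
             (#-cong (Mono? φ′ κ v ─? Q?) (Mono? φ κ v ─? Q?) (other φ φ′ λ x vx x≢a x≢b → sym (same x vx x≢a x≢b)) (other φ′ φ same)) ⟩
      # (Join? v b) + rest ∎)
    where
    open ≡-Reasoning
    κ = φ a
    Q? : Decidable (λ e → e ∋ a ⊎ e ∋ b)
    Q? = (_∋? a) ∪? (_∋? b)
    rest = # (Mono? φ κ v ─? Q?)
    to-a : ∀ e → Join v a e → Mono φ κ v e × (e ∋ a ⊎ e ∋ b)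
    to-a e j = proj₂ (Mono-end v≢a j) refl , inj₁ (proj₂ j)
    from-a : ∀ e → Mono φ κ v e × (e ∋ a ⊎ e ∋ b) → Join v a e
    from-a e (m , inj₁ e∋a) = proj₁ m , e∋a
    from-a e (m , inj₂ e∋b) = ⊥-elim (φa≢φb (sym (proj₁ (Mono-end v≢b (proj₁ m , e∋b)) m)))
    to-b : ∀ e → Join v b e → Mono φ′ κ v e × (e ∋ a ⊎ e ∋ b)
    to-b e j = proj₂ (Mono-end v≢b j) φ′b , inj₂ (proj₂ j)
    from-b : ∀ e → Mono φ′ κ v e × (e ∋ a ⊎ e ∋ b) → Join v b e
    from-b e (m , inj₁ e∋a) = ⊥-elim (φa≢φb (trans (sym (proj₁ (Mono-end v≢a (proj₁ m , e∋a)) m)) φ′a))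
    from-b e (m , inj₂ e∋b) = proj₁ m , e∋b
    other : ∀ ψ ψ′ → (∀ x → Adj v x → x ≢ a → x ≢ b → ψ x ≡ ψ′ x) → ∀ e →
      Mono ψ′ κ v e × ¬ (e ∋ a ⊎ e ∋ b) → Mono ψ κ v e × ¬ (e ∋ a ⊎ e ∋ b)
    other ψ ψ′ eq e ((e∋v , c) , ¬ab) = (e∋v , λ u e∋u u≢v →
      trans (eq u (u≢v ∘ sym , e , e∋v , e∋u) (λ { refl → ¬ab (inj₁ e∋u) }) (λ { refl → ¬ab (inj₂ e∋u) })) (c u e∋u u≢v)) , ¬ab

  -- The token travels from `v` over `x` and `y` back to `v`. Each vertex it leaves takes the colour
  -- of the next one; the colour of `x` is parked on `v` until it reaches `y`.
  triangle-swap : ∀ {φ v x y} → Token φ v → Adj v x → Adj x y → Adj y v →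
    ∃ λ φ′ → Token φ′ v × φ′ x ≡ φ y × φ′ y ≡ φ x × (∀ z → z ≢ v → z ≢ x → z ≢ y → φ′ z ≡ φ z)
  triangle-swap {φ} {v} {x} {y} tok vx xy yv = φ₃ , move (move (move tok vx) xy) yv
    , trans (≔-≢ φ₂ _ (proj₁ xy)) (trans (≔-≡ φ₁ x _) (≔-≢ φ _ (proj₁ yv)))
    , trans (≔-≡ φ₂ y _) (trans (≔-≢ φ₁ _ (proj₁ vx)) (≔-≡ φ v _))
    , λ z z≢v z≢x z≢y → trans (≔-≢ φ₂ _ z≢y) (trans (≔-≢ φ₁ _ z≢x) (≔-≢ φ _ z≢v))
    where
    φ₁ = φ [ v ≔ φ x ]
    φ₂ = φ₁ [ x ≔ φ₁ y ]
    φ₃ = φ₂ [ y ≔ φ₂ v ]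

  -- Swapping the colours of x and y would change the colours seen from d.
  diamond-clash : ∀ {φ φ′ v x y d} → Adj v x → Adj v d → Adj x d → d ≢ y → ¬ Adj d y → Token φ v → Token φ′ v →
    φ x ≢ φ y → φ′ x ≡ φ y → (∀ z → z ≢ v → z ≢ x → z ≢ y → φ′ z ≡ φ z) → ⊥
  diamond-clash {φ} {φ′} {v} {x} {y} {d} vx vd xd d≢y ¬dy tok tok′ φx≢φy φ′x rest =
    no-colour-loss (move tok vd) (move tok′ vd) (φ x) keep (Adj-sym xd) (≔-≢ φ _ x≢v)
      λ eq → φx≢φy (sym (trans (sym φ′x) (trans (sym (≔-≢ φ′ _ x≢v)) eq)))
    where
    x≢v : x ≢ v
    x≢v = proj₁ vx ∘ sym
    φ′d : φ′ d ≡ φ d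
    φ′d = rest d (proj₁ vd ∘ sym) (proj₁ xd ∘ sym) d≢y
    keep : ∀ z → Adj d z → (φ′ [ v ≔ φ′ d ]) z ≡ φ x → (φ [ v ≔ φ d ]) z ≡ φ x
    keep z dz eq with z FinP.≟ v | z FinP.≟ x
    ... | yes _ | _ = trans (sym φ′d) eq
    ... | no _ | yes refl = ⊥-elim (φx≢φy (sym (trans (sym φ′x) eq)))
    ... | no z≢v | no z≢x = trans (sym (rest z z≢v z≢x λ { refl → ¬dy dz })) eq

  -- Starting with different colours on `x` and `y`, a tour of the triangle exchanges them; a vertex
  -- `d` next to `x` but not to `y` would see one half of the exchange only.
  no-diamond : ∀ {v x y d} → Adj v x → Adj v y → Adj x y → Adj v d → Adj x d → d ≢ y → Adj d y
  no-diamond {v} {x} {y} {d} vx vy xy vd xd d≢y = decidable-stable (Adj? d y) λ ¬dy →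
    clash ¬dy (two-colours vx vy (proj₁ xy))
    where
    clash : ¬ Adj d y → (∃ λ φ → Token φ v × φ x ≢ φ y) → ⊥
    clash ¬dy (φ , tok , φx≢φy) =
      let (φ′ , tok′ , φ′x , φ′y , rest) = triangle-swap tok vx xy (Adj-sym vy)
      in diamond-clash vx vd xd d≢y ¬dy tok tok′ φx≢φy φ′x rest

  -- The token on an induced cycle

  -- An induced cycle of length 4 + q, traversed periodically.
  record Cycle (q : ℕ) : Set where
    field
      s         : ℕ → Fin (nV H)
      periodic  : ∀ i → s (4 + q + i) ≡ s i
      distinct  : ∀ i m → 0 < m → m < 4 + q → s i ≢ s (m + i)
      edge      : ∀ i → Adj (s i) (s (suc i))
      chordless : ∀ i m → 2 ≤ m → 2 + m ≤ 4 + q → ¬ Adj (s i) (s (m + i))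

    periodic* : ∀ k i → s (k * (4 + q) + i) ≡ s i
    periodic* zero    i = refl
    periodic* (suc k) i = trans (cong s (+-assoc (4 + q) (k * (4 + q)) i)) (trans (periodic _) (periodic* k i))

    distinct′ : ∀ {i j} → i < j → j < 4 + q → s i ≢ s j
    distinct′ {i} {j} i<j j<n = subst (λ k → s i ≢ s k) (m∸n+n≡m (<⇒≤ i<j))
      (distinct i (j ∸ i) (m<n⇒0<n∸m i<j) (≤-<-trans (m∸n≤m j i) j<n))

    s-injective : ∀ {i j} → i < 4 + q → j < 4 + q → s i ≡ s j → i ≡ j
    s-injective {i} {j} i<n j<n eq with <-cmp i j
    ... | tri< i<j _ _ = ⊥-elim (distinct′ i<j j<n eq)
    ... | tri≈ _ i≡j _ = i≡j
    ... | tri> _ _ j<i = ⊥-elim (distinct′ j<i i<n (sym eq))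

    On : Pred (Fin (nV H)) 0ℓ
    On x = ∃ λ i → s i ≡ x

    reduce : ∀ {x} → On x → ∃ λ i → i < 4 + q × s i ≡ x
    reduce (i , refl) = i % (4 + q) , m%n<n i (4 + q) ,
      sym (trans (cong s (trans (m≡m%n+[m/n]*n i (4 + q)) (+-comm (i % (4 + q)) _))) (periodic* (i / (4 + q)) _))

    On? : Decidable On
    On? x = map′ (λ (i , eq) → toℕ i , eq)
      (λ on → let (i , i<n , eq) = reduce on in fromℕ< i<n , trans (cong s (FinP.toℕ-fromℕ< i<n)) eq)
      (FinP.any? (λ (i : Fin (4 + q)) → s (toℕ i) FinP.≟ x))

    neighbour : ∀ {i} → i < 4 + q → Adj (s 0) (s i) → i ≡ 1 ⊎ i ≡ 3 + q
    neighbour {zero} _ (s≢s , _) = ⊥-elim (s≢s refl)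
    neighbour {suc zero} _ _ = inj₁ refl
    neighbour {suc (suc i)} i<n adj with suc (suc i) ≟ 3 + q
    ... | yes eq = inj₂ eq
    ... | no neq = ⊥-elim (chordless 0 (2 + i) (s≤s (s≤s z≤n))
                     (s≤s (≤∧≢⇒< (s≤s⁻¹ i<n) neq)) (subst (λ k → Adj (s 0) (s k)) (sym (+-identityʳ (2 + i))) adj))

    edge-back : Adj (s 0) (s (3 + q))
    edge-back = Adj-sym (subst (Adj (s (3 + q))) (trans (cong s (sym (+-identityʳ (4 + q)))) (periodic 0)) (edge (3 + q)))

  open Cycle

  shift : ∀ {q} → Cycle q → ℕ → Cycle q
  shift {q} c r = record
    { s         = λ i → s c (i + r)
    ; periodic  = λ i → trans (cong (s c) (+-assoc (4 + q) i r)) (periodic c (i + r))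
    ; distinct  = λ i m 0<m m<n → subst (λ k → s c (i + r) ≢ s c k) (sym (+-assoc m i r)) (distinct c (i + r) m 0<m m<n)
    ; edge      = λ i → edge c (i + r)
    ; chordless = λ i m 2≤m m≤n → subst (λ k → ¬ Adj (s c (i + r)) (s c k)) (sym (+-assoc m i r)) (chordless c (i + r) m 2≤m m≤n)
    }

  -- Multiplication by 3 + q is negation modulo 4 + q.
  reverse : ∀ {q} → Cycle q → Cycle q
  reverse {q} c = record
    { s         = λ i → s c ((3 + q) * i)
    ; periodic  = λ i → trans (cong (s c) (*-distribˡ-+ (3 + q) (4 + q) i)) (periodic* c (3 + q) _)
    ; distinct  = λ i m 0<m m<n eq → distinct c ((3 + q) * (m + i)) m 0<m m<n (trans (sym eq) (sym (back m i)))
    ; edge      = λ i → Adj-sym (subst (Adj _) (back 1 i) (edge c ((3 + q) * (1 + i))))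
    ; chordless = λ i m 2≤m m≤n adj → chordless c ((3 + q) * (m + i)) m 2≤m m≤n
                    (subst (Adj _) (sym (back m i)) (Adj-sym adj))
    }
    where
    back : ∀ m i → s c (m + (3 + q) * (m + i)) ≡ s c ((3 + q) * i)
    back m i = trans (cong (s c) (begin
      m + (3 + q) * (m + i)              ≡⟨ cong (m +_) (*-distribˡ-+ (3 + q) m i) ⟩
      m + ((3 + q) * m + (3 + q) * i)    ≡⟨ +-assoc m _ _ ⟨
      (4 + q) * m + (3 + q) * i          ≡⟨ cong (_+ (3 + q) * i) (*-comm (4 + q) m) ⟩
      m * (4 + q) + (3 + q) * i          ∎)) (periodic* c m _)
      where open ≡-Reasoning

  -- The outcome of one full turn of the token: the `3 + q` colours on the cycle move one place
  -- back. The colour of `s c 1` wraps around to the last position, as it is parked on `s c 0` at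
  -- the start and picked up when the turn closes.
  record Rotated {q} (c : Cycle q) (φ : Colouring) : Set where
    field
      {φ′}  : Colouring
      tok′  : Token φ′ (s c 0)
      inner : ∀ i → 0 < i → i < 3 + q → φ′ (s c i) ≡ φ (s c (suc i))
      last  : φ′ (s c (3 + q)) ≡ φ (s c 1)
      outer : ∀ x → ¬ On c x → φ′ x ≡ φ x

  module _ {q} (c : Cycle q) where

    private σ = s c

    walk : ∀ {φ} → Token φ (σ 0) → ∀ m → m ≤ 3 + q → ∃ λ ψ → Token ψ (σ m) ×
      (∀ i → i < m → ψ (σ i) ≡ φ (σ (suc i))) × (∀ x → (∀ i → i < m → x ≢ σ i) → ψ x ≡ φ x)
    walk {φ} tok zero    _   = φ , tok , (λ _ ()) , λ _ _ → refl
    walk {φ} tok (suc m) m<n with walk tok m (<⇒≤ m<n)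
    ... | ψ , tok-ψ , before , after = ψ [ σ m ≔ ψ (σ (suc m)) ] , move tok-ψ (edge c m) , before′
        , λ x x∉ → trans (≔-≢ ψ _ (x∉ m ≤-refl)) (after x λ i i<m → x∉ i (m≤n⇒m≤1+n i<m))
      where
      before′ : ∀ i → i < suc m → (ψ [ σ m ≔ ψ (σ (suc m)) ]) (σ i) ≡ φ (σ (suc i))
      before′ i i<1+m with i ≟ m
      ... | yes refl = trans (≔-≡ ψ (σ m) _) (after (σ (suc m)) λ j j<m eq → distinct′ c (m≤n⇒m≤1+n j<m) (s≤s m<n) (sym eq))
      ... | no i≢m = let i<m = ≤∧≢⇒< (s≤s⁻¹ i<1+m) i≢m in
              trans (≔-≢ ψ _ (distinct′ c i<m (m≤n⇒m≤1+n m<n))) (before i i<m)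

    rotate : ∀ {φ} → Token φ (σ 0) → Rotated c φ
    rotate {φ} tok = let (ψ , tok-ψ , before , after) = walk tok (3 + q) ≤-refl in record
      { tok′  = move tok-ψ (Adj-sym (edge-back c))
      ; inner = λ i 0<i i<n → trans (≔-≢ ψ _ (distinct′ c i<n ≤-refl)) (before i i<n)
      ; last  = trans (≔-≡ ψ (σ (3 + q)) _) (before 0 (s≤s z≤n))
      ; outer = λ x x∉ → trans (≔-≢ ψ _ λ eq → x∉ (3 + q , sym eq)) (after x λ i _ eq → x∉ (i , sym eq))
      }

    on-neighbour : ∀ {z} → Adj (σ 0) z → On c z → z ≡ σ 1 ⊎ z ≡ σ (3 + q)
    on-neighbour adj on with reduce c on
    ... | i , i<n , refl with neighbour c i<n adj
    ...   | inj₁ refl = inj₁ refl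
    ...   | inj₂ refl = inj₂ refl

    -- One turn gives the cycle neighbours `σ 1` and `σ (3 + q)` of the token the former colours of
    -- `σ 2` and `σ 1`, and changes no other neighbour. If `σ 2` did not have the colour `κ` of
    -- `σ (3 + q)`, then `κ` would disappear from one of the two and be gained nowhere.
    across : ∀ {φ} → Token φ (σ 0) → φ (σ 2) ≡ φ (σ (3 + q))
    across {φ} tok with φ (σ 2) FinP.≟ φ (σ (3 + q))
    ... | yes eq = eq
    ... | no neq = ⊥-elim (lost (φ (σ 1) FinP.≟ κ))
      where
      κ = φ (σ (3 + q))
      open Rotated (rotate tok)
      φ′σ1 : φ′ (σ 1) ≢ κ
      φ′σ1 eq = neq (trans (sym (inner 1 (s≤s z≤n) (s≤s (s≤s z≤n)))) eq)
      keep : ∀ z → Adj (σ 0) z → φ′ z ≡ κ → φ z ≡ κ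
      keep z adj eq with On? c z
      ... | no  off = trans (sym (outer z off)) eq
      ... | yes on with on-neighbour adj on
      ...   | inj₁ refl = ⊥-elim (φ′σ1 eq)
      ...   | inj₂ refl = refl
      lost : Dec (φ (σ 1) ≡ κ) → ⊥
      lost (yes eq) = no-colour-loss tok tok′ κ keep (edge c 0) eq φ′σ1
      lost (no neq) = no-colour-loss tok tok′ κ keep (edge-back c) refl λ eq → neq (trans (sym last) eq)

    -- Applying `across` after one turn compares positions 3 and 1; every further turn shifts the
    -- compared pair by one place.
    alternate : ∀ i {φ} → Token φ (σ 0) → 0 < i → 2 + i ≤ 3 + q → φ (σ (2 + i)) ≡ φ (σ i)
    alternate (suc zero) tok _ _ = trans (sym (inner 2 (s≤s z≤n) (s≤s (s≤s (s≤s z≤n))))) (trans (across tok′) last)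
      where open Rotated (rotate tok)
    alternate (suc (suc i)) tok _ bound = trans (sym (inner (3 + i) (s≤s z≤n) bound))
        (trans (alternate (suc i) tok′ (s≤s z≤n) (≤-trans (n≤1+n _) bound)) (inner (suc i) (s≤s z≤n) (≤-trans (n≤1+n _) (≤-trans (n≤1+n _) bound))))
      where open Rotated (rotate tok)

    two-coloured : ∃ λ φ → Token φ (σ 0) × φ (σ 1) ≢ φ (σ (3 + q))
    two-coloured = two-colours (edge c 0) (edge-back c) (distinct′ c (s≤s (s≤s z≤n)) ≤-refl)

    full-turn : ∀ i → σ (3 + q + suc i) ≡ σ i
    full-turn i = trans (cong σ (+-suc (3 + q) i)) (periodic c i)

  -- With the token on `s c 1`, `across` compares `s c 3` and `s c 0`. The former has kept its
  -- colour, which by alternation is that of `s c 1`.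
  lands-next : ∀ {q} (c : Cycle q) {φ φ″ κ} → Token φ (s c 0) → Token φ″ (s c 1) → φ″ (s c 0) ≡ κ →
    φ″ (s c 3) ≡ φ (s c 3) → κ ≡ φ (s c 1)
  lands-next {q} c {φ} {φ″} {κ} tok tok″ φ″s0 φ″s3 = begin
    κ                      ≡⟨ φ″s0 ⟨
    φ″ (s c 0)             ≡⟨ cong φ″ (full-turn c 0) ⟨
    φ″ (s c (3 + q + 1))   ≡⟨ across (shift c 1) tok″ ⟨
    φ″ (s c 3)             ≡⟨ φ″s3 ⟩
    φ (s c 3)              ≡⟨ alternate c 1 tok (s≤s z≤n) (s≤s (s≤s (s≤s z≤n))) ⟩
    φ (s c 1)              ∎
    where open ≡-Reasoning

  -- In `far`, `i` is the position of the predecessor of `s c 0` when counting starts at `w`. Hence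
  -- `alternate` at `i`, counted from `w`, compares exactly the two cycle neighbours of `s c 0`.
  data Position {q} (c : Cycle q) (w : Fin (nV H)) : Set where
    next     : w ≡ s c 1 → Position c w
    previous : w ≡ s c (3 + q) → Position c w
    far      : ∀ i j → 0 < i → 2 + i ≤ 3 + q → i + j ≡ 3 + q → w ≡ s c j → Position c w

  position : ∀ {q} (c : Cycle q) {w} → On c w → w ≢ s c 0 → Position c w
  position {q} c on w≢s0 with reduce c on
  ... | zero , _ , eq = ⊥-elim (w≢s0 (sym eq))
  ... | suc zero , _ , eq = next (sym eq)
  ... | suc (suc j) , s≤s j<n , eq with m≤n⇒m<n∨m≡n j<n
  ...   | inj₂ refl = previous (sym eq)
  ...   | inj₁ j<n′ = far (3 + q ∸ (2 + j)) (2 + j) (m<n⇒0<n∸m j<n′)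
            (≤-trans (+-monoˡ-≤ (3 + q ∸ (2 + j)) (m≤m+n 2 j)) (≤-reflexive (m+[n∸m]≡n (<⇒≤ j<n′))))
            (m∸n+n≡m (<⇒≤ j<n′)) (sym eq)

  module Pendant {q} (c : Cycle q) {d} (off : ¬ On c d) (adj : Adj (s c 0) d) (r : Return (On c) (s c 0) d)
    {φ} (tok : Token φ (s c 0)) (φ1≢φn : φ (s c 1) ≢ φ (s c (3 + q))) where

    open Return r using (landing; landing∈; landing≢)
    open Rotated (rotate c tok)

    -- The return walk `r` depends on `H` alone, so one landing constrains every colouring with the
    -- token on `s c 0`, in particular those before and after a full turn. `c′` is `c` or its
    -- reversal, according to the side of the landing.
    lands-at : ∀ (c′ : Cycle q) → s c′ 0 ≡ s c 0 → (∀ i → On c (s c′ i)) → landing ≡ s c′ 1 →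
      ∀ {ψ} → Token ψ (s c 0) → ψ d ≡ ψ (s c′ 1)
    lands-at c′ eq₀ on eq₁ {ψ} tok-ψ = let (ψ″ , tok″ , ψ″s0 , same) = excursion tok-ψ off adj r (0 , refl) in
      lands-next c′ (subst (Token ψ) (sym eq₀) tok-ψ) (subst (Token ψ″) eq₁ tok″) (trans (cong ψ″ eq₀) ψ″s0)
        (same (s c′ 3) (on 3) λ eq → distinct′ c′ (s≤s z≤n) (s≤s (s≤s (s≤s (s≤s z≤n)))) (trans eq₀ (sym eq)))

    φ′d : φ′ d ≡ φ d
    φ′d = outer d off

    -- A landing next to `s c 0` ties the colour of `d` to the colour found there; a full turn
    -- exchanges the colours of the two cycle neighbours but leaves `d` alone. A landing elsewhere
    -- puts the token away from both neighbours, and being two apart on the cycle they must agree.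
    refute : Position c landing → ⊥
    refute (next eq) = φ1≢φn (begin
      φ (s c 1)       ≡⟨ lands-at c refl (λ i → i , refl) eq tok ⟨
      φ d             ≡⟨ φ′d ⟨
      φ′ d            ≡⟨ lands-at c refl (λ i → i , refl) eq tok′ ⟩
      φ′ (s c 1)      ≡⟨ inner 1 (s≤s z≤n) (s≤s (s≤s z≤n)) ⟩
      φ (s c 2)       ≡⟨ across c tok ⟩
      φ (s c (3 + q)) ∎)
      where open ≡-Reasoning
    refute (previous eq) = φ1≢φn (begin
      φ (s c 1)        ≡⟨ last ⟨
      φ′ (s c (3 + q)) ≡⟨ via tok′ ⟨
      φ′ d             ≡⟨ φ′d ⟩
      φ d              ≡⟨ via tok ⟩
      φ (s c (3 + q))  ∎)
      where
      open ≡-Reasoning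
      eq₁ : s c ((3 + q) * 1) ≡ s c (3 + q)
      eq₁ = cong (s c) (*-identityʳ (3 + q))
      via : ∀ {ψ} → Token ψ (s c 0) → ψ d ≡ ψ (s c (3 + q))
      via {ψ} tok-ψ = trans (lands-at (reverse c) (cong (s c) (*-zeroʳ (3 + q))) (λ i → (3 + q) * i , refl)
                        (trans eq (sym eq₁)) tok-ψ) (cong ψ eq₁)
    refute (far i j 0<i i≤ i+j eq) = let (φ″ , tok″ , _ , same) = excursion tok off adj r (0 , refl) in φ1≢φn (begin
      φ (s c 1)             ≡⟨ same (s c 1) (1 , refl) (distinct′ c (s≤s z≤n) (s≤s (s≤s z≤n)) ∘ sym) ⟨
      φ″ (s c 1)            ≡⟨ cong φ″ (trans (cong (λ k → s c (2 + k)) i+j) (trans (cong (λ k → s c (suc k)) (+-comm 1 (3 + q))) (periodic c 1))) ⟨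
      φ″ (s c (2 + i + j))  ≡⟨ alternate (shift c j) i (subst (Token φ″) eq tok″) 0<i i≤ ⟩
      φ″ (s c (i + j))      ≡⟨ cong (λ k → φ″ (s c k)) i+j ⟩
      φ″ (s c (3 + q))      ≡⟨ same (s c (3 + q)) (3 + q , refl) (distinct′ c (s≤s z≤n) ≤-refl ∘ sym) ⟩
      φ (s c (3 + q))       ∎)
      where open ≡-Reasoning

  no-pendant : ∀ {q} (c : Cycle q) {d} → ¬ On c d → ¬ Adj (s c 0) d
  no-pendant {q} c {d} off adj = clash (two-coloured c)
    where
    r : Return (On c) (s c 0) d
    r = return noCut (On? c) (0 , refl) off (s c 1 , (1 , refl) , distinct′ c (s≤s z≤n) (s≤s (s≤s z≤n)) ∘ sym)
    clash : (∃ λ φ → Token φ (s c 0) × φ (s c 1) ≢ φ (s c (3 + q))) → ⊥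
    clash (φ , tok , φ1≢φn) = Pendant.refute c off adj r tok φ1≢φn (position c (Return.landing∈ r) (Return.landing≢ r))

  -- An edge leaving the cycle would start at some `s c i`; a shift brings this vertex to position
  -- 0, where `no-pendant` applies.
  covers : ∀ {q} (c : Cycle q) x → On c x
  covers {q} c x = decidable-stable (On? c x) λ off → clash (proj₂ conn ⟦ On? c ⟧ (s c 0 , ∈⟦⟧⁺ (On? c) (0 , refl))
      (x , λ x∈ → off (∈⟦⟧⁻ (On? c) x∈)))
    where
    clash : (∃ λ e → ∃ λ u → ∃ λ w → e ∋ u × u ∈ₛ ⟦ On? c ⟧ × e ∋ w × ¬ (w ∈ₛ ⟦ On? c ⟧)) → ⊥
    clash (e , u , w , e∋u , u∈ , e∋w , w∉) with ∈⟦⟧⁻ (On? c) u∈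
    ... | i , refl = no-pendant (shift c i) {w} (λ (k , eq) → w∉ (∈⟦⟧⁺ (On? c) (k + i , eq)))
                       ((λ { refl → w∉ u∈ }) , e , e∋u , e∋w)

  even-or-odd : ∀ n → ∃ λ k → n ≡ 2 * k ⊎ n ≡ 1 + 2 * k
  even-or-odd zero = 0 , inj₁ refl
  even-or-odd (suc n) with even-or-odd n
  ... | k , inj₁ refl = k , inj₂ refl
  ... | k , inj₂ refl = suc k , inj₁ (cong suc (sym (+-suc k (k + 0))))

  -- If `3 + q` were odd, alternation along the odd positions would carry the colour of position 1
  -- to position `3 + q`.
  odd-period : ∀ {q} (c : Cycle q) {φ} → Token φ (s c 0) → φ (s c 1) ≢ φ (s c (3 + q)) → Odd (4 + q)
  odd-period {q} c {φ} tok φ1≢φn with even-or-odd (3 + q)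
  ... | k , inj₁ eq = k , cong suc eq
  ... | k , inj₂ eq = ⊥-elim (φ1≢φn (sym (trans (cong (λ i → φ (s c i)) eq) (steps k (≤-reflexive (sym eq))))))
    where
    steps : ∀ k → 1 + 2 * k ≤ 3 + q → φ (s c (1 + 2 * k)) ≡ φ (s c 1)
    steps zero _ = refl
    steps (suc k) bound = trans (cong (λ i → φ (s c i)) unfold) (trans
        (alternate c (1 + 2 * k) tok (s≤s z≤n) bound′) (steps k (≤-trans (m≤n+m (1 + 2 * k) 2) bound′)))
      where
      unfold : 1 + 2 * suc k ≡ 2 + (1 + 2 * k)
      unfold = cong suc (*-suc 2 k)
      bound′ : 2 + (1 + 2 * k) ≤ 3 + q
      bound′ = subst (_≤ 3 + q) unfold bound

  -- By `across`, a full turn exchanges the colours of the two cycle neighbours and leaves all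
  -- vertices off the cycle unchanged.
  #Join-turn : ∀ {q} (c : Cycle q) → # (Join? (s c 0) (s c 1)) ≡ # (Join? (s c 0) (s c (3 + q)))
  #Join-turn {q} c = from-colouring (two-coloured c)
    where
    from-colouring : (∃ λ φ → Token φ (s c 0) × φ (s c 1) ≢ φ (s c (3 + q))) → _
    from-colouring (φ , tok , φ1≢φn) = swap⇒#Join≡ tok tok′ (proj₁ (edge c 0)) (proj₁ (edge-back c)) φ1≢φn
      (trans (inner 1 (s≤s z≤n) (s≤s (s≤s z≤n))) (across c tok)) last same
      where
      open Rotated (rotate c tok)
      same : ∀ x → Adj (s c 0) x → x ≢ s c 1 → x ≢ s c (3 + q) → φ′ x ≡ φ x
      same x adj x≢1 x≢n = outer x λ on → [ x≢1 , x≢n ]′ (on-neighbour c adj on)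

  #Join-edge : ∀ {q} (c : Cycle q) i → # (Join? (s c i) (s c (suc i))) ≡ # (Join? (s c 0) (s c 1))
  #Join-edge c zero = refl
  #Join-edge {q} c (suc i) = trans (#Join-turn (shift c (suc i))) (trans
    (cong (λ x → # (Join? (s c (suc i)) x)) (full-turn c i)) (trans (#Join-sym (s c (suc i)) (s c i)) (#Join-edge c i)))

  ¬Adj⇒#Join≡0 : ∀ {u w} → u ≢ w → ¬ Adj u w → # (Join? u w) ≡ 0
  ¬Adj⇒#Join≡0 {u} {w} u≢w ¬adj = #-zero (Join? u w) λ e (e∋u , e∋w) → ¬adj (u≢w , e , e∋u , e∋w)

  colour-sole : ∀ {φ v a} → Token φ v → v ≢ a → (∀ z → Adj v z → φ z ≡ φ a → z ≡ a) → f v (φ a) ≡ # (Join? v a)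
  colour-sole {φ} {v} {a} tok v≢a sole = trans (sym (Mono-# tok (φ a))) (#-cong (Mono? φ (φ a) v) (Join? v a) to
      λ e j → proj₂ (Mono-end v≢a j) refl)
    where
    to : ∀ e → Mono φ (φ a) v e → Join v a e
    to e (e∋v , mono) with other-end e v
    ... | z , z≢v , e∋z = e∋v , subst (e ∋_) (sole z (z≢v ∘ sym , e , e∋v , e∋z) (mono z e∋z z≢v)) e∋z

  colour-absent : ∀ {φ v κ} → Token φ v → (∀ z → Adj v z → φ z ≢ κ) → f v κ ≡ 0
  colour-absent {φ} {v} {κ} tok absent = trans (sym (Mono-# tok κ)) (#-zero (Mono? φ κ v) none)
    where
    none : ∀ e → ¬ Mono φ κ v e
    none e (e∋v , mono) with other-end e v
    ... | z , z≢v , e∋z = absent z (z≢v ∘ sym , e , e∋v , e∋z) (mono z e∋z z≢v)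

  module CycleHard {q} (c : Cycle q) {φ} (tok : Token φ (s c 0)) (φ1≢φn : φ (s c 1) ≢ φ (s c (3 + q))) where

    k l : Fin p
    k = φ (s c 1)
    l = φ (s c (3 + q))

    t : ℕ
    t = # (Join? (s c 0) (s c 1))

    Sides : Cycle q → Colouring → Fin p → Fin p → Set
    Sides c ψ k l = ψ (s c 1) ≡ k × ψ (s c (3 + q)) ≡ l

    -- A step of the token keeps `k` and `l` on its two cycle neighbours but exchanges their sides:
    -- by `across` the new vertex ahead has the colour that was behind, and the vertex just left
    -- inherits the colour that was ahead.
    around : ∀ m → ∃ λ ψ → Token ψ (s c m) × (Sides (shift c m) ψ k l ⊎ Sides (shift c m) ψ l k)
    around zero = φ , tok , inj₁ (refl , cong (λ i → φ (s c i)) (+-identityʳ (3 + q)))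
    around (suc m) = step (around m)
      where
      step : (∃ λ ψ → Token ψ (s c m) × (Sides (shift c m) ψ k l ⊎ Sides (shift c m) ψ l k)) →
        ∃ λ ψ → Token ψ (s c (suc m)) × (Sides (shift c (suc m)) ψ k l ⊎ Sides (shift c (suc m)) ψ l k)
      step (ψ , tok-ψ , sides) = ψ′ , move tok-ψ (edge c m) ,
          [ (λ (a , b) → inj₂ (trans ahead b , trans behind a)) , (λ (a , b) → inj₁ (trans ahead b , trans behind a)) ]′ sides
        where
        ψ′ = ψ [ s c m ≔ ψ (s c (suc m)) ]
        ahead : ψ′ (s c (suc (suc m))) ≡ ψ (s c (3 + q + m))
        ahead = trans (≔-≢ ψ _ (distinct c m 2 (s≤s z≤n) (s≤s (s≤s (s≤s z≤n))) ∘ sym)) (across (shift c m) tok-ψ)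
        behind : ψ′ (s c (3 + q + suc m)) ≡ ψ (s c (suc m))
        behind = trans (cong ψ′ (full-turn c m)) (≔-≡ ψ (s c m) _)

    sides⇒f : ∀ (c′ : Cycle q) {ψ k l} → # (Join? (s c′ 0) (s c′ 1)) ≡ t → k ≢ l → Token ψ (s c′ 0) → Sides c′ ψ k l →
      f (s c′ 0) k ≡ t × f (s c′ 0) l ≡ t × (∀ i → i ≢ k → i ≢ l → f (s c′ 0) i ≡ 0)
    sides⇒f c′ {ψ} eq k≢l tok-ψ (refl , refl) =
        trans (colour-sole tok-ψ (proj₁ (edge c′ 0)) sole-next) eq
      , trans (colour-sole tok-ψ (proj₁ (edge-back c′)) sole-previous) (trans (sym (#Join-turn c′)) eq)
      , λ i i≢k i≢l → colour-absent tok-ψ λ z adj ψz → [ (λ { refl → i≢k (sym ψz) }) , (λ { refl → i≢l (sym ψz) }) ]′ (nb adj)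
      where
      nb : ∀ {z} → Adj (s c′ 0) z → z ≡ s c′ 1 ⊎ z ≡ s c′ (3 + q)
      nb adj = on-neighbour c′ adj (covers c′ _)
      sole-next : ∀ z → Adj (s c′ 0) z → ψ z ≡ ψ (s c′ 1) → z ≡ s c′ 1
      sole-next z adj eq = [ id , (λ z≡ → ⊥-elim (k≢l (trans (sym eq) (cong ψ z≡)))) ]′ (nb adj)
      sole-previous : ∀ z → Adj (s c′ 0) z → ψ z ≡ ψ (s c′ (3 + q)) → z ≡ s c′ (3 + q)
      sole-previous z adj eq = [ (λ z≡ → ⊥-elim (k≢l (trans (cong ψ (sym z≡)) eq))) , id ]′ (nb adj)

    f-values : ∀ v → f v k ≡ t × f v l ≡ t × (∀ i → i ≢ k → i ≢ l → f v i ≡ 0)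
    f-values v = subst (λ v → f v k ≡ t × f v l ≡ t × (∀ i → i ≢ k → i ≢ l → f v i ≡ 0))
        (proj₂ (covers c v)) (values (proj₁ (covers c v)) (around (proj₁ (covers c v))))
      where
      values : ∀ m → (∃ λ ψ → Token ψ (s c m) × (Sides (shift c m) ψ k l ⊎ Sides (shift c m) ψ l k)) →
        f (s c m) k ≡ t × f (s c m) l ≡ t × (∀ i → i ≢ k → i ≢ l → f (s c m) i ≡ 0)
      values m (ψ , tok-ψ , inj₁ sides) = sides⇒f (shift c m) (#Join-edge c m) φ1≢φn tok-ψ sides
      values m (ψ , tok-ψ , inj₂ sides) =
        let (fl , fk , rest) = sides⇒f (shift c m) (#Join-edge c m) (φ1≢φn ∘ sym) tok-ψ sides
        in fk , fl , λ i i≢k i≢l → rest i i≢l i≢k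

    nV≡ : nV H ≡ 4 + q
    nV≡ = ≤-antisym (FinP.injective⇒≤ {f = pos} pos-inj)
      (FinP.injective⇒≤ {f = λ (i : Fin (4 + q)) → s c (toℕ i)} λ {i} {j} eq →
        FinP.toℕ-injective (s-injective c (FinP.toℕ<n i) (FinP.toℕ<n j) eq))
      where
      pos : Fin (nV H) → Fin (4 + q)
      pos x = fromℕ< (proj₁ (proj₂ (reduce c (covers c x))))
      s-pos : ∀ x → s c (toℕ (pos x)) ≡ x
      s-pos x = let (i , i<n , eq) = reduce c (covers c x) in trans (cong (s c) (FinP.toℕ-fromℕ< i<n)) eq
      pos-inj : ∀ {x y} → pos x ≡ pos y → x ≡ y
      pos-inj {x} {y} eq = trans (sym (s-pos x)) (trans (cong (λ i → s c (toℕ i)) eq) (s-pos y))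

    bound : ∀ (i : Fin (nV H)) → toℕ i < 4 + q
    bound i = subst (toℕ i <_) nV≡ (FinP.toℕ<n i)

    rotation : Fin (nV H) ↔ Fin (nV H)
    rotation = mk↔ₛ′ to from to-from λ i → to-injective (to-from (to i))
      where
      to from : Fin (nV H) → Fin (nV H)
      to i = s c (toℕ i)
      reduced : ∀ x → ∃ λ i → i < 4 + q × s c i ≡ x
      reduced x = reduce c (covers c x)
      from x = fromℕ< (subst (proj₁ (reduced x) <_) (sym nV≡) (proj₁ (proj₂ (reduced x))))
      to-from : ∀ x → to (from x) ≡ x
      to-from x = trans (cong (s c) (FinP.toℕ-fromℕ< _)) (proj₂ (proj₂ (reduced x)))
      to-injective : ∀ {i j} → to i ≡ to j → i ≡ j
      to-injective {i} {j} eq = FinP.toℕ-injective (s-injective c (bound i) (bound j) eq)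

    join-ahead : ∀ (i j : Fin (nV H)) → toℕ i < toℕ j →
      (CycAdj i j → # (Join? (s c (toℕ i)) (s c (toℕ j))) ≡ t) ×
      (¬ CycAdj i j → # (Join? (s c (toℕ i)) (s c (toℕ j))) ≡ 0)
    join-ahead i j i<j = adjacent , λ ¬adj → ¬Adj⇒#Join≡0 (distinct′ c i<j (bound j)) λ a → chord ¬adj a
      where
      adjacent : CycAdj i j → # (Join? (s c (toℕ i)) (s c (toℕ j))) ≡ t
      adjacent (inj₁ eq) = subst (λ m → # (Join? (s c (toℕ i)) (s c m)) ≡ t) eq (#Join-edge c (toℕ i))
      adjacent (inj₂ (inj₁ eq)) = ⊥-elim (<-asym i<j (≤-reflexive eq))
      adjacent (inj₂ (inj₂ (inj₁ (i≡0 , 1+j≡n)))) = trans (#Join-sym (s c (toℕ i)) (s c (toℕ j))) (trans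
        (cong (λ x → # (Join? (s c (toℕ j)) x)) (trans (cong (s c) i≡0) (sym (trans
          (cong (s c) (trans 1+j≡n (trans nV≡ (sym (+-identityʳ (4 + q)))))) (periodic c 0)))))
        (#Join-edge c (toℕ j)))
      adjacent (inj₂ (inj₂ (inj₂ (j≡0 , _)))) = ⊥-elim (n≮0 (subst (toℕ i <_) j≡0 i<j))
      chord : ¬ CycAdj i j → ¬ Adj (s c (toℕ i)) (s c (toℕ j))
      chord ¬adj a = chordless c (toℕ i) m 2≤m 2+m≤n (subst (λ k → Adj (s c (toℕ i)) (s c k)) (sym m+i≡j) a)
        where
        m = toℕ j ∸ toℕ i
        m+i≡j : m + toℕ i ≡ toℕ j
        m+i≡j = m∸n+n≡m (<⇒≤ i<j)
        2≤m : 2 ≤ m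
        2≤m = ≤∧≢⇒< (m<n⇒0<n∸m i<j) λ 1≡m → ¬adj (inj₁ (trans (cong (_+ toℕ i) 1≡m) m+i≡j))
        2+m≤n : 2 + m ≤ 4 + q
        2+m≤n with toℕ i ≟ 0
        ... | no i≢0 = ≤-trans (s≤s (≤-trans (≤-reflexive (+-comm 1 m)) (≤-trans (+-monoʳ-≤ m (n≢0⇒n>0 i≢0)) (≤-reflexive m+i≡j)))) (bound j)
        -- From position 0 the distance `3 + q` leads to the closing edge, which `CycAdj` lists as
        -- adjacent.
        ... | yes i≡0 = ≤∧≢⇒< (subst (_≤ 4 + q) (cong suc (sym m≡j)) (bound j)) λ eq →
                          ¬adj (inj₂ (inj₂ (inj₁ (i≡0 , trans (cong suc (sym m≡j)) (trans eq (sym nV≡))))))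
          where
          m≡j : m ≡ toℕ j
          m≡j = trans (sym (+-identityʳ m)) (trans (cong (m +_) (sym i≡0)) m+i≡j)

    CycAdj-sym : ∀ {n} {i j : Fin n} → CycAdj i j → CycAdj j i
    CycAdj-sym (inj₁ eq) = inj₂ (inj₁ eq)
    CycAdj-sym (inj₂ (inj₁ eq)) = inj₁ eq
    CycAdj-sym (inj₂ (inj₂ (inj₁ eq))) = inj₂ (inj₂ (inj₂ eq))
    CycAdj-sym (inj₂ (inj₂ (inj₂ eq))) = inj₂ (inj₂ (inj₁ eq))

    isTC : IsTC H t
    isTC = ordinary , rotation , joins
      where
      joins : ∀ i j → i ≢ j → (CycAdj i j → mult H (s c (toℕ i)) (s c (toℕ j)) ≡ t) ×
        (¬ CycAdj i j → mult H (s c (toℕ i)) (s c (toℕ j)) ≡ 0)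
      joins i j i≢j with <-cmp (toℕ i) (toℕ j)
      ... | tri< i<j _ _ = let (adj , nonadj) = join-ahead i j i<j ; eq = mult≡# (distinct′ c i<j (bound j)) in
              (λ a → trans eq (adj a)) , λ a → trans eq (nonadj a)
      ... | tri≈ _ i≡j _ = ⊥-elim (i≢j (FinP.toℕ-injective i≡j))
      ... | tri> _ _ j<i = let (adj , nonadj) = join-ahead j i j<i
                               eq = trans (mult≡# (distinct′ c j<i (bound i) ∘ sym)) (#Join-sym (s c (toℕ i)) (s c (toℕ j))) in
              (λ a → trans eq (adj (CycAdj-sym a))) , λ a → trans eq (nonadj (a ∘ CycAdj-sym))

    5≤nV : 5 ≤ nV H
    5≤nV = subst (5 ≤_) (sym nV≡) (≤∧≢⇒< (m≤m+n 4 q) λ 4≡ → not-four (subst Odd (sym 4≡) (odd-period c tok φ1≢φn)))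
      where
      not-four : ¬ Odd 4
      not-four (k , eq) = lemma k (suc-injective eq)
        where
        lemma : ∀ k → 3 ≢ 2 * k
        lemma (suc zero) ()
        lemma (suc (suc zero)) ()
        lemma (suc (suc (suc k))) eq with () ← trans eq (*-suc 2 (2 + k))

    hard : Hard p H f
    hard = hard-C H f t k l
      (subst (0 <_) (sym (#-suc (Join? (s c 0) (s c 1)) (proj₂ (proj₂ (edge c 0))))) (s≤s z≤n))
      5≤nV (subst Odd (sym nV≡) (odd-period c tok φ1≢φn)) isTC φ1≢φn
      (λ v → proj₁ (f-values v)) (λ v → proj₁ (proj₂ (f-values v))) λ v → proj₂ (proj₂ (f-values v))

  cycle⇒hard : ∀ {q} → Cycle q → Hard p H f
  cycle⇒hard c = let (_ , tok , φ1≢φn) = two-coloured c in CycleHard.hard c tok φ1≢φn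

  -- Finding an induced cycle

  -- Indices are reduced modulo `4 + q` to make the finite list periodic. Since `y < 4 + q`, the
  -- condition `y ≢ 3 + q + x` exempts only the pair 0 and `3 + q`, which `closing` joins.
  module Close {q} (h : ℕ → Fin (nV H))
    (inj : ∀ {x y} → x < y → y < 4 + q → h x ≢ h y)
    (step : ∀ {x} → suc x < 4 + q → Adj (h x) (h (suc x)))
    (closing : Adj (h (3 + q)) (h 0))
    (no-chord : ∀ {x y} → 2 + x ≤ y → y < 4 + q → y ≢ 3 + q + x → ¬ Adj (h x) (h y)) where

    n = 4 + q

    -- Both `m` and `i % n` lie below `n`, so their sum passes `n` at most once, with overshoot `y`.
    -- Each cycle property thus becomes one about two ordered indices below `n`.
    wrap : ∀ i m → m < n → (m + i % n < n × (m + i) % n ≡ m + i % n) ⊎ (∃ λ y → y < n × n + y ≡ m + i % n × (m + i) % n ≡ y)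
    wrap i m m<n = by-size (m + i % n <? n)
      where
      mod : (m + i) % n ≡ (m + i % n) % n
      mod = trans (cong (_% n) (trans (cong (m +_) (m≡m%n+[m/n]*n i n)) (sym (+-assoc m (i % n) _)))) ([m+kn]%n≡m%n (m + i % n) (i / n) n)
      by-size : Dec (m + i % n < n) → _
      by-size (yes lt) = inj₁ (lt , trans mod (m<n⇒m%n≡m lt))
      by-size (no ge) = inj₂ (y , y<n , n+y , trans mod (trans (cong (_% n) (trans (sym n+y) (+-comm n y))) (trans ([m+n]%n≡m%n y n) (m<n⇒m%n≡m y<n))))
        where
        y = m + i % n ∸ n
        n+y : n + y ≡ m + i % n
        n+y = m+[n∸m]≡n (≮⇒≥ ge)
        y<n : y < n
        y<n = +-cancelˡ-< n y n (subst (_< n + n) (sym n+y) (+-mono-< m<n (m%n<n i n)))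

    cycle : Cycle q
    cycle = record
      { s         = λ i → h (i % n)
      ; periodic  = λ i → cong h (trans (cong (_% n) (+-comm n i)) ([m+n]%n≡m%n i n))
      ; distinct  = closed-distinct
      ; edge      = closed-edge
      ; chordless = closed-chordless
      }
      where
      closed-distinct : ∀ i m → 0 < m → m < n → h (i % n) ≢ h ((m + i) % n)
      closed-distinct i m 0<m m<n = [ (λ (lt , eq) → subst (λ y → h (i % n) ≢ h y) (sym eq) (inj (m<n+m (i % n) 0<m) lt))
        , (λ (y , y<n , n+y , eq) → subst (λ y → h (i % n) ≢ h y) (sym eq)
            (inj (+-cancelˡ-< m y (i % n) (subst (m + y <_) n+y (+-monoˡ-< y m<n))) (m%n<n i n) ∘ sym)) ]′ (wrap i m m<n)
      closed-edge : ∀ i → Adj (h (i % n)) (h (suc i % n))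
      closed-edge i = [ (λ (lt , eq) → subst (λ y → Adj (h (i % n)) (h y)) (sym eq) (step lt))
        , (λ (y , y<n , n+y , eq) → subst₂ (λ x y → Adj (h x) (h y)) (last y n+y) (trans (first y n+y) (sym eq)) closing) ]′ (wrap i 1 (s≤s (s≤s z≤n)))
        where
        full : ∀ y → n + y ≡ suc (i % n) → n ≡ suc (i % n)
        full y eq = ≤-antisym (≤-trans (m≤m+n n y) (≤-reflexive eq)) (m%n<n i n)
        last : ∀ y → n + y ≡ suc (i % n) → 3 + q ≡ i % n
        last y eq = suc-injective (full y eq)
        first : ∀ y → n + y ≡ suc (i % n) → 0 ≡ y
        first y eq = sym (+-cancelˡ-≡ n y 0 (trans eq (trans (sym (full y eq)) (sym (+-identityʳ n)))))
      closed-chordless : ∀ i m → 2 ≤ m → 2 + m ≤ n → ¬ Adj (h (i % n)) (h ((m + i) % n))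
      closed-chordless i m 2≤m 2+m≤n = [ (λ (lt , eq) → subst (λ y → ¬ Adj (h (i % n)) (h y)) (sym eq)
              (no-chord (+-monoˡ-≤ (i % n) 2≤m) lt λ eq → <-irrefl (+-cancelʳ-≡ (i % n) m (3 + q) eq) (s≤s⁻¹ 2+m≤n)))
        , (λ (y , y<n , n+y , eq) → subst (λ y → ¬ Adj (h (i % n)) (h y)) (sym eq)
              (no-chord (+-cancelˡ-≤ m (2 + y) (i % n) (subst (m + (2 + y) ≤_) n+y
                  (subst (_≤ n + y) (trans (cong (_+ y) (+-comm 2 m)) (+-assoc m 2 y)) (+-monoˡ-≤ y 2+m≤n)))) (m%n<n i n)
                (λ eq′ → <-irrefl (+-cancelʳ-≡ (3 + q + y) 1 m (trans n+y (cong (m +_) eq′))) 2≤m)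
               ∘ Adj-sym)) ]′ (wrap i m (<⇒≤ 2+m≤n))

  record Trail (v : Fin (nV H)) (g : ℕ → Fin (nV H)) (k : ℕ) : Set where
    field
      adj   : ∀ i → i < k → Adj (g i) (g (suc i))
      avoid : ∀ i → i ≤ k → g i ≢ v

  walk⇒trail : ∀ {v a b} → Walk (_≢ v) a b → a ≢ v → ∃ λ k → ∃ λ g → Trail v g k × g 0 ≡ a × g k ≡ b
  walk⇒trail {a = a} [] a≢v = 0 , (λ _ → a) , record { adj = λ _ () ; avoid = λ _ _ → a≢v } , refl , refl
  walk⇒trail {v} {a} ((ac , c≢v) ∷ walk) a≢v =
    let (k , g , tr , g0 , gk) = walk⇒trail walk c≢v in
    suc k , cons g , record { adj = adj′ tr g0 ; avoid = λ { zero _ → a≢v ; (suc i) (s≤s i≤k) → Trail.avoid tr i i≤k } } , refl , gk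
    where
    cons : (ℕ → Fin (nV H)) → ℕ → Fin (nV H)
    cons g zero    = a
    cons g (suc i) = g i
    adj′ : ∀ {g k} → Trail v g k → g 0 ≡ _ → ∀ i → i < suc k → Adj (cons g i) (cons g (suc i))
    adj′ tr g0 zero    _         = subst (Adj a) (sym g0) ac
    adj′ tr g0 (suc i) (s≤s i<k) = Trail.adj tr i i<k

  truncate : ∀ {v g k j} → Trail v g k → j ≤ k → Trail v g j
  truncate tr j≤k = record
    { adj = λ i i<j → Trail.adj tr i (<-≤-trans i<j j≤k) ; avoid = λ i i≤j → Trail.avoid tr i (≤-trans i≤j j≤k) }

  skip : (ℕ → Fin (nV H)) → ℕ → ℕ → ℕ → Fin (nV H)
  skip g i δ m = if does (m ≤? i) then g m else g (δ + m)

  skip-≤ : ∀ g {i} δ {m} → m ≤ i → skip g i δ m ≡ g m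
  skip-≤ g {i} δ {m} m≤i = cong (λ b → if b then g m else g (δ + m)) (does-true (m ≤? i) m≤i)

  skip-> : ∀ g {i} δ {m} → i < m → skip g i δ m ≡ g (δ + m)
  skip-> g {i} δ {m} i<m = cong (λ b → if b then g m else g (δ + m)) (dec-false (m ≤? i) (<⇒≱ i<m))

  shortcut : ∀ {v g k i δ} → Trail v g k → δ + suc i ≤ k → Adj (g i) (g (δ + suc i)) → Trail v (skip g i δ) (k ∸ δ)
  shortcut {v} {g} {k} {i} {δ} tr bound jump = record { adj = adj′ ; avoid = avoid′ }
    where
    open Trail tr
    δ≤k : δ ≤ k
    δ≤k = ≤-trans (m≤m+n δ (suc i)) bound
    i<k∸δ : i < k ∸ δ
    i<k∸δ = +-cancelˡ-≤ δ _ _ (subst (δ + suc i ≤_) (sym (m+[n∸m]≡n δ≤k)) bound)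
    adj′ : ∀ m → m < k ∸ δ → Adj (skip g i δ m) (skip g i δ (suc m))
    adj′ m m< with <-cmp m i
    ... | tri< m<i _ _ = subst₂ Adj (sym (skip-≤ g δ (<⇒≤ m<i))) (sym (skip-≤ g δ m<i))
                           (adj m (<-≤-trans (<-trans m<i i<k∸δ) (m∸n≤m k δ)))
    ... | tri≈ _ refl _ = subst₂ Adj (sym (skip-≤ g δ ≤-refl)) (sym (skip-> g δ ≤-refl)) jump
    ... | tri> _ _ i<m = subst₂ Adj (sym (skip-> g δ i<m)) (sym (trans (skip-> g δ (m≤n⇒m≤1+n i<m)) (cong g (+-suc δ m))))
                           (adj (δ + m) (subst (_≤ k) (+-suc δ m) (subst (δ + suc m ≤_) (m+[n∸m]≡n δ≤k) (+-monoʳ-≤ δ m<))))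
    avoid′ : ∀ m → m ≤ k ∸ δ → skip g i δ m ≢ v
    avoid′ m m≤ eq with m ≤? i
    ... | yes m≤i = avoid m (≤-trans m≤ (m∸n≤m k δ)) (trans (sym (skip-≤ g δ m≤i)) eq)
    ... | no  m≰i = avoid (δ + m) (subst (δ + m ≤_) (m+[n∸m]≡n δ≤k) (+-monoʳ-≤ δ m≤)) (trans (sym (skip-> g δ (≰⇒> m≰i))) eq)

  -- A chord of the trail, with both `i` and `δ` bounded so that `anyUpTo?` decides it;
  -- `suc δ + suc i` runs through the positions at least two beyond `i`.
  Jump : (ℕ → Fin (nV H)) → ℕ → Set
  Jump g k = ∃ λ i → i < k × ∃ λ δ → δ < k × suc δ + suc i ≤ k × Adj (g i) (g (suc δ + suc i))

  jump-free : ∀ g k → ¬ Jump g k → ∀ i j → 2 + i ≤ j → j ≤ k → ¬ Adj (g i) (g j)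
  jump-free g k ¬jump i j 2+i≤j j≤k a = ¬jump (i , <-≤-trans (≤-trans (n≤1+n _) 2+i≤j) j≤k , j ∸ (2 + i) ,
      <-≤-trans (∸-monoʳ-< {j} {2 + i} {0} (s≤s z≤n) 2+i≤j) j≤k ,
      subst (_≤ k) (sym eq) j≤k , subst (λ m → Adj (g i) (g m)) (sym eq) a)
    where
    eq : suc (j ∸ (2 + i)) + suc i ≡ j
    eq = trans (sym (+-suc (j ∸ (2 + i)) (suc i))) (m∸n+n≡m 2+i≤j)

  Closes : ℕ → Set
  Closes k = ∀ v g → Trail v g k → Adj v (g 0) → Adj v (g k) → g 0 ≢ g k → ¬ Adj (g 0) (g k) → ∃ Cycle

  -- A shortest trail between non-adjacent neighbours of v closes up to an induced cycle through v.
  closes : ∀ k → Closes k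
  closes = <-rec Closes reduce-trail
    where
    reduce-trail : ∀ k → (∀ {j} → j < k → Closes j) → Closes k
    reduce-trail zero rec v g tr v0 vk 0≢k ¬0k = ⊥-elim (0≢k refl)
    reduce-trail (suc zero) rec v g tr v0 vk 0≢k ¬0k = ⊥-elim (¬0k (Trail.adj tr 0 ≤-refl))
    reduce-trail k@(suc (suc q)) rec v g tr v0 vk 0≢k ¬0k
      with anyUpTo? (λ i → g i FinP.≟ g k) k
         | anyUpTo? (λ i → anyUpTo? (λ δ → (suc δ + suc i ≤? k) ×-dec Adj? (g i) (g (suc δ + suc i))) k) k
         | anyUpTo? (λ j → (0 <? j) ×-dec Adj? v (g j)) k
    ... | yes (i , i<k , gi≡gk) | _ | _ = rec i<k v g (truncate tr (<⇒≤ i<k)) v0 (subst (Adj v) (sym gi≡gk) vk)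
            (λ eq → 0≢k (trans eq gi≡gk)) λ a → ¬0k (subst (Adj (g 0)) gi≡gk a)
    ... | no _ | yes (i , _ , δ , _ , bound , jump) | _ =
            rec (s≤s (m∸n≤m (suc q) δ)) v (skip g i (suc δ)) (shortcut tr bound jump)
              (subst (Adj v) (sym start) v0) (subst (Adj v) (sym finish) vk)
              (λ eq → 0≢k (trans (sym start) (trans eq finish))) (λ a → ¬0k (subst₂ Adj start finish a))
      where
      start : skip g i (suc δ) 0 ≡ g 0
      start = skip-≤ g {i} (suc δ) z≤n
      δ≤k : suc δ ≤ k
      δ≤k = ≤-trans (m≤m+n (suc δ) (suc i)) bound
      finish : skip g i (suc δ) (k ∸ suc δ) ≡ g k
      finish = trans (skip-> g (suc δ) (+-cancelˡ-≤ (suc δ) _ _ (subst (suc δ + suc i ≤_) (sym (m+[n∸m]≡n δ≤k)) bound)))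
                 (cong g (m+[n∸m]≡n δ≤k))
    ... | no ¬repeat | no ¬jump | yes (j , j<k , 0<j , vj) = spoke j j<k 0<j vj
      where
      no-jump = jump-free g k ¬jump
      spoke : ∀ j → j < k → 0 < j → Adj v (g j) → ∃ Cycle
      -- The trail is cut at the neighbour of `v`; its new ends are non-adjacent because there is no
      -- jump.
      spoke (suc (suc j)) j<k _ vj = rec j<k v g (truncate tr (<⇒≤ j<k)) v0 vj
        (λ eq → no-jump′ eq) (no-jump 0 (2 + j) (s≤s (s≤s z≤n)) (<⇒≤ j<k))
        where
        no-jump′ : g 0 ≢ g (2 + j)
        no-jump′ eq = no-jump 0 (3 + j) (s≤s (s≤s z≤n)) j<k (subst (λ x → Adj x (g (3 + j))) (sym eq) (Trail.adj tr (2 + j) j<k))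
      spoke (suc zero) j<k _ v1 = by-length q refl
        where
        by-length : ∀ q′ → q ≡ q′ → ∃ Cycle
        -- Here `v` is adjacent to all of `g 0`, `g 1`, `g 2`: a diamond. For a longer trail `g 0`
        -- is dropped instead.
        by-length zero refl = ⊥-elim (¬0k (no-diamond v1 vk (Trail.adj tr 1 ≤-refl) v0 (Adj-sym (Trail.adj tr 0 (s≤s z≤n))) 0≢k))
        by-length (suc q′) refl = rec {suc q} ≤-refl v (g ∘ suc) (record
          { adj = λ i i<k → Trail.adj tr (suc i) (s≤s i<k) ; avoid = λ i i≤k → Trail.avoid tr (suc i) (s≤s i≤k) })
          v1 vk (λ eq → ¬repeat (1 , s≤s (s≤s z≤n) , eq)) (no-jump 1 k (s≤s (s≤s (s≤s z≤n))) ≤-refl)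
    ... | no ¬repeat | no ¬jump | no ¬spoke = q , Close.cycle h inj step (Adj-sym vk) no-chord
      where
      h : ℕ → Fin (nV H)
      h zero    = v
      h (suc i) = g i
      no-jump = jump-free g k ¬jump
      inj : ∀ {x y} → x < y → y < 4 + q → h x ≢ h y
      inj {zero} {suc j} _ y<n eq = Trail.avoid tr j (s≤s⁻¹ (s≤s⁻¹ y<n)) (sym eq)
      inj {suc i} {suc j} (s≤s i<j) y<n eq with m≤n⇒m<n∨m≡n (s≤s⁻¹ (s≤s⁻¹ y<n))
      ... | inj₂ refl = ¬repeat (i , i<j , eq)
      -- A repetition before the end is itself a jump, from `i` to the successor of `j`; so only
      -- repetitions of `g k` had to be searched for.
      ... | inj₁ j<k = no-jump i (suc j) (s≤s i<j) j<k (subst (λ x → Adj x (g (suc j))) (sym eq) (Trail.adj tr j j<k))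
      step : ∀ {x} → suc x < 4 + q → Adj (h x) (h (suc x))
      step {zero}  _ = v0
      step {suc i} x<n = Trail.adj tr i (s≤s⁻¹ (s≤s⁻¹ x<n))
      no-chord : ∀ {x y} → 2 + x ≤ y → y < 4 + q → y ≢ 3 + q + x → ¬ Adj (h x) (h y)
      no-chord {zero} {suc j} 2≤y y<n y≢ a = ¬spoke (j , ≤∧≢⇒< (s≤s⁻¹ (s≤s⁻¹ y<n))
        (λ j≡k → y≢ (cong suc (trans j≡k (sym (+-identityʳ k))))) , s≤s⁻¹ 2≤y , a)
      no-chord {suc i} {suc j} (s≤s 2+i≤j) y<n _ a = no-jump i j 2+i≤j (s≤s⁻¹ (s≤s⁻¹ y<n)) a

  -- Applying `return` to the set of `v` and `b`, entered from `a`, forces the landing to be `b`.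
  -- This yields a walk from `a` to `b` that avoids `v`.
  open-path⇒hard : ∀ {v a b} → Adj v a → Adj v b → a ≢ b → ¬ Adj a b → Hard p H f
  open-path⇒hard {v} {a} {b} va vb a≢b ¬ab = from-trail (walk⇒trail (weaken (λ x ¬S x≡v → ¬S (inj₁ x≡v)) outside ++ ((back′ , b≢v) ∷ [])) a≢v)
    where
    a≢v : a ≢ v
    a≢v = proj₁ va ∘ sym
    b≢v : b ≢ v
    b≢v = proj₁ vb ∘ sym
    open Return (return noCut ((FinP._≟ v) ∪? (FinP._≟ b)) (inj₁ refl) [ a≢v , a≢b ]′ (b , inj₂ refl , b≢v))
    back′ : Adj last b
    back′ = subst (Adj last) ([ (λ eq → ⊥-elim (landing≢ eq)) , id ]′ landing∈) back
    from-trail : (∃ λ k → ∃ λ g → Trail v g k × g 0 ≡ a × g k ≡ b) → Hard p H f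
    from-trail (k , g , tr , refl , refl) = cycle⇒hard (proj₂ (closes k v g tr va vb a≢b ¬ab))

  -- Complete blocks

  -- `ns i` is the size of class `i` with the token on `t₀`; moves preserve class sizes, so the same
  -- numbers serve every vertex. Multiplicities agree because any two neighbours of a vertex form a
  -- triangle with it.
  complete⇒hard : (∀ u w → u ≢ w → Adj u w) → Hard p H f
  complete⇒hard adj = hard-K H f t ns
      (subst (0 <_) (sym (#-suc (Join? t₀ x₀) (proj₂ (proj₂ (adj t₀ x₀ (x₀≢t₀ ∘ sym)))))) (s≤s z≤n))
      (subst (3 ≤_) (#-all (⊤? {nV H}) (λ _ → tt)) (#-three (⊤? {nV H}) x₀≢t₀ x₀≢y₀ (y₀≢t₀ ∘ sym) tt tt tt))
      (ordinary , λ u w u≢w → trans (mult≡# u≢w) (#Join-t u w u≢w))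
      (φ₀ x₀ , φ₀ y₀ , φx₀≢φy₀ , (λ eq → #-≡0⇒¬ (cls φ₀ (φ₀ x₀) t₀) eq x₀ (refl , x₀≢t₀)) ,
        λ eq → #-≡0⇒¬ (cls φ₀ (φ₀ y₀) t₀) eq y₀ (refl , y₀≢t₀))
      total (λ v i → f-value v i (v FinP.≟ t₀))
    where
    x₀≢y₀ : x₀ ≢ y₀
    x₀≢y₀ eq = φx₀≢φy₀ (cong φ₀ eq)
    t : ℕ
    t = # (Join? t₀ x₀)
    cls : (φ : Colouring) → ∀ i v → Decidable (λ x → φ x ≡ i × x ≢ v)
    cls φ i v = (λ x → φ x FinP.≟ i) ∖? v
    ns : Fin p → ℕ
    ns i = # (cls φ₀ i t₀)
    turn : ∀ v a b → v ≢ a → v ≢ b → a ≢ b → # (Join? v a) ≡ # (Join? v b)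
    turn v a b v≢a v≢b a≢b = from-colouring (two-colours va vb a≢b)
      where
      va = adj v a v≢a
      vb = adj v b v≢b
      from-colouring : (∃ λ φ → Token φ v × φ a ≢ φ b) → # (Join? v a) ≡ # (Join? v b)
      from-colouring (φ , tok , φa≢φb) =
        let (φ′ , tok′ , φ′a , φ′b , rest) = triangle-swap tok va (adj a b a≢b) (Adj-sym vb)
        in swap⇒#Join≡ tok tok′ v≢a v≢b φa≢φb φ′a φ′b λ x vx x≢a x≢b → rest x (proj₁ vx ∘ sym) x≢a x≢b
    from-t₀ : ∀ w → t₀ ≢ w → # (Join? t₀ w) ≡ t
    from-t₀ w t₀≢w with w FinP.≟ x₀
    ... | yes refl = refl
    ... | no w≢x₀  = turn t₀ w x₀ t₀≢w (x₀≢t₀ ∘ sym) w≢x₀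
    #Join-t : ∀ u w → u ≢ w → # (Join? u w) ≡ t
    #Join-t u w u≢w with u FinP.≟ t₀ | w FinP.≟ t₀
    ... | yes refl | _ = from-t₀ w u≢w
    ... | no u≢t₀ | yes refl = trans (#Join-sym u t₀) (from-t₀ u (u≢t₀ ∘ sym))
    ... | no u≢t₀ | no w≢t₀ = trans (turn u w t₀ u≢w u≢t₀ w≢t₀) (trans (#Join-sym u t₀) (from-t₀ u (u≢t₀ ∘ sym)))
    token-f : ∀ {φ v} → Token φ v → ∀ i → f v i ≡ t * # (cls φ i v)
    token-f {φ} {v} tok i = trans (sym (Mono-# tok i)) (#Star (λ x → φ x FinP.≟ i) v t λ u _ u≢v → #Join-t v u (u≢v ∘ sym))
    -- The move only lets `t₀` replace `v` in its class, so exchanging these two vertices is a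
    -- bijection of classes.
    class-move : ∀ v i → v ≢ t₀ → # (cls (φ₀ [ t₀ ≔ φ₀ v ]) i v) ≡ ns i
    class-move v i v≢t₀ = ≤-antisym
        (#-injection (cls φ₁ i v) (cls φ₀ i t₀) (λ x _ → swap-in v t₀ x) to (λ x y (_ , x≢v) (_ , y≢v) → swap-inj v t₀ x≢v y≢v))
        (#-injection (cls φ₀ i t₀) (cls φ₁ i v) (λ x _ → swap-in t₀ v x) from (λ x y (_ , x≢t) (_ , y≢t) → swap-inj t₀ v x≢t y≢t))
      where
      φ₁ = φ₀ [ t₀ ≔ φ₀ v ]
      swap-in : Fin (nV H) → Fin (nV H) → Fin (nV H) → Fin (nV H)
      swap-in new old x = if does (x FinP.≟ old) then new else x
      swap-inj : ∀ new old {x y} → x ≢ new → y ≢ new → swap-in new old x ≡ swap-in new old y → x ≡ y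
      swap-inj new old {x} {y} x≢ y≢ eq with x FinP.≟ old | y FinP.≟ old
      ... | yes refl | yes refl = refl
      ... | yes _    | no _     = ⊥-elim (y≢ (sym eq))
      ... | no _     | yes _    = ⊥-elim (x≢ eq)
      ... | no _     | no _     = eq
      to : ∀ x → φ₁ x ≡ i × x ≢ v → φ₀ (swap-in v t₀ x) ≡ i × swap-in v t₀ x ≢ t₀
      to x (eq , x≢v) with x FinP.≟ t₀
      ... | yes _ = eq , v≢t₀
      ... | no x≢t₀ = eq , x≢t₀
      from : ∀ x → φ₀ x ≡ i × x ≢ t₀ → φ₁ (swap-in t₀ v x) ≡ i × swap-in t₀ v x ≢ v
      from x (eq , x≢t₀) with x FinP.≟ v
      ... | yes refl = trans (≔-≡ φ₀ t₀ (φ₀ v)) eq , v≢t₀ ∘ sym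
      ... | no x≢v = trans (≔-≢ φ₀ (φ₀ v) x≢t₀) eq , x≢v
    f-value : ∀ v i → Dec (v ≡ t₀) → f v i ≡ t * ns i
    f-value v i (yes refl) = token-f tok₀ i
    f-value v i (no v≢t₀) = trans (token-f (move tok₀ (adj t₀ v (v≢t₀ ∘ sym))) i) (cong (t *_) (class-move v i v≢t₀))
    total : sumFin ns ≡ nV H ∸ 1
    total = trans (≤-antisym
        (Σ#-≤ (λ i → cls φ₀ i t₀) ((⊤? {nV H}) ∖? t₀) (λ i x (_ , x≢t₀) → tt , x≢t₀) λ i j x (eq , _) (eq′ , _) → trans (sym eq) eq′)
        (Σ#-≥ (λ i → cls φ₀ i t₀) ((⊤? {nV H}) ∖? t₀) λ x (_ , x≢t₀) → φ₀ x , refl , x≢t₀))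
      (cong (_∸ 1) (trans (sym (#-suc (⊤? {nV H}) {t₀} tt)) (#-all (⊤? {nV H}) (λ _ → tt))))

  mixed⇒hard : Hard p H f
  mixed⇒hard = by-search (FinP.any? λ v → FinP.any? λ a → FinP.any? λ b →
      Adj? v a ×-dec Adj? v b ×-dec ¬? (a FinP.≟ b) ×-dec ¬? (Adj? a b))
    where
    by-search : Dec (∃ λ v → ∃ λ a → ∃ λ b → Adj v a × Adj v b × a ≢ b × ¬ Adj a b) → Hard p H f
    by-search (yes (v , a , b , va , vb , a≢b , ¬ab)) = open-path⇒hard va vb a≢b ¬ab
    by-search (no ¬open) = complete⇒hard λ u w u≢w → decidable-stable (Adj? u w) λ ¬uw → escape u w u≢w ¬uw
      where
      -- An edge leaving the closed neighbourhood of `u` joins a neighbour `x` of `u` to a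
      -- non-neighbour `y`: an open path with centre `x`.
      escape : ∀ u w → u ≢ w → ¬ Adj u w → ⊥
      escape u w u≢w ¬uw = clash (proj₂ conn ⟦ N? ⟧ (u , ∈⟦⟧⁺ N? (inj₁ refl)) (w , λ w∈ → [ (λ w≡u → u≢w (sym w≡u)) , ¬uw ]′ (∈⟦⟧⁻ N? w∈)))
        where
        N? = (FinP._≟ u) ∪? Adj? u
        clash : (∃ λ e → ∃ λ x → ∃ λ y → e ∋ x × x ∈ₛ ⟦ N? ⟧ × e ∋ y × ¬ (y ∈ₛ ⟦ N? ⟧)) → ⊥
        clash (e , x , y , e∋x , x∈ , e∋y , y∉) = at (∈⟦⟧⁻ N? x∈)
          where
          xy : Adj x y
          xy = (λ { refl → y∉ x∈ }) , e , e∋x , e∋y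
          at : x ≡ u ⊎ Adj u x → ⊥
          at (inj₁ refl) = y∉ (∈⟦⟧⁺ N? (inj₂ xy))
          at (inj₂ ux) = ¬open (x , u , y , Adj-sym ux , xy , (λ u≡y → y∉ (∈⟦⟧⁺ N? (inj₁ (sym u≡y)))) , λ uy → y∉ (∈⟦⟧⁺ N? (inj₂ uy)))

-- Blocks with a single colour

module Monochromatic {p} (H : Hypergraph) (f : VFun p H) (conn : Connected H)
  (f≥deg : ∀ v → deg H v ≤ sumFin (f v)) (unpart : ¬ Partitionable H f) where

  open Edges H
  open Colourings H f
  open Moves f≥deg unpart

  Uniform : Fin p → Fin (nV H) → Set
  Uniform j v = ∃ λ φ → Token φ v × (∀ x → x ≢ v → φ x ≡ j)

  uniform-move : ∀ {j v u} → Adj v u → Uniform j v → Uniform j u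
  uniform-move {j} {v} {u} vu (φ , tok , all-j) = φ [ v ≔ φ u ] , move tok vu , recoloured
    where
    recoloured : ∀ x → x ≢ u → (φ [ v ≔ φ u ]) x ≡ j
    recoloured x x≢u with x FinP.≟ v
    ... | yes _  = all-j u (proj₁ vu ∘ sym)
    ... | no x≢v = all-j x x≢v

  uniform-everywhere : ∀ {j} k Z → # (λ x → ¬? (x ∈?ₛ Z)) ≤ k → ∃ (_∈ₛ Z) → (∀ z → z ∈ₛ Z → Uniform j z) → ∀ v → Uniform j v
  uniform-everywhere {j} k Z bound ne uniform v with v ∈?ₛ Z
  ... | yes v∈Z = uniform v v∈Z
  ... | no  v∉Z = enlarge k bound (proj₂ conn Z ne (v , v∉Z))
    where
    enlarge : ∀ k → # (λ x → ¬? (x ∈?ₛ Z)) ≤ k → (∃ λ e → ∃ λ u → ∃ λ w → e ∋ u × u ∈ₛ Z × e ∋ w × ¬ (w ∈ₛ Z)) → Uniform j v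
    enlarge zero bound _ = ⊥-elim (#-≡0⇒¬ (λ x → ¬? (x ∈?ₛ Z)) (n≤0⇒n≡0 bound) v v∉Z)
    enlarge (suc k) bound (e , u , w , e∋u , u∈Z , e∋w , w∉Z) = uniform-everywhere k ⟦ Z′? ⟧
        (s≤s⁻¹ (≤-trans (#-strict (λ x → ¬? (x ∈?ₛ ⟦ Z′? ⟧)) (λ x → ¬? (x ∈?ₛ Z))
          (λ x x∉Z′ x∈Z → x∉Z′ (∈⟦⟧⁺ Z′? (inj₁ x∈Z))) w∉Z λ w∉Z′ → w∉Z′ (∈⟦⟧⁺ Z′? (inj₂ refl))) bound))
        (u , ∈⟦⟧⁺ Z′? (inj₁ u∈Z))
        (λ z z∈Z′ → [ uniform z , (λ { refl → uniform-move ((λ { refl → w∉Z u∈Z }) , e , e∋u , e∋w) (uniform u u∈Z) }) ]′ (∈⟦⟧⁻ Z′? z∈Z′)) v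
      where Z′? = (_∈?ₛ Z) ∪? (FinP._≟ w)

  uniform⇒hard : IsBlock H → ∀ {j v} → Uniform j v → Hard p H f
  uniform⇒hard block {j} {v₀} uniform₀ = hard-M H f j block
      (λ v → own (uniform v)) (λ v i i≢j → foreign i i≢j (uniform v))
    where
    uniform : ∀ v → Uniform j v
    uniform = uniform-everywhere _ ⟦ FinP._≟ v₀ ⟧ ≤-refl (v₀ , ∈⟦⟧⁺ (FinP._≟ v₀) refl)
      λ z z∈ → subst (Uniform j) (sym (∈⟦⟧⁻ (FinP._≟ v₀) z∈)) uniform₀
    own : ∀ {v} → Uniform j v → f v j ≡ deg H v
    own {v} (φ , tok , all-j) = trans (sym (Mono-# tok j))
      (#-cong (Mono? φ j v) (_∋? v) (λ e → proj₁) λ e e∋v → e∋v , λ u _ u≢v → all-j u u≢v)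
    foreign : ∀ {v} i → i ≢ j → Uniform j v → f v i ≡ 0
    foreign {v} i i≢j (φ , tok , all-j) = trans (sym (Mono-# tok i)) (#-zero (Mono? φ i v) none)
      where
      none : ∀ e → ¬ Mono φ i v e
      none e (e∋v , c) with other-end e v
      ... | x , x≢v , e∋x = i≢j (trans (sym (c x e∋x x≢v)) (all-j x x≢v))

block⇒hard : ∀ {p} → Fin p → (H : Hypergraph) (f : VFun p H) → IsBlock H → (∀ v → deg H v ≤ sumFin (f v)) →
  ¬ Partitionable H f → Hard p H f
block⇒hard {p} c₀ H f block@(conn , ¬sep) f≥deg unpart = by-token (token-exists v₀)
  where
  open Colourings H f
  open Existence c₀ conn f≥deg
  open Monochromatic H f conn f≥deg unpart
  v₀ : Fin (nV H)
  v₀ = fromℕ< (proj₁ conn)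
  by-token : ∃ (λ φ → Token φ v₀) → Hard p H f
  by-token (φ , tok) = by-colours
      (FinP.any? λ x → FinP.any? λ y → ¬? (x FinP.≟ v₀) ×-dec ¬? (y FinP.≟ v₀) ×-dec ¬? (φ x FinP.≟ φ y))
      (FinP.any? λ x → ¬? (x FinP.≟ v₀))
    where
    by-colours : Dec (∃ λ x → ∃ λ y → x ≢ v₀ × y ≢ v₀ × φ x ≢ φ y) → Dec (∃ λ x → x ≢ v₀) → Hard p H f
    by-colours (yes (x , y , x≢ , y≢ , φx≢φy)) _ =
      Structure.mixed⇒hard H f conn f≥deg unpart (block⇒noCut H ¬sep) φ v₀ tok x y x≢ y≢ φx≢φy
    by-colours (no ¬mixed) (yes (x , x≢)) = uniform⇒hard block (φ , tok , λ y y≢ →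
      decidable-stable (φ y FinP.≟ φ x) λ φy≢φx → ¬mixed (y , x , y≢ , x≢ , φy≢φx))
    -- `v₀` is the only vertex, so any colour, here `c₀`, is uniform vacuously.
    by-colours (no _) (no ¬other) = uniform⇒hard block {c₀} (φ , tok , λ x x≢ → ⊥-elim (¬other (x , x≢)))

-- Splitting at a separating vertex

record Enumeration {n} (P : Pred (Fin n) 0ℓ) : Set where
  field
    size      : ℕ
    elem      : Fin size → Fin n
    elem∈     : ∀ i → P (elem i)
    elem-inj  : ∀ {i j} → elem i ≡ elem j → i ≡ j
    index     : ∀ x → P x → Fin size
    elem-index : ∀ x p → elem (index x p) ≡ x

  index-elem : ∀ i p → index (elem i) p ≡ i
  index-elem i p = elem-inj (elem-index (elem i) p)

  index-irrelevant : ∀ {x} p q → index x p ≡ index x q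
  index-irrelevant {x} p q = elem-inj (trans (elem-index x p) (sym (elem-index x q)))

enumerate : ∀ {n} {P : Pred (Fin n) 0ℓ} → Decidable P → Enumeration P
enumerate {zero} P? = record
  { size = 0 ; elem = λ () ; elem∈ = λ () ; elem-inj = λ { {()} } ; index = λ () ; elem-index = λ () }
enumerate {suc n} {P} P? with P? zero | enumerate (P? ∘ suc)
... | no ¬p₀ | E = record
  { size = size ; elem = suc ∘ elem ; elem∈ = elem∈ ; elem-inj = elem-inj ∘ FinP.suc-injective
  ; index = λ { zero p → ⊥-elim (¬p₀ p) ; (suc x) p → index x p }
  ; elem-index = λ { zero p → ⊥-elim (¬p₀ p) ; (suc x) p → cong suc (elem-index x p) } }
  where open Enumeration E
... | yes p₀ | E = record
  { size = suc size
  ; elem = λ { zero → zero ; (suc i) → suc (elem i) }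
  ; elem∈ = λ { zero → p₀ ; (suc i) → elem∈ i }
  ; elem-inj = λ { {zero} {zero} _ → refl ; {suc i} {suc j} eq → cong suc (elem-inj (FinP.suc-injective eq)) }
  ; index = λ { zero p → zero ; (suc x) p → suc (index x p) }
  ; elem-index = λ { zero p → refl ; (suc x) p → cong suc (elem-index x p) } }
  where open Enumeration E

-- One side X of a separating vertex v, with the edges B belonging to it.
module Lobe {p} (H : Hypergraph) (f : VFun p H) (conn : Connected H)
  (f≥deg : ∀ v → deg H v ≤ sumFin (f v)) (unpart : ¬ Partitionable H f)
  (v : Fin (nV H)) (φ : Fin (nV H) → Fin p) (tok : Colourings.Token H f φ v)
  {X : Pred (Fin (nV H)) 0ℓ} (X? : Decidable X) {B : Pred (Fin (nE H)) 0ℓ} (B? : Decidable B)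
  (v∈X : X v) (B⊆X : ∀ e → B e → ∀ u → u ∈ₛ inc H e → X u)
  (X⊆B : ∀ e u → u ∈ₛ inc H e → X u → u ≢ v → B e) where

  open Edges H
  open Colourings H f
  open Moves f≥deg unpart

  module 𝕍 = Enumeration (enumerate X?)
  module 𝔼 = Enumeration (enumerate B?)

  lobe : Hypergraph
  lobe = record
    { nV = 𝕍.size
    ; nE = 𝔼.size
    ; inc = λ e → tabulate (λ x → lookup (inc H (𝔼.elem e)) (𝕍.elem x))
    ; inc-size = λ e → ≤-trans (subst (2 ≤_) (∣∣≡# (inc H (𝔼.elem e))) (inc-size H (𝔼.elem e)))
        (subst (# (𝔼.elem e ∋?_) ≤_) (sym (∣∣≡# (tabulate (λ x → lookup (inc H (𝔼.elem e)) (𝕍.elem x)))))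
          (#-injection (𝔼.elem e ∋?_) (_∈?ₛ tabulate (λ x → lookup (inc H (𝔼.elem e)) (𝕍.elem x)))
            (λ u e∋u → 𝕍.index u (B⊆X _ (𝔼.elem∈ e) u e∋u))
            (λ u e∋u → trans (lookup∘tabulate _ (𝕍.index u _)) (trans (cong (lookup (inc H (𝔼.elem e))) (𝕍.elem-index u _)) e∋u))
            λ u w _ _ eq → trans (sym (𝕍.elem-index u _)) (trans (cong 𝕍.elem eq) (𝕍.elem-index w _))))
    }

  open Edges lobe using () renaming (_∋_ to _∋′_; _∋?_ to _∋′?_; Within to Within′; Within? to Within′?)

  inc-lobe : ∀ e x → lookup (inc lobe e) x ≡ lookup (inc H (𝔼.elem e)) (𝕍.elem x)
  inc-lobe e x = lookup∘tabulate _ x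

  ∋′⇒∋ : ∀ {e x} → e ∋′ x → 𝔼.elem e ∋ 𝕍.elem x
  ∋′⇒∋ {e} {x} = trans (sym (inc-lobe e x))

  ∋⇒∋′ : ∀ {e x} → 𝔼.elem e ∋ 𝕍.elem x → e ∋′ x
  ∋⇒∋′ {e} {x} = trans (inc-lobe e x)

  v′ : Fin (nV lobe)
  v′ = 𝕍.index v v∈X

  v′-elem : 𝕍.elem v′ ≡ v
  v′-elem = 𝕍.elem-index v v∈X

  elem≡v : ∀ {x} → 𝕍.elem x ≡ v → x ≡ v′
  elem≡v eq = 𝕍.elem-inj (trans eq (sym v′-elem))

  smaller : (∃ λ y → ¬ X y) → nV lobe < nV H
  smaller (y , ¬Xy) = subst₂ _≤_ (cong suc (#-all (⊤? {𝕍.size}) (λ _ → tt))) (#-all (⊤? {nV H}) (λ _ → tt))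
      (≤-trans (s≤s (#-injection (⊤? {𝕍.size}) X? (λ x _ → 𝕍.elem x) (λ x _ → 𝕍.elem∈ x) (λ _ _ _ _ → 𝕍.elem-inj)))
        (#-strict X? (⊤? {nV H}) (λ _ _ → tt) tt ¬Xy))

  -- The retraction sends everything outside `X` to `v′`. An edge of `H` crossing the preimage of
  -- `S` must belong to `B`, since any other edge collapses to `v′` and cannot cross; so it is an
  -- edge of the lobe.
  connected : Connected lobe
  connected = ≤-<-trans z≤n (FinP.toℕ<n v′) , crossing
    where
    crossing : ∀ S → (∃ λ u → u ∈ₛ S) → (∃ λ u → ¬ (u ∈ₛ S)) →
      ∃ λ e → ∃ λ u → ∃ λ w → e ∋′ u × u ∈ₛ S × e ∋′ w × ¬ (w ∈ₛ S)
    crossing S (a , a∈S) (b , b∉S) = restrict (proj₂ conn ⟦ Ŝ? ⟧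
        (𝕍.elem a , ∈⟦⟧⁺ Ŝ? (subst (_∈ₛ S) (sym (retract-elem a)) a∈S))
        (𝕍.elem b , λ b∈ → b∉S (subst (_∈ₛ S) (retract-elem b) (∈⟦⟧⁻ Ŝ? b∈))))
      where
      retract-dec : ∀ x → Dec (X x) → Fin (nV lobe)
      retract-dec x (yes x∈X) = 𝕍.index x x∈X
      retract-dec x (no _)    = v′
      retract : Fin (nV H) → Fin (nV lobe)
      retract x = retract-dec x (X? x)
      retract-in : ∀ x (d : Dec (X x)) (x∈X : X x) → retract-dec x d ≡ 𝕍.index x x∈X
      retract-in x (yes q)  x∈X = 𝕍.index-irrelevant q x∈X
      retract-in x (no x∉X) x∈X = ⊥-elim (x∉X x∈X)
      retract-elem : ∀ x → retract (𝕍.elem x) ≡ x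
      retract-elem x = trans (retract-in (𝕍.elem x) (X? (𝕍.elem x)) (𝕍.elem∈ x)) (𝕍.index-elem x (𝕍.elem∈ x))
      retract-v : ∀ x → (X x → x ≡ v) → (d : Dec (X x)) → retract-dec x d ≡ v′
      retract-v x only-v (yes x∈X) = elem≡v (trans (𝕍.elem-index x x∈X) (only-v x∈X))
      retract-v x only-v (no _)    = refl
      Ŝ? : Decidable (λ x → retract x ∈ₛ S)
      Ŝ? x = retract x ∈?ₛ S
      restrict : (∃ λ e → ∃ λ u → ∃ λ w → e ∋ u × u ∈ₛ ⟦ Ŝ? ⟧ × e ∋ w × ¬ (w ∈ₛ ⟦ Ŝ? ⟧)) → _
      restrict (e , u , w , e∋u , u∈ , e∋w , w∉) = by-side (B? e)
        where
        r∈ : retract u ∈ₛ S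
        r∈ = ∈⟦⟧⁻ Ŝ? u∈
        r∉ : ¬ (retract w ∈ₛ S)
        r∉ r∈S = w∉ (∈⟦⟧⁺ Ŝ? r∈S)
        by-side : Dec (B e) → ∃ λ e → ∃ λ u → ∃ λ w → e ∋′ u × u ∈ₛ S × e ∋′ w × ¬ (w ∈ₛ S)
        by-side (yes Be) = 𝔼.index e Be , retract u , retract w , lies u e∋u , r∈ , lies w e∋w , r∉
          where
          lies : ∀ x → e ∋ x → 𝔼.index e Be ∋′ retract x
          lies x e∋x = ∋⇒∋′ (subst₂ _∋_ (sym (𝔼.elem-index e Be))
            (sym (trans (cong 𝕍.elem (retract-in x (X? x) (B⊆X e Be x e∋x))) (𝕍.elem-index x _))) e∋x)
        by-side (no ¬Be) = ⊥-elim (r∉ (subst (_∈ₛ S) (trans (to-v u e∋u) (sym (to-v w e∋w))) r∈))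
          where
          to-v : ∀ x → e ∋ x → retract x ≡ v′
          to-v x e∋x = retract-v x (λ x∈X → decidable-stable (x FinP.≟ v) λ x≢v → ¬Be (X⊆B e x e∋x x∈X x≢v)) (X? x)

  -- Of the `f v i` edges of colour `i` at `v`, those in `B`. The shares of complementary edge sets
  -- add up to `f v i`, as merging demands at the merged vertex.
  share : Fin p → ℕ
  share i = # (Mono? φ i v ∩? B?)

  f′ : VFun p lobe
  f′ x i = if does (𝕍.elem x FinP.≟ v) then share i else f (𝕍.elem x) i

  f′-v : ∀ {x} i → 𝕍.elem x ≡ v → f′ x i ≡ share i
  f′-v {x} i eq = cong (λ b → if b then share i else f (𝕍.elem x) i) (does-true (𝕍.elem x FinP.≟ v) eq)

  f′-other : ∀ {x} i → 𝕍.elem x ≢ v → f′ x i ≡ f (𝕍.elem x) i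
  f′-other {x} i neq = cong (λ b → if b then share i else f (𝕍.elem x) i) (dec-false (𝕍.elem x FinP.≟ v) neq)

  f′≥deg : ∀ x → deg lobe x ≤ sumFin (f′ x)
  f′≥deg x with 𝕍.elem x FinP.≟ v
  ... | yes refl = ≤-trans
          (#-injection (_∋′? x) ((_∋? 𝕍.elem x) ∩? B?) (λ e _ → 𝔼.elem e) (λ e e∋x → ∋′⇒∋ e∋x , 𝔼.elem∈ e) (λ _ _ _ _ → 𝔼.elem-inj))
          (Σ#-≥ (λ i → Mono? φ i v ∩? B?) ((_∋? 𝕍.elem x) ∩? B?) λ e (e∋v , Be) → let (i , m) = edge-mono tok e e∋v in i , m , Be)
  ... | no _ = ≤-trans
          (#-injection (_∋′? x) (_∋? 𝕍.elem x) (λ e _ → 𝔼.elem e) (λ e e∋x → ∋′⇒∋ e∋x) (λ _ _ _ _ → 𝔼.elem-inj))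
          (f≥deg (𝕍.elem x))

  -- A colouring of the lobe is glued to `φ` outside `X`. If `Y` meets `X`, its trace in the lobe
  -- has a vertex of small degree. Away from `v` all edges at this vertex lie in `B`. At `v` there
  -- are fewer than `share i` edges in `B`, and the others in `Y` are monochromatic under `φ`, so
  -- the total is below `f v i`.
  unpart′ : ¬ Partitionable lobe f′
  unpart′ part = glue (Colourings.partitionable⇒good lobe f′ part)
    where
    glue : ∃ (Colourings.Good lobe f′ (λ _ → ⊥)) → ⊥
    glue (χ′ , good′) = unpart (good⇒partitionable good)
      where
      χ-dec : ∀ x → Dec (X x) → Fin p
      χ-dec x (yes x∈X) = χ′ (𝕍.index x x∈X)
      χ-dec x (no _)    = φ x
      χ : Colouring
      χ x = χ-dec x (X? x)
      χ-in : ∀ x (d : Dec (X x)) (x∈X : X x) → χ-dec x d ≡ χ′ (𝕍.index x x∈X)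
      χ-in x (yes q)  x∈X = cong χ′ (𝕍.index-irrelevant q x∈X)
      χ-in x (no x∉X) x∈X = ⊥-elim (x∉X x∈X)
      χ-out : ∀ x (d : Dec (X x)) → ¬ X x → χ-dec x d ≡ φ x
      χ-out x (yes x∈X) x∉X = ⊥-elim (x∉X x∈X)
      χ-out x (no _)    x∉X = refl
      χ-elem : ∀ x → χ (𝕍.elem x) ≡ χ′ x
      χ-elem x = trans (χ-in (𝕍.elem x) (X? (𝕍.elem x)) (𝕍.elem∈ x)) (cong χ′ (𝕍.index-elem x (𝕍.elem∈ x)))
      good : Good (λ _ → ⊥) χ
      good i Y Y⊆ ne = by-meet (FinP.any? Y′?)
        where
        Y′? : Decidable (λ x → 𝕍.elem x ∈ₛ Y)
        Y′? x = 𝕍.elem x ∈?ₛ Y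
        Y′ : Subset (nV lobe)
        Y′ = ⟦ Y′? ⟧
        Witness : Set
        Witness = ∃ λ u → u ∈ₛ Y × # (Within? Y u) < f u i
        restrict : ∀ {e x} (Be : B e) → Within Y (𝕍.elem x) e → Within′ Y′ x (𝔼.index e Be)
        restrict {e} {x} Be (e∋x , e⊆Y) = ∋⇒∋′ (subst (_∋ 𝕍.elem x) (sym (𝔼.elem-index e Be)) e∋x) ,
          λ w e∋w → ∈⟦⟧⁺ Y′? (e⊆Y (𝕍.elem w) (subst (_∋ 𝕍.elem w) (𝔼.elem-index e Be) (∋′⇒∋ e∋w)))
        index-inj : ∀ e e′ (p : B e) (q : B e′) → 𝔼.index e p ≡ 𝔼.index e′ q → e ≡ e′
        index-inj e e′ p q eq = trans (sym (𝔼.elem-index e p)) (trans (cong 𝔼.elem eq) (𝔼.elem-index e′ q))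
        locate : ∀ x₀ → 𝕍.elem x₀ ∈ₛ Y → # (Within′? Y′ x₀) < f′ x₀ i → Dec (𝕍.elem x₀ ≡ v) → Witness
        locate x₀ x₀∈Y lt (no x₀≢v) = 𝕍.elem x₀ , x₀∈Y , ≤-<-trans
          (#-injection (Within? Y (𝕍.elem x₀)) (Within′? Y′ x₀) (λ e w → 𝔼.index e (inside e w)) (λ e w → restrict (inside e w) w)
            λ e e′ w w′ → index-inj e e′ (inside e w) (inside e′ w′))
          (subst (# (Within′? Y′ x₀) <_) (f′-other i x₀≢v) lt)
          where
          inside : ∀ e → Within Y (𝕍.elem x₀) e → B e
          inside e (e∋x , _) = X⊆B e (𝕍.elem x₀) e∋x (𝕍.elem∈ x₀) x₀≢v
        locate x₀ x₀∈Y lt (yes x₀≡v) = 𝕍.elem x₀ , x₀∈Y , subst₂ _<_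
          (sym (#-split (Within? Y (𝕍.elem x₀)) B?))
          (trans (sym (#-split (Mono? φ i v) B?)) (trans (Mono-# tok i) (cong (λ u → f u i) (sym x₀≡v))))
          (+-mono-<-≤ (≤-<-trans
              (#-injection (Within? Y (𝕍.elem x₀) ∩? B?) (Within′? Y′ x₀) (λ e (_ , Be) → 𝔼.index e Be) (λ e (w , Be) → restrict Be w)
                λ e e′ (_ , Be) (_ , Be′) → index-inj e e′ Be Be′)
              (subst (# (Within′? Y′ x₀) <_) (f′-v i x₀≡v) lt))
            (#-mono (Within? Y (𝕍.elem x₀) ─? B?) (Mono? φ i v ─? B?) outside))
          where
          outside : ∀ e → Within Y (𝕍.elem x₀) e × ¬ B e → Mono φ i v e × ¬ B e
          outside e ((e∋x , e⊆Y) , ¬Be) = (subst (e ∋_) x₀≡v e∋x , λ u e∋u u≢v →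
            trans (sym (χ-out u (X? u) λ u∈X → ¬Be (X⊆B e u e∋u u∈X u≢v))) (proj₂ (Y⊆ u (e⊆Y u e∋u)))) , ¬Be
        by-meet : Dec (∃ λ x → 𝕍.elem x ∈ₛ Y) → Witness
        by-meet (no ¬meet) = tok i Y (λ y y∈Y → (λ { refl → avoid y y∈Y v∈X }) ,
            trans (sym (χ-out y (X? y) (avoid y y∈Y))) (proj₂ (Y⊆ y y∈Y))) ne
          where
          avoid : ∀ y → y ∈ₛ Y → ¬ X y
          avoid y y∈Y y∈X = ¬meet (𝕍.index y y∈X , subst (_∈ₛ Y) (sym (𝕍.elem-index y y∈X)) y∈Y)
        by-meet (yes (x , x∈Y)) =
          let (x₀ , x₀∈Y′ , lt) = good′ i Y′ (λ y y∈Y′ → (λ ()) , trans (sym (χ-elem y)) (proj₂ (Y⊆ (𝕍.elem y) (∈⟦⟧⁻ Y′? y∈Y′))))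
                                    (x , ∈⟦⟧⁺ Y′? x∈Y)
          in locate x₀ (∈⟦⟧⁻ Y′? x₀∈Y′) lt (𝕍.elem x₀ FinP.≟ v)

split-↔ : ∀ {n} {B : Pred (Fin n) 0ℓ} (B? : Decidable B)
  (E₁ : Enumeration B) (E₂ : Enumeration (λ x → ¬ B x)) →
  (Fin (Enumeration.size E₁) ⊎ Fin (Enumeration.size E₂)) ↔ Fin n
split-↔ {n} {B} B? E₁ E₂ = mk↔ₛ′ to (λ x → from x (B? x)) (λ x → to-from x (B? x)) from-to
  where
  module E₁ = Enumeration E₁
  module E₂ = Enumeration E₂
  to : Fin E₁.size ⊎ Fin E₂.size → Fin n
  to = [ E₁.elem , E₂.elem ]′
  from : ∀ x → Dec (B x) → Fin E₁.size ⊎ Fin E₂.size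
  from x (yes Bx) = inj₁ (E₁.index x Bx)
  from x (no ¬Bx) = inj₂ (E₂.index x ¬Bx)
  to-from : ∀ x d → to (from x d) ≡ x
  to-from x (yes Bx) = E₁.elem-index x Bx
  to-from x (no ¬Bx) = E₂.elem-index x ¬Bx
  from-to₁ : ∀ i d → from (E₁.elem i) d ≡ inj₁ i
  from-to₁ i (yes Bx) = cong inj₁ (E₁.index-elem i Bx)
  from-to₁ i (no ¬Bx) = ⊥-elim (¬Bx (E₁.elem∈ i))
  from-to₂ : ∀ i d → from (E₂.elem i) d ≡ inj₂ i
  from-to₂ i (yes Bx) = ⊥-elim (E₂.elem∈ i Bx)
  from-to₂ i (no ¬Bx) = cong inj₂ (E₂.index-elem i ¬Bx)
  from-to : ∀ s → from (to s) (B? (to s)) ≡ s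
  from-to (inj₁ i) = from-to₁ i (B? (E₁.elem i))
  from-to (inj₂ i) = from-to₂ i (B? (E₂.elem i))

-- The body of `Separating` with both sides as parameters, so that it can be decided by searching
-- through all of them.
Separation : (H : Hypergraph) → Fin (nV H) → Subset (nV H) → Subset (nV H) → Set
Separation H v X₁ X₂ =
  (∀ u → u ∈ₛ X₁ ⊎ u ∈ₛ X₂) × (∀ u → u ∈ₛ X₁ → u ∈ₛ X₂ → u ≡ v) × v ∈ₛ X₁ × v ∈ₛ X₂ ×
  2 ≤ ∣ X₁ ∣ × 2 ≤ ∣ X₂ ∣ × (∀ e → inc H e ⊆ₛ X₁ ⊎ inc H e ⊆ₛ X₂)

separating? : ∀ H → Dec (∃ λ v → ∃ λ X₁ → ∃ λ X₂ → Separation H v X₁ X₂)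
separating? H = FinP.any? λ v → anySubset? λ X₁ → anySubset? λ X₂ →
  FinP.all? (λ u → (u ∈?ₛ X₁) ⊎-dec (u ∈?ₛ X₂)) ×-dec
  FinP.all? (λ u → (u ∈?ₛ X₁) →-dec ((u ∈?ₛ X₂) →-dec (u FinP.≟ v))) ×-dec
  (v ∈?ₛ X₁) ×-dec (v ∈?ₛ X₂) ×-dec (2 ≤? ∣ X₁ ∣) ×-dec (2 ≤? ∣ X₂ ∣) ×-dec
  FinP.all? (λ e → Inside? X₁ e ⊎-dec Inside? X₂ e)
  where open Edges H

module Split {p} (H : Hypergraph) (f : VFun p H) (conn : Connected H)
  (f≥deg : ∀ v → deg H v ≤ sumFin (f v)) (unpart : ¬ Partitionable H f)
  (v : Fin (nV H)) (φ : Fin (nV H) → Fin p) (tok : Colourings.Token H f φ v)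
  (X₁ X₂ : Subset (nV H)) (separation : Separation H v X₁ X₂) where

  open Edges H
  open Colourings H f
  open Moves f≥deg unpart

  cover = proj₁ separation
  meet = proj₁ (proj₂ separation)
  v∈X₁ = proj₁ (proj₂ (proj₂ separation))
  v∈X₂ = proj₁ (proj₂ (proj₂ (proj₂ separation)))
  2≤X₁ = proj₁ (proj₂ (proj₂ (proj₂ (proj₂ separation))))
  2≤X₂ = proj₁ (proj₂ (proj₂ (proj₂ (proj₂ (proj₂ separation)))))
  sides = proj₂ (proj₂ (proj₂ (proj₂ (proj₂ (proj₂ separation)))))

  module L₁ = Lobe H f conn f≥deg unpart v φ tok (_∈?ₛ X₁) (Inside? X₁) v∈X₁ (λ e e⊆X₁ → e⊆X₁)
    (λ e u e∋u u∈X₁ u≢v → [ id , (λ e⊆X₂ → ⊥-elim (u≢v (meet u u∈X₁ (e⊆X₂ u e∋u)))) ]′ (sides e))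
  -- Taking the edges not inside `X₁`, rather than those inside `X₂`, makes the two edge sets
  -- complementary by definition.
  module L₂ = Lobe H f conn f≥deg unpart v φ tok (_∈?ₛ X₂) (λ e → ¬? (Inside? X₁ e)) v∈X₂
    (λ e e⊈X₁ → [ (λ e⊆X₁ → ⊥-elim (e⊈X₁ e⊆X₁)) , id ]′ (sides e))
    (λ e u e∋u u∈X₂ u≢v e⊆X₁ → u≢v (meet u (e⊆X₁ u e∋u) u∈X₂))

  smaller₁ : nV L₁.lobe < nV H
  smaller₁ = let (y , y≢v , y∈X₂) = #-other (_∈?ₛ X₂) (subst (2 ≤_) (∣∣≡# X₂) 2≤X₂) v in
    L₁.smaller (y , λ y∈X₁ → y≢v (meet y y∈X₁ y∈X₂))

  smaller₂ : nV L₂.lobe < nV H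
  smaller₂ = let (y , y≢v , y∈X₁) = #-other (_∈?ₛ X₁) (subst (2 ≤_) (∣∣≡# X₁) 2≤X₁) v in
    L₂.smaller (y , λ y∈X₂ → y≢v (meet y y∈X₁ y∈X₂))

  merge : MergeOf L₁.lobe L₁.v′ L₂.lobe L₂.v′ H v
  merge = record
    { φ₁ = L₁.𝕍.elem
    ; φ₂ = L₂.𝕍.elem
    ; φ₁-inj = λ _ _ → L₁.𝕍.elem-inj
    ; φ₂-inj = λ _ _ → L₂.𝕍.elem-inj
    ; φ₁-v = L₁.v′-elem
    ; φ₂-v = L₂.v′-elem
    ; meet = λ x y eq → L₁.elem≡v (meet (L₁.𝕍.elem x) (L₁.𝕍.elem∈ x) (subst (_∈ₛ X₂) (sym eq) (L₂.𝕍.elem∈ y)))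
    ; cover = λ u → [ (λ u∈X₁ → inj₁ (L₁.𝕍.index u u∈X₁ , L₁.𝕍.elem-index u u∈X₁))
                    , (λ u∈X₂ → inj₂ (L₂.𝕍.index u u∈X₂ , L₂.𝕍.elem-index u u∈X₂)) ]′ (cover u)
    ; ψ = split-↔ (Inside? X₁) (enumerate (Inside? X₁)) (enumerate (λ e → ¬? (Inside? X₁ e)))
    ; inc₁ = λ e x → sym (L₁.inc-lobe e x)
    ; inc₁-im = λ e u e∋u → let u∈X₁ = L₁.𝔼.elem∈ e u e∋u in L₁.𝕍.index u u∈X₁ , L₁.𝕍.elem-index u u∈X₁
    ; inc₂ = λ e x → sym (L₂.inc-lobe e x)
    ; inc₂-im = λ e u e∋u → let u∈X₂ = in-X₂ (L₂.𝔼.elem∈ e) u e∋u in L₂.𝕍.index u u∈X₂ , L₂.𝕍.elem-index u u∈X₂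
    }
    where
    in-X₂ : ∀ {e} → ¬ (inc H e ⊆ₛ X₁) → inc H e ⊆ₛ X₂
    in-X₂ {e} e⊈X₁ = [ (λ e⊆X₁ → ⊥-elim (e⊈X₁ e⊆X₁)) , id ]′ (sides e)

  merged-hard : Hard p L₁.lobe L₁.f′ → Hard p L₂.lobe L₂.f′ → Hard p H f
  merged-hard hard₁ hard₂ = hard-merge L₁.lobe L₁.f′ L₁.v′ L₂.lobe L₂.f′ L₂.v′ H f v hard₁ hard₂ merge
    (λ x x≢v′ i → sym (L₁.f′-other i (x≢v′ ∘ L₁.elem≡v)))
    (λ y y≢v′ i → sym (L₂.f′-other i (y≢v′ ∘ L₂.elem≡v)))
    λ i → trans (sym (Mono-# tok i)) (trans (#-split (Mono? φ i v) (Inside? X₁))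
      (sym (cong₂ _+_ (L₁.f′-v i L₁.v′-elem) (L₂.f′-v i L₂.v′-elem))))

-- Induction on the bound `k`: each lobe misses a vertex of the other side.
unpartitionable⇒hard : ∀ {p} → Fin p → ∀ k H (f : VFun p H) → nV H ≤ k → Connected H →
  (∀ v → deg H v ≤ sumFin (f v)) → ¬ Partitionable H f → Hard p H f
unpartitionable⇒hard c₀ zero H f nV≤ conn f≥deg unpart = ⊥-elim (<⇒≱ (proj₁ conn) nV≤)
unpartitionable⇒hard {p} c₀ (suc k) H f nV≤ conn f≥deg unpart = by-separation (separating? H)
  where
  open Colourings H f
  open Existence c₀ conn f≥deg
  by-separation : Dec (∃ λ v → ∃ λ X₁ → ∃ λ X₂ → Separation H v X₁ X₂) → Hard p H f
  by-separation (no ¬sep) = block⇒hard c₀ H f (conn , λ v sep → ¬sep (v , sep)) f≥deg unpart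
  by-separation (yes (v , X₁ , X₂ , separation)) = by-token (token-exists v)
    where
    by-token : ∃ (λ φ → Token φ v) → Hard p H f
    by-token (φ , tok) = merged-hard
        (unpartitionable⇒hard c₀ k L₁.lobe L₁.f′ (s≤s⁻¹ (≤-trans smaller₁ nV≤)) L₁.connected L₁.f′≥deg L₁.unpart′)
        (unpartitionable⇒hard c₀ k L₂.lobe L₂.f′ (s≤s⁻¹ (≤-trans smaller₂ nV≤)) L₂.connected L₂.f′≥deg L₂.unpart′)
      where open Split H f conn f≥deg unpart v φ tok X₁ X₂ separation

-- Hard pairs are not partitionable

module Obstructions {p} (H : Hypergraph) (f : VFun p H) {χ : Fin (nV H) → Fin p}
  (good : Colourings.Good H f (λ _ → ⊥) χ) where

  open Edges H
  open Joins H
  open Colourings H f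

  good-class : ∀ {P : Pred (Fin (nV H)) 0ℓ} (P? : Decidable P) i → (∀ x → P x → χ x ≡ i) → ∃ P →
    ∃ λ v → P v × # (Within? ⟦ P? ⟧ v) < f v i
  good-class P? i P⊆ (x , px) =
    let (v , v∈ , lt) = good i ⟦ P? ⟧ (λ y y∈ → (λ ()) , P⊆ y (∈⟦⟧⁻ P? y∈)) (x , ∈⟦⟧⁺ P? px) in v , ∈⟦⟧⁻ P? v∈ , lt

  nonzero : ∀ x → f x (χ x) ≢ 0
  nonzero x eq with good-class (FinP._≟ x) (χ x) (λ y y≡x → cong χ y≡x) (x , refl)
  ... | v , refl , lt = n≮0 (subst (# (Within? ⟦ FinP._≟ x ⟧ x) <_) eq lt)

  -- A single vertex already violates a colour of value 0, so all of `H` has colour `j`; then no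
  -- vertex has degree below `f v j`.
  refute-M : 0 < nV H → ∀ j → (∀ v → f v j ≡ deg H v) → (∀ v i → i ≢ j → f v i ≡ 0) → ⊥
  refute-M 0<n j own foreign =
    let (v , _ , lt) = good-class (⊤? {nV H}) j (λ x _ → only-j x) (fromℕ< 0<n , tt) in
    <-irrefl (sym (own v)) (≤-<-trans (#-mono (_∋? v) (Within? ⟦ (⊤? {nV H}) ⟧ v) λ e e∋v → e∋v , λ u _ → ∈⟦⟧⁺ (⊤? {nV H}) {u} tt) lt)
    where
    only-j : ∀ x → χ x ≡ j
    only-j x = decidable-stable (χ x FinP.≟ j) λ χx≢j → nonzero x (foreign x (χ x) χx≢j)

  -- In a class of m vertices every degree is t(m - 1), which goodness puts below `t * ns i`. So m
  -- is at most `ns i`, and the classes together miss a vertex.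
  refute-K : ∀ t (ns : Fin p → ℕ) → 1 ≤ t → 3 ≤ nV H → IsTK H t → sumFin ns ≡ nV H ∸ 1 →
    (∀ v i → f v i ≡ t * ns i) → ⊥
  refute-K t ns 1≤t 3≤n (ordinary , mult≡t) Σns f≡ = <⇒≱ (≤-reflexive n≡) (subst₂ _≤_ (#-all (⊤? {nV H}) λ _ → tt) Σns
      (≤-trans (Σ#-≥ cls? (⊤? {nV H}) λ x _ → χ x , refl) (sumFin-mono class-≤)))
    where
    open Multigraph H ordinary
    n≡ : suc (nV H ∸ 1) ≡ nV H
    n≡ = m+[n∸m]≡n (≤-trans (s≤s z≤n) 3≤n)
    cls? : ∀ i → Decidable (λ x → χ x ≡ i)
    cls? i x = χ x FinP.≟ i
    class-≤ : ∀ i → # (cls? i) ≤ ns i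
    class-≤ i with FinP.any? (cls? i)
    ... | no ¬∃ = subst (_≤ ns i) (sym (#-zero (cls? i) λ x eq → ¬∃ (x , eq))) z≤n
    ... | yes ∃x = let (v , v∈ , lt) = good-class (cls? i) i (λ _ eq → eq) ∃x in
      subst (_≤ ns i) (sym (#-suc (cls? i) v∈)) (*-cancelˡ-< t _ _ (subst₂ _<_ (within v v∈) (f≡ v i) lt))
      where
      within : ∀ v → χ v ≡ i → # (Within? ⟦ cls? i ⟧ v) ≡ t * # (cls? i ∖? v)
      within v v∈ = trans (#-cong (Within? ⟦ cls? i ⟧ v) (Star? (cls? i) v)
          (λ e (e∋v , e⊆) → e∋v , λ u e∋u _ → ∈⟦⟧⁻ (cls? i) (e⊆ u e∋u))
          λ e (e∋v , c) → e∋v , λ u e∋u → ∈⟦⟧⁺ (cls? i) (at e c u e∋u (u FinP.≟ v)))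
        (#Star (cls? i) v t λ u _ u≢v → trans (sym (mult≡# (u≢v ∘ sym))) (mult≡t v u (u≢v ∘ sym)))
        where
        at : ∀ e → (∀ u → e ∋ u → u ≢ v → χ u ≡ i) → ∀ u → e ∋ u → Dec (u ≡ v) → χ u ≡ i
        at e c u e∋u (yes refl) = v∈
        at e c u e∋u (no u≢v)   = c u e∋u u≢v

  -- Two adjacent vertices of one colour would both have degree at least `t` in their pair, so `k`
  -- and `l` colour the cycle properly and alternate. Its first and last vertex, at even distance
  -- `2 * m`, then agree although they are adjacent.
  refute-C : ∀ t (k l : Fin p) → 1 ≤ t → 5 ≤ nV H → Odd (nV H) → IsTC H t →
    (∀ v → f v k ≡ t) → (∀ v → f v l ≡ t) → (∀ v i → i ≢ k → i ≢ l → f v i ≡ 0) → ⊥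
  refute-C t k l 1≤t 5≤n (m , n≡) (ordinary , rotation , joins) fk fl f0 =
      proper first last first≢last (inj₂ (inj₂ (inj₁ (toℕ-first , trans (cong suc toℕ-last) (sym n≡))))) (even m first last toℕ-first toℕ-last)
    where
    open Multigraph H ordinary
    s : Fin (nV H) → Fin (nV H)
    s = Inverse.to rotation
    s-inj : ∀ {i j} → s i ≡ s j → i ≡ j
    s-inj {i} {j} eq = trans (sym (Inverse.strictlyInverseʳ rotation i)) (trans (cong (Inverse.from rotation) eq) (Inverse.strictlyInverseʳ rotation j))
    two : ∀ x → χ x ≡ k ⊎ χ x ≡ l
    two x with χ x FinP.≟ k | χ x FinP.≟ l
    ... | yes eq | _ = inj₁ eq
    ... | no _ | yes eq = inj₂ eq
    ... | no ≢k | no ≢l = ⊥-elim (nonzero x (f0 x (χ x) ≢k ≢l))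
    f-t : ∀ v x → f v (χ x) ≡ t
    f-t v x = [ (λ eq → trans (cong (f v) eq) (fk v)) , (λ eq → trans (cong (f v) eq) (fl v)) ]′ (two x)
    proper : ∀ i j → i ≢ j → CycAdj i j → χ (s i) ≢ χ (s j)
    proper i j i≢j adj eq =
      let (x , x∈ , lt) = good-class uw? (χ u) (λ x → [ cong χ , (λ { refl → sym eq }) ]′) (u , inj₁ refl) in
      <⇒≱ (subst (# (Within? ⟦ uw? ⟧ x) <_) (f-t x u) lt) (subst (_≤ # (Within? ⟦ uw? ⟧ x)) (trans (sym (mult≡# u≢w)) (proj₁ (joins i j i≢j) adj))
        (#-mono (Join? u w) (Within? ⟦ uw? ⟧ x) λ e (e∋u , e∋w) → [ (λ x≡u → subst (e ∋_) (sym x≡u) e∋u) , (λ x≡w → subst (e ∋_) (sym x≡w) e∋w) ]′ x∈ ,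
          λ y e∋y → ∈⟦⟧⁺ uw? (ends e u≢w e∋u e∋w e∋y)))
      where
      u = s i
      w = s j
      uw? = (FinP._≟ u) ∪? (FinP._≟ w)
      u≢w : u ≢ w
      u≢w eq = i≢j (s-inj eq)
    alternates : ∀ {x y z} → χ x ≢ χ y → χ y ≢ χ z → χ x ≡ χ z
    alternates {x} {y} {z} x≢y y≢z with two x | two y | two z
    ... | inj₁ a | inj₁ b | _      = ⊥-elim (x≢y (trans a (sym b)))
    ... | inj₂ a | inj₂ b | _      = ⊥-elim (x≢y (trans a (sym b)))
    ... | _      | inj₁ b | inj₁ c = ⊥-elim (y≢z (trans b (sym c)))
    ... | _      | inj₂ b | inj₂ c = ⊥-elim (y≢z (trans b (sym c)))
    ... | inj₁ a | inj₂ b | inj₁ c = trans a (sym c)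
    ... | inj₂ a | inj₁ b | inj₂ c = trans a (sym c)
    consecutive : ∀ {i j} → suc (toℕ i) ≡ toℕ j → χ (s i) ≢ χ (s j)
    consecutive {i} {j} eq = proper i j (λ { refl → 1+n≢n eq }) (inj₁ eq)
    even : ∀ m (i j : Fin (nV H)) → toℕ i ≡ 0 → toℕ j ≡ 2 * m → χ (s i) ≡ χ (s j)
    even zero i j i≡0 j≡0 = cong (λ x → χ (s x)) (FinP.toℕ-injective (trans i≡0 (sym j≡0)))
    even (suc m) i j i≡0 j≡ = trans (even m i j₀ i≡0 (FinP.toℕ-fromℕ< _))
        (alternates (consecutive {j₀} {j₁} (trans (cong suc (FinP.toℕ-fromℕ< _)) (sym (FinP.toℕ-fromℕ< _))))
                    (consecutive {j₁} {j} (trans (cong suc (FinP.toℕ-fromℕ< _)) (sym j≡′))))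
      where
      j≡′ : toℕ j ≡ 2 + 2 * m
      j≡′ = trans j≡ (*-suc 2 m)
      j<n : 2 + 2 * m < nV H
      j<n = subst (_< nV H) j≡′ (FinP.toℕ<n j)
      j₁ j₀ : Fin (nV H)
      j₁ = fromℕ< (<-trans ≤-refl j<n)
      j₀ = fromℕ< (<-trans ≤-refl (<-trans ≤-refl j<n))
    0<n : 0 < nV H
    0<n = ≤-trans (s≤s z≤n) 5≤n
    first last : Fin (nV H)
    first = fromℕ< 0<n
    last = fromℕ< (subst (2 * m <_) (sym n≡) ≤-refl)
    toℕ-first : toℕ first ≡ 0
    toℕ-first = FinP.toℕ-fromℕ< 0<n
    toℕ-last : toℕ last ≡ 2 * m
    toℕ-last = FinP.toℕ-fromℕ< _
    first≢last : first ≢ last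
    first≢last eq = <⇒≢ (≤-trans (s≤s (s≤s z≤n)) (subst (5 ≤_) n≡ 5≤n)) (cong suc (trans (sym toℕ-first) (trans (cong toℕ eq) toℕ-last)))

module Merging {p} {H₁ : Hypergraph} {f₁ : VFun p H₁} {v₁ : Fin (nV H₁)} {H₂ : Hypergraph} {f₂ : VFun p H₂} {v₂ : Fin (nV H₂)}
  {H : Hypergraph} {f : VFun p H} {w : Fin (nV H)} (m : MergeOf H₁ v₁ H₂ v₂ H w)
  (f-φ₁ : ∀ x → x ≢ v₁ → ∀ i → f (MergeOf.φ₁ m x) i ≡ f₁ x i)
  (f-φ₂ : ∀ y → y ≢ v₂ → ∀ i → f (MergeOf.φ₂ m y) i ≡ f₂ y i)
  (f-w : ∀ i → f w i ≡ f₁ v₁ i + f₂ v₂ i)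
  {χ : Fin (nV H) → Fin p} (good : Colourings.Good H f (λ _ → ⊥) χ) where

  open MergeOf m
  open Edges H
  module E₁ = Edges H₁
  module E₂ = Edges H₂

  to₁ : Fin (nE H₁) → Fin (nE H)
  to₁ e = Inverse.to ψ (inj₁ e)

  to₂ : Fin (nE H₂) → Fin (nE H)
  to₂ e = Inverse.to ψ (inj₂ e)

  to-inj : ∀ {a b} → Inverse.to ψ a ≡ Inverse.to ψ b → a ≡ b
  to-inj {a} {b} eq = trans (sym (Inverse.strictlyInverseʳ ψ a)) (trans (cong (Inverse.from ψ) eq) (Inverse.strictlyInverseʳ ψ b))

  Left : Fin (nE H) → Set
  Left e = ∃ λ e₁ → to₁ e₁ ≡ e

  Left? : Decidable Left
  Left? e = FinP.any? λ e₁ → to₁ e₁ FinP.≟ e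

  module _ (i : Fin p) (Y₁ : Subset (nV H₁)) (Y₂ : Subset (nV H₂)) where

    Image : Pred (Fin (nV H)) 0ℓ
    Image u = (∃ λ x → x ∈ₛ Y₁ × φ₁ x ≡ u) ⊎ (∃ λ y → y ∈ₛ Y₂ × φ₂ y ≡ u)

    Image? : Decidable Image
    Image? = (λ u → FinP.any? λ x → (x ∈?ₛ Y₁) ×-dec (φ₁ x FinP.≟ u)) ∪? (λ u → FinP.any? λ y → (y ∈?ₛ Y₂) ×-dec (φ₂ y FinP.≟ u))

    Y : Subset (nV H)
    Y = ⟦ Image? ⟧

    within₁ : ∀ {x} e → E₁.Within Y₁ x e → Within Y (φ₁ x) (to₁ e)
    within₁ {x} e (e∋x , e⊆) = trans (inc₁ e x) e∋x , inside
      where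
      inside : ∀ u → to₁ e ∋ u → u ∈ₛ Y
      inside u e∋u with inc₁-im e u e∋u
      ... | x′ , refl = ∈⟦⟧⁺ Image? (inj₁ (x′ , e⊆ x′ (trans (sym (inc₁ e x′)) e∋u) , refl))

    within₂ : ∀ {y} e → E₂.Within Y₂ y e → Within Y (φ₂ y) (to₂ e)
    within₂ {y} e (e∋y , e⊆) = trans (inc₂ e y) e∋y , inside
      where
      inside : ∀ u → to₂ e ∋ u → u ∈ₛ Y
      inside u e∋u with inc₂-im e u e∋u
      ... | y′ , refl = ∈⟦⟧⁺ Image? (inj₂ (y′ , e⊆ y′ (trans (sym (inc₂ e y′)) e∋u) , refl))

    -- The union of the images of two bad sets is bad in `H`. At `w` its edges split into those from
    -- `H₁` and those from `H₂`, so the two lower bounds add up to `f w i`; for this, both sets or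
    -- neither must contain the merged vertex. One of them may be empty.
    clash : (∀ x → x ∈ₛ Y₁ → χ (φ₁ x) ≡ i) → (∀ y → y ∈ₛ Y₂ → χ (φ₂ y) ≡ i) → ∃ Image →
      (∀ x → x ∈ₛ Y₁ → f₁ x i ≤ # (E₁.Within? Y₁ x)) → (∀ y → y ∈ₛ Y₂ → f₂ y i ≤ # (E₂.Within? Y₂ y)) →
      (v₁ ∈ₛ Y₁ → v₂ ∈ₛ Y₂) → (v₂ ∈ₛ Y₂ → v₁ ∈ₛ Y₁) → ⊥
    clash χ₁ χ₂ (u₀ , u₀∈) bad₁ bad₂ 1⇒2 2⇒1 =
      let (u , u∈ , lt) = good i Y (λ u u∈ → (λ ()) , coloured u (∈⟦⟧⁻ Image? u∈)) (u₀ , ∈⟦⟧⁺ Image? u₀∈) in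
      <⇒≱ lt (bad u (∈⟦⟧⁻ Image? u∈))
      where
      coloured : ∀ u → Image u → χ u ≡ i
      coloured u (inj₁ (x , x∈ , refl)) = χ₁ x x∈
      coloured u (inj₂ (y , y∈ , refl)) = χ₂ y y∈
      bad-w : v₁ ∈ₛ Y₁ → v₂ ∈ₛ Y₂ → f w i ≤ # (Within? Y w)
      bad-w v₁∈ v₂∈ = subst₂ _≤_ (sym (f-w i)) (sym (#-split (Within? Y w) Left?)) (+-mono-≤
        (≤-trans (bad₁ v₁ v₁∈) (#-injection (E₁.Within? Y₁ v₁) (Within? Y w ∩? Left?) (λ e _ → to₁ e)
          (λ e we → subst (λ u → Within Y u (to₁ e)) φ₁-v (within₁ e we) , e , refl) λ _ _ _ _ eq → inj₁-injective (to-inj eq)))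
        (≤-trans (bad₂ v₂ v₂∈) (#-injection (E₂.Within? Y₂ v₂) (Within? Y w ─? Left?) (λ e _ → to₂ e)
          (λ e we → subst (λ u → Within Y u (to₂ e)) φ₂-v (within₂ e we) , right e) λ _ _ _ _ eq → inj₂-injective (to-inj eq))))
        where
        right : ∀ e → ¬ Left (to₂ e)
        right e (e₁ , eq) with () ← to-inj eq
      bad : ∀ u → Image u → f u i ≤ # (Within? Y u)
      bad u (inj₁ (x , x∈ , refl)) with x FinP.≟ v₁
      ... | yes refl = subst (λ u → f u i ≤ # (Within? Y u)) (sym φ₁-v) (bad-w x∈ (1⇒2 x∈))
      ... | no x≢v₁  = ≤-trans (≤-reflexive (f-φ₁ x x≢v₁ i)) (≤-trans (bad₁ x x∈)
              (#-injection (E₁.Within? Y₁ x) (Within? Y (φ₁ x)) (λ e _ → to₁ e) within₁ λ _ _ _ _ eq → inj₁-injective (to-inj eq)))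
      bad u (inj₂ (y , y∈ , refl)) with y FinP.≟ v₂
      ... | yes refl = subst (λ u → f u i ≤ # (Within? Y u)) (sym φ₂-v) (bad-w (2⇒1 y∈) y∈)
      ... | no y≢v₂  = ≤-trans (≤-reflexive (f-φ₂ y y≢v₂ i)) (≤-trans (bad₂ y y∈)
              (#-injection (E₂.Within? Y₂ y) (Within? Y (φ₂ y)) (λ e _ → to₂ e) within₂ λ _ _ _ _ eq → inj₂-injective (to-inj eq)))

  ∈∅-elim : ∀ {n} {A : Set} (x : Fin n) → x ∈ₛ ∅ → A
  ∈∅-elim x x∈ = ⊥-elim (∉⊥ (lookup⇒[]= x _ x∈))

  -- If `χ` fails on both sides, there are bad sets `Y₁` and `Y₂`. Each contains the merged vertex,
  -- as it would otherwise clash alone, with `∅` as partner. So their colours agree and they clash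
  -- together.
  refute : ¬ Partitionable H₁ f₁ → ¬ Partitionable H₂ f₂ → ⊥
  refute unpart₁ unpart₂ = unpart₁ (Colourings.good⇒partitionable H₁ f₁ {χ ∘ φ₁} good₁)
    where
    module C₁ = Colourings H₁ f₁
    module C₂ = Colourings H₂ f₂
    Bad₁ : Fin p → Subset (nV H₁) → Set
    Bad₁ i Y₁ = ∀ x → x ∈ₛ Y₁ → f₁ x i ≤ # (E₁.Within? Y₁ x)
    Bad₂ : Fin p → Subset (nV H₂) → Set
    Bad₂ i Y₂ = ∀ y → y ∈ₛ Y₂ → f₂ y i ≤ # (E₂.Within? Y₂ y)
    v₁∈bad : ∀ i Y₁ → (∀ x → x ∈ₛ Y₁ → χ (φ₁ x) ≡ i) → ∃ (_∈ₛ Y₁) → Bad₁ i Y₁ → v₁ ∈ₛ Y₁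
    v₁∈bad i Y₁ χ₁ (x , x∈) bad₁ = decidable-stable (v₁ ∈?ₛ Y₁) λ v₁∉ →
      clash i Y₁ ∅ χ₁ (λ x → ∈∅-elim x) (φ₁ x , inj₁ (x , x∈ , refl)) bad₁ (λ x → ∈∅-elim x) (⊥-elim ∘ v₁∉) (∈∅-elim v₂)
    v₂∈bad : ∀ i Y₂ → (∀ y → y ∈ₛ Y₂ → χ (φ₂ y) ≡ i) → ∃ (_∈ₛ Y₂) → Bad₂ i Y₂ → v₂ ∈ₛ Y₂
    v₂∈bad i Y₂ χ₂ (y , y∈) bad₂ = decidable-stable (v₂ ∈?ₛ Y₂) λ v₂∉ →
      clash i ∅ Y₂ (λ x → ∈∅-elim x) χ₂ (φ₂ y , inj₂ (y , y∈ , refl)) (λ x → ∈∅-elim x) bad₂ (∈∅-elim v₁) (⊥-elim ∘ v₂∉)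
    both : ∀ i j Y₁ Y₂ → (∀ x → x ∈ₛ Y₁ → χ (φ₁ x) ≡ i) → (∀ y → y ∈ₛ Y₂ → χ (φ₂ y) ≡ j) →
      ∃ (_∈ₛ Y₁) → ∃ (_∈ₛ Y₂) → Bad₁ i Y₁ → Bad₂ j Y₂ → ⊥
    both i j Y₁ Y₂ χ₁ χ₂ ne₁ ne₂ bad₁ bad₂ = at-w (trans (sym (χ₁ v₁ v₁∈)) (trans (cong χ (trans φ₁-v (sym φ₂-v))) (χ₂ v₂ v₂∈)))
      where
      v₁∈ = v₁∈bad i Y₁ χ₁ ne₁ bad₁
      v₂∈ = v₂∈bad j Y₂ χ₂ ne₂ bad₂
      at-w : i ≡ j → ⊥
      at-w refl = clash i Y₁ Y₂ χ₁ χ₂ (φ₁ v₁ , inj₁ (v₁ , v₁∈ , refl)) bad₁ bad₂ (λ _ → v₂∈) (λ _ → v₁∈)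
    good₁ : C₁.Good (λ _ → ⊥) (χ ∘ φ₁)
    good₁ i Y₁ Y₁⊆ ne₁ with FinP.any? (λ x → (x ∈?ₛ Y₁) ×-dec (# (E₁.Within? Y₁ x) <? f₁ x i))
    ... | yes found = found
    ... | no none₁ = ⊥-elim (unpart₂ (C₂.good⇒partitionable {χ ∘ φ₂} good₂))
      where
      good₂ : C₂.Good (λ _ → ⊥) (χ ∘ φ₂)
      good₂ j Y₂ Y₂⊆ ne₂ with FinP.any? (λ y → (y ∈?ₛ Y₂) ×-dec (# (E₂.Within? Y₂ y) <? f₂ y j))
      ... | yes found = found
      ... | no none₂ = ⊥-elim (both i j Y₁ Y₂ (λ x x∈ → proj₂ (Y₁⊆ x x∈)) (λ y y∈ → proj₂ (Y₂⊆ y y∈)) ne₁ ne₂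
              (λ x x∈ → ≮⇒≥ λ lt → none₁ (x , x∈ , lt)) (λ y y∈ → ≮⇒≥ λ lt → none₂ (y , y∈ , lt)))

hard⇒unpartitionable : ∀ {p H} {f : VFun p H} → Hard p H f → ¬ Partitionable H f
hard⇒unpartitionable (hard-M H f j ((0<n , _) , _) own foreign) part =
  Obstructions.refute-M H f (proj₂ (Colourings.partitionable⇒good H f part)) 0<n j own foreign
hard⇒unpartitionable (hard-K H f t ns 1≤t 3≤n isTK _ Σns f≡) part =
  Obstructions.refute-K H f (proj₂ (Colourings.partitionable⇒good H f part)) t ns 1≤t 3≤n isTK Σns f≡
hard⇒unpartitionable (hard-C H f t k l 1≤t 5≤n odd isTC k≢l fk fl f0) part =
  Obstructions.refute-C H f (proj₂ (Colourings.partitionable⇒good H f part)) t k l 1≤t 5≤n odd isTC fk fl f0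
hard⇒unpartitionable (hard-merge H₁ f₁ v₁ H₂ f₂ v₂ H f w hard₁ hard₂ m f-φ₁ f-φ₂ f-w) part =
  Merging.refute {f₁ = f₁} {f₂ = f₂} {f = f} m f-φ₁ f-φ₂ f-w (proj₂ (Colourings.partitionable⇒good H f part))
    (hard⇒unpartitionable hard₁) (hard⇒unpartitionable hard₂)

theorem1p2 : (p : ℕ) → 1 ≤ p → (H : Hypergraph) → Connected H →
    (f : VFun p H) → (∀ v → deg H v ≤ sumFin (f v)) →
    (¬ Partitionable H f) ⇔ Hard p H f
theorem1p2 (suc p) _ H conn f f≥deg =
  mk⇔ (unpartitionable⇒hard zero (nV H) H f ≤-refl conn f≥deg) hard⇒unpartitionable
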